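{- For $n\ge 7$, \[ |\mathsf{ASM}_{n,3}(2143,3412)| = \sum_{k=0}^{n-5} 2^{n-4-k}\binom{2k}{k} - (n-2)2^{n-5}, \] and for $n\le 6$, $|\mathsf{ASM}_{n,3}(2143,3412)|=0$. The generating function is \[ \sum_{n\ge 0}|\mathsf{ASM}_{n,3}(2143,3412)|\,z^n = \frac{2z^5}{(1-2z)\sqrt{1-4z}} - \frac{2z^5(1-2z^2)}{(1-2z)^2}. \]
   Context: An alternating sign matrix (ASM) is a square matrix with entries in $\{0,1,-1\}$ such that every row and every column sums to $1$ and the nonzero entries of each row and each column alternate in sign. A permutation $\pi\in S_k$ is identified with the $k\times k$ matrix whose row $i$ has a $1$ in column $\pi(i)$ and $0$ elsewhere. An $n\times n$ ASM $A$ classically contains $\pi\in S_k$ if there are order-preserving injections $f,g:[k]\to[n]$ with $A_{f(i),g(\pi(i))}=1$ for all $i$; otherwise $A$ classically avoids $\pi$. $\mathsf{ASM}_{n,3}(2143,3412)$ denotes the set of $n\times n$ ASMs classically avoiding both $2143$ and $3412$ and having exactly three entries equal to $-1$. -}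

module Defs where

open import Data.Nat as ℕ using (ℕ; zero; suc; _≤_; _<_)
open import Data.Nat.Combinatorics using (_C_)
open import Data.Integer as ℤ using (ℤ; +_; -[1+_]; 0ℤ; 1ℤ; -1ℤ; _≟_)
open import Data.Fin using (Fin)
import Data.Fin as Fin
open import Data.Vec as Vec using (Vec; lookup)
open import Data.List as List using (List; []; _∷_; filter; length; upTo; concat)
open import Data.Product using (Σ; _×_; ∃; ∃-syntax)
open import Data.Sum using (_⊎_)
open import Data.Irrelevant using (Irrelevant)
open import Relation.Nullary using (¬_)
open import Relation.Binary.PropositionalEquality using (_≡_; _≢_)

Matrix : ℕ → Set
Matrix n = Vec (Vec ℤ n) n

entry : ∀ {n} → Matrix n → Fin n → Fin n → ℤ
entry A i j = lookup (lookup A i) j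

row : ∀ {n} → Matrix n → Fin n → List ℤ
row A i = Vec.toList (lookup A i)

col : ∀ {n} → Matrix n → Fin n → List ℤ
col A j = Vec.toList (Vec.map (λ r → lookup r j) A)

nonzeros : List ℤ → List ℤ
nonzeros xs = filter (λ x → Relation.Nullary.¬? (x ≟ 0ℤ)) xs
  where import Relation.Nullary

Alternates : List ℤ → Set
Alternates []           = Data.Unit.⊤ where import Data.Unit
Alternates (x ∷ [])     = Data.Unit.⊤ where import Data.Unit
Alternates (x ∷ y ∷ xs) = (x ℤ.* y ℤ.< 0ℤ) × Alternates (y ∷ xs)

GoodLine : List ℤ → Set
GoodLine xs = (List.foldr ℤ._+_ 0ℤ xs ≡ 1ℤ) × Alternates (nonzeros xs)

IsASM : ∀ {n} → Matrix n → Set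
IsASM {n} A =
  (∀ i j → (entry A i j ≡ 0ℤ) ⊎ (entry A i j ≡ 1ℤ) ⊎ (entry A i j ≡ -1ℤ))
  × (∀ i → GoodLine (row A i))
  × (∀ j → GoodLine (col A j))

negCount : ∀ {n} → Matrix n → ℕ
negCount {n} A = length (filter (λ x → x ≟ -1ℤ) (concat (List.map (row A) (List.allFin n))))

Increasing : ∀ {k n} → (Fin k → Fin n) → Set
Increasing {k} f = ∀ (i j : Fin k) → i Fin.< j → f i Fin.< f j

-- classical containment of the permutation matrix of π ∈ S_k
-- (π given as its one-line function, 0-indexed)
Contains : ∀ {n k} → Matrix n → (Fin k → Fin k) → Set
Contains {n} {k} A π =
  Σ (Fin k → Fin n) λ f → Σ (Fin k → Fin n) λ g →
    Increasing f × Increasing g × (∀ i → entry A (f i) (g (π i)) ≡ 1ℤ)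

Avoids : ∀ {n k} → Matrix n → (Fin k → Fin k) → Set
Avoids A π = ¬ Contains A π

p2143 : Fin 4 → Fin 4
p2143 Fin.zero = Fin.suc Fin.zero
p2143 (Fin.suc Fin.zero) = Fin.zero
p2143 (Fin.suc (Fin.suc Fin.zero)) = Fin.suc (Fin.suc (Fin.suc Fin.zero))
p2143 (Fin.suc (Fin.suc (Fin.suc Fin.zero))) = Fin.suc (Fin.suc Fin.zero)

p3412 : Fin 4 → Fin 4
p3412 Fin.zero = Fin.suc (Fin.suc Fin.zero)
p3412 (Fin.suc Fin.zero) = Fin.suc (Fin.suc (Fin.suc Fin.zero))
p3412 (Fin.suc (Fin.suc Fin.zero)) = Fin.zero
p3412 (Fin.suc (Fin.suc (Fin.suc Fin.zero))) = Fin.suc Fin.zero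

-- ASM_{n,3}(2143,3412) as a subtype; proof components are irrelevant so
-- that elements are determined by the matrix (the set, not proofs, is counted)
InASM3 : ∀ {n} → Matrix n → Set
InASM3 A = IsASM A × Avoids A p2143 × Avoids A p3412 × (negCount A ≡ 3)

ASM3 : ℕ → Set
ASM3 n = Σ (Matrix n) λ A → Irrelevant (InASM3 A)

formula : ℕ → ℤ
formula n =
  (+ List.foldr ℕ._+_ 0 (List.map (λ k → (2 ℕ.^ (n ℕ.∸ 4 ℕ.∸ k)) ℕ.* ((2 ℕ.* k) C k)) (upTo (n ℕ.∸ 4))))
  ℤ.- (+ ((n ℕ.∸ 2) ℕ.* (2 ℕ.^ (n ℕ.∸ 5))))

Series : Set
Series = ℕ → ℤ

_*ₛ_ : Series → Series → Series
(f *ₛ g) m = List.foldr ℤ._+_ 0ℤ (List.map (λ k → f k ℤ.* g (m ℕ.∸ k)) (upTo (suc m)))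

_-ₛ_ : Series → Series → Series
(f -ₛ g) m = f m ℤ.- g m

poly : List ℤ → Series
poly []       m       = 0ℤ
poly (c ∷ cs) zero    = c
poly (c ∷ cs) (suc m) = poly cs m

_≈ₛ_ : Series → Series → Set
f ≈ₛ g = ∀ m → f m ≡ g m

1-2z : Series
1-2z = poly (1ℤ ∷ ℤ.- (+ 2) ∷ [])

2z⁵ : Series
2z⁵ = poly (0ℤ ∷ 0ℤ ∷ 0ℤ ∷ 0ℤ ∷ 0ℤ ∷ + 2 ∷ [])

1-2z² : Series
1-2z² = poly (1ℤ ∷ 0ℤ ∷ ℤ.- (+ 2) ∷ [])

1-4z : Series
1-4z = poly (1ℤ ∷ ℤ.- (+ 4) ∷ [])

-- S is the formal square root √(1−4z) (constant term 1; unique)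
IsSqrt1-4z : Series → Set
IsSqrt1-4z S = (S 0 ≡ 1ℤ) × ((S *ₛ S) ≈ₛ 1-4z)

-- F = 2z⁵/((1−2z)√(1−4z)) − 2z⁵(1−2z²)/(1−2z)²,  stated after multiplying
-- through by the unit (1−2z)²·√(1−4z) of ℤ[[z]]:
--   (1−2z)² · S · F = 2z⁵(1−2z) − 2z⁵(1−2z²) · S
GFIdentity : Series → Set
GFIdentity F = ∀ S → IsSqrt1-4z S →
  (((1-2z *ₛ 1-2z) *ₛ S) *ₛ F) ≈ₛ ((2z⁵ *ₛ 1-2z) -ₛ ((2z⁵ *ₛ 1-2z²) *ₛ S))

{-# OPTIONS --safe #-}

-- An entry −1 has ones in all four directions, so two of them in general position produce 2143 or 3412: the three entries
-- −1 share a line, say the row r (the other case is the transpose). Avoidance then forces row r to read + − + − + − + on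
-- seven consecutive columns, the ones of the rows r − 1 and r + 1 to lie in the middle one of these columns, and all other
-- ones to lie on two increasing and two decreasing quadrants, which are determined by the half in which each outer row and
-- column has its one. Hence, with N = n − 7, the matrices with a given orientation correspond to pairs of lattice paths, of
-- lengths N + 4 and N and of opposite monotony, with a marked common vertex. Two such paths that meet have one more common
-- vertex than common edges, and contracting a common edge leads from N to N − 1. Therefore the number total N satisfies
-- total N = 2 · total (N − 1) + C(2N+4,N+2) − 2 · 2^N, the last two terms counting the pairs of paths that meet.
module Submission where

open import Defs
open import Data.Bool as Bool using (Bool; true; false; not)
open import Data.Empty using (⊥; ⊥-elim)
open import Data.Fin as Fin using (Fin; toℕ; fromℕ<)
import Data.Fin.Properties as Finₚ
open import Data.Fin.Properties using (+↔⊎; *↔×; 1↔⊤; toℕ<n; toℕ-fromℕ<)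
open import Data.Integer as ℤ using (ℤ; 0ℤ; 1ℤ; -1ℤ; +<+; -<+) renaming (_+_ to _⊹_; _*_ to _⋆_; _-_ to _⊖_)
import Data.Integer.Properties as ℤₚ
import Data.Integer.Tactic.RingSolver as ℤRS
open import Data.Irrelevant using ([_])
open import Data.List as List using (List; []; _∷_; _++_; applyUpTo; concat; filter; foldr; length)
open import Data.List.Properties using (∷-injectiveʳ; filter-++; length-++; length-map; map-tabulate; map-upTo)
open import Data.Nat
open import Data.Nat.Properties
open import Data.Nat.Combinatorics using (_C_; nCk+nC[k+1]≡[n+1]C[k+1]; nCn≡1)
open import Data.Nat.Tactic.RingSolver using (solve-∀)
open import Data.Product using (Σ; _×_; _,_; proj₁; proj₂; ∃)
open import Data.Product.Function.NonDependent.Propositional using (_×-↔_)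
open import Data.Sum using (_⊎_; inj₁; inj₂; swap)
open import Data.Sum.Function.Propositional using (_⊎-↔_)
open import Data.Unit using (tt)
open import Data.Vec as Vec using (Vec; []; _∷_; lookup; tabulate)
open import Data.Vec.Properties using (lookup∘tabulate; tabulate∘lookup; tabulate-cong; lookup-map; ≡-dec)
open import Function using (_∘_)
open import Function.Bundles using (_↔_; mk↔ₛ′; Inverse)
open import Function.Properties.Inverse using (↔-sym; ↔-trans)
open import Relation.Binary.Definitions using (tri<; tri≈; tri>)
open import Relation.Binary.PropositionalEquality
open import Relation.Nullary using (¬_; Dec; yes; no; does; recompute)
open import Relation.Nullary.Decidable using (_×-dec_; _⊎-dec_; ¬?; decidable-stable; map′)

-- Counting words and pairs of lattice paths

-- Reversing the order of the rows or of the columns exchanges 2143 and 3412 and permutes the four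
-- quadrants. The geometry is therefore stated for arbitrary strict total orders and for relations
-- `One` and `Neg`, argued for one quadrant and transferred by flips.
--
-- A quadrant is the increasing matching of its marked rows with its marked columns, so words
-- determine it as soon as the numbers of marks agree. Besides the N outer columns, the columns `d1`
-- and `d3` have a one in the upper and in the lower half; these four ones take up four more rows,
-- whence N + 4 outer rows. The words `L` and `R` are the short path cut at the marked vertex, `U`
-- and `D` the long path cut there.
--
-- A long path fills the rectangle of the short path `Q` enlarged by one on each side. Exactly two
-- such paths miss `Q`, passing around its ends, which explains 2 · 2^N; summing the numbers of all
-- long paths over `Q` gives C(2N+4,N+2) by Vandermonde. The excess of common vertices over common
-- edges is obtained by induction along `Q`, where `crossings` sorts the long paths by the height at
-- which they enter a column.

trues falses : List Bool → ℕ
trues []           = 0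
trues (true  ∷ w) = suc (trues w)
trues (false ∷ w) = trues w
falses []           = 0
falses (true  ∷ w) = falses w
falses (false ∷ w) = suc (falses w)

-- Lattice paths with a steps of one kind and b of the other.
paths : ℕ → ℕ → ℕ
paths zero    _       = 1
paths (suc a) zero    = 1
paths (suc a) (suc b) = paths a (suc b) + paths (suc a) b

paths-zeroʳ : ∀ a → paths a 0 ≡ 1
paths-zeroʳ zero    = refl
paths-zeroʳ (suc a) = refl

paths≡C : ∀ a b → paths a b ≡ (a + b) C a
paths≡C zero    b       = refl
paths≡C (suc a) zero    = sym (trans (cong (λ m → suc m C suc a) (+-identityʳ a)) (nCn≡1 (suc a)))
paths≡C (suc a) (suc b) = trans (cong₂ _+_ (paths≡C a (suc b)) (trans (paths≡C (suc a) b) (cong (_C suc a) (sym (+-suc a b)))))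
                            (nCk+nC[k+1]≡[n+1]C[k+1] (a + suc b) a)

sumV : ℕ → (List Bool → ℕ) → ℕ
sumV zero    f = f []
sumV (suc N) f = sumV N (f ∘ (true ∷_)) + sumV N (f ∘ (false ∷_))

-- The sum over the pairs L, R of total length N, that is over paths with a marked vertex; the first
-- summand has the mark before all letters.
sumS : ℕ → (List Bool → List Bool → ℕ) → ℕ
sumS zero    f = f [] []
sumS (suc N) f = sumV (suc N) (f []) + (sumS N (f ∘ (true ∷_)) + sumS N (f ∘ (false ∷_)))

sumV-cong : ∀ N {f g} → (∀ Q → f Q ≡ g Q) → sumV N f ≡ sumV N g
sumV-cong zero    h = h []
sumV-cong (suc N) h = cong₂ _+_ (sumV-cong N (h ∘ (true ∷_))) (sumV-cong N (h ∘ (false ∷_)))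

interchange : ∀ a b c d → (a + b) + (c + d) ≡ (a + c) + (b + d)
interchange = solve-∀

sumV-+ : ∀ N f g → sumV N (λ Q → f Q + g Q) ≡ sumV N f + sumV N g
sumV-+ zero    f g = refl
sumV-+ (suc N) f g = trans (cong₂ _+_ (sumV-+ N _ _) (sumV-+ N _ _)) (interchange (sumV N (f ∘ (true ∷_))) _ _ _)

sumV-const : ∀ N c → sumV N (λ _ → c) ≡ c * 2 ^ N
sumV-const zero    c = sym (*-identityʳ c)
sumV-const (suc N) c = trans (cong₂ _+_ (sumV-const N c) (sumV-const N c)) (lem c (2 ^ N))
  where lem : ∀ c p → c * p + c * p ≡ c * (p + (p + 0))
        lem = solve-∀

-- For a fixed path, the sums over its vertices and over its edges. The letter of the edge is
-- dropped by `edges`, which is the contraction.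
splits edges : (List Bool → List Bool → ℕ) → List Bool → ℕ
splits f []      = f [] []
splits f (x ∷ Q) = f [] (x ∷ Q) + splits (f ∘ (x ∷_)) Q
edges f []      = 0
edges f (x ∷ Q) = f [] Q + edges (f ∘ (x ∷_)) Q

sumV-splits : ∀ N f → sumV N (splits f) ≡ sumS N f
sumV-splits zero    f = refl
sumV-splits (suc N) f =
  trans (cong₂ _+_ (part true) (part false))
        (interchange (sumV N (f [] ∘ (true ∷_))) (sumS N (f ∘ (true ∷_))) _ _)
  where part : ∀ x → sumV N (splits f ∘ (x ∷_)) ≡ sumV N (f [] ∘ (x ∷_)) + sumS N (f ∘ (x ∷_))
        part x = trans (sumV-+ N _ _) (cong (sumV N (f [] ∘ (x ∷_)) +_) (sumV-splits N _))

-- Contracting the marked edge leaves a path of length N with a marked vertex. The factor 2 is the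
-- lost letter, which may be either of the two.
sumV-edges : ∀ N f → sumV (suc N) (edges f) ≡ 2 * sumS N f
sumV-edges zero    f = lem (f [] [])
  where lem : ∀ a → (a + 0) + (a + 0) ≡ a + (a + 0)
        lem = solve-∀
sumV-edges (suc N) f =
  trans (cong₂ _+_ (part true) (part false))
        (lem (sumV (suc N) (f [])) (sumS N (f ∘ (true ∷_))) (sumS N (f ∘ (false ∷_))))
  where part : ∀ x → sumV (suc N) (edges f ∘ (x ∷_)) ≡ sumV (suc N) (f []) + 2 * sumS N (f ∘ (x ∷_))
        part x = trans (sumV-+ (suc N) (f []) (edges (f ∘ (x ∷_)))) (cong (sumV (suc N) (f []) +_) (sumV-edges N (f ∘ (x ∷_))))
        lem : ∀ v s t → (v + 2 * s) + (v + 2 * t) ≡ 2 * (v + (s + t))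
        lem = solve-∀

-- A partial Vandermonde sum: the paths entering column a at height at most m, grouped by that height.
crossings : ℕ → ℕ → ℕ → ℕ → ℕ
crossings a x zero    c = paths a 0 * paths x c
crossings a x (suc m) c = paths a (suc m) * paths x c + crossings a x m (suc c)

-- A path that enters column a at height at most m either enters column a + 1 at such a height too,
-- or takes the vertical step from height m to m + 1 in between; the product counts the latter
-- paths.
crossings-conserve : ∀ a x m c → crossings a (suc x) m (suc c) ≡ crossings (suc a) x m (suc c) + paths (suc a) m * paths (suc x) c
crossings-conserve a x zero c rewrite paths-zeroʳ a = lem (paths x (suc c)) (paths (suc x) c)
  where lem : ∀ p q → (p + q) + 0 ≡ (p + 0) + (q + 0)
        lem = solve-∀
crossings-conserve a x (suc m) c rewrite crossings-conserve a x m (suc c) =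
  lem (paths a (suc m)) (paths x (suc c)) (paths (suc x) c) (crossings (suc a) x m (suc (suc c))) (paths (suc a) m)
  where lem : ∀ p q r k s → p * (q + r) + (k + s * (q + r)) ≡ ((p + s) * q + k) + (p + s) * r
        lem = solve-∀

-- For a = 0 the paths are sorted by the height of their first horizontal step; those which climb
-- beyond height m before it are the `paths (suc x) c`.
crossings-hockey : ∀ x m c → crossings 0 x m (suc c) + paths (suc x) c ≡ paths (suc x) (suc c + m)
crossings-hockey x zero    c rewrite +-identityʳ c | *-identityˡ (paths x (suc c)) = refl
crossings-hockey x (suc m) c = trans (lem (paths x (suc c)) (crossings 0 x m (suc (suc c))) (paths (suc x) c))
                      (trans (crossings-hockey x m (suc c)) (cong (paths (suc x)) (cong suc (sym (+-suc c m)))))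
  where lem : ∀ p k q → (p + 0 + k) + q ≡ k + (p + q)
        lem = solve-∀

-- The paths through the vertex of Q = L ++ R between L and R, in the rectangle of Q enlarged by one on each side;
-- a and c count the letters of Q already passed. The same product counts the paths through an edge of L ++ x ∷ R.
pairs : ℕ → ℕ → List Bool → List Bool → ℕ
pairs a c L R = paths (suc (a + trues L)) (suc (falses R)) * paths (suc (trues R)) (suc (c + falses L))

splits-cong : ∀ {f g} → (∀ L R → f L R ≡ g L R) → ∀ Q → splits f Q ≡ splits g Q
splits-cong h []      = h [] []
splits-cong h (x ∷ Q) = cong₂ _+_ (h [] (x ∷ Q)) (splits-cong (h ∘ (x ∷_)) Q)

edges-cong : ∀ {f g} → (∀ L R → f L R ≡ g L R) → ∀ Q → edges f Q ≡ edges g Q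
edges-cong h []      = refl
edges-cong h (x ∷ Q) = cong₂ _+_ (h [] Q) (edges-cong (h ∘ (x ∷_)) Q)

pairs-true : ∀ a c L R → pairs a c (true ∷ L) R ≡ pairs (suc a) c L R
pairs-true a c L R rewrite +-suc a (trues L) = refl

pairs-false : ∀ a c L R → pairs a c (false ∷ L) R ≡ pairs a (suc c) L R
pairs-false a c L R rewrite +-suc c (falses L) = refl

-- A path meeting Q has exactly one more vertex than edges in common with it, since one of them increases and the other
-- decreases; crossings counts the paths that meet the rest of Q, and one that passes around its end.
splits-edges : ∀ a c Q → splits (pairs a c) Q + 1 ≡ edges (pairs a c) Q + crossings a (suc (trues Q)) (suc (falses Q)) (suc c)
splits-edges a c [] rewrite +-identityʳ a | +-identityʳ c | paths-zeroʳ a = lem (paths a 1) (paths 1 c)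
  where lem : ∀ p q → (p + 1) * (1 + q) + 1 ≡ p * (1 + q) + (1 + (1 + q) + 0)
        lem = solve-∀
splits-edges a c (true ∷ Q)
  rewrite splits-cong (pairs-true a c) Q | edges-cong (pairs-true a c) Q
        | +-identityʳ a | +-identityʳ c
        | crossings-conserve a (suc (trues Q)) (suc (falses Q)) c
  = trans (+-assoc _ (splits (pairs (suc a) c) Q) 1)
   (trans (cong (paths (suc a) (suc (falses Q)) * paths (suc (suc (trues Q))) (suc c) +_) (splits-edges (suc a) c Q))
    (lem (paths (suc a) (suc (falses Q))) (paths (suc (trues Q)) (suc c)) (paths (suc (suc (trues Q))) c)
         (edges (pairs (suc a) c) Q) (crossings (suc a) (suc (trues Q)) (suc (falses Q)) (suc c))))
  where lem : ∀ p q r s k → p * (q + r) + (s + k) ≡ (p * q + s) + (k + p * r)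
        lem = solve-∀
splits-edges a c (false ∷ Q)
  rewrite splits-cong (pairs-false a c) Q | edges-cong (pairs-false a c) Q
        | +-identityʳ a | +-identityʳ c
  = trans (+-assoc _ (splits (pairs a (suc c)) Q) 1)
   (trans (cong (paths (suc a) (suc (suc (falses Q))) * paths (suc (trues Q)) (suc c) +_) (splits-edges a (suc c) Q))
    (lem (paths a (suc (suc (falses Q)))) (paths (suc a) (suc (falses Q))) (paths (suc (trues Q)) (suc c))
         (edges (pairs a (suc c)) Q) (crossings a (suc (trues Q)) (suc (falses Q)) (suc (suc c)))))
  where lem : ∀ p q r s k → (p + q) * r + (s + k) ≡ (q * r + s) + (p * r + k)
        lem = solve-∀

-- The second 1 comes from `crossings-hockey` and is the path around the other end of Q. Hence all
-- but two of the paths in the enlarged rectangle meet Q.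
splits-total : ∀ Q → splits (pairs 0 0) Q + 2 ≡ edges (pairs 0 0) Q + paths (2 + trues Q) (2 + falses Q)
splits-total Q = trans (sym (+-assoc (splits (pairs 0 0) Q) 1 1))
                (trans (cong (_+ 1) (splits-edges 0 0 Q))
                (trans (+-assoc (edges (pairs 0 0) Q) _ 1)
                       (cong (edges (pairs 0 0) Q +_) (crossings-hockey (suc (trues Q)) (suc (falses Q)) 0))))

-- Vandermonde by Pascal's rule: the two choices of the first letter supply the two summands of a
-- path count with both sides one longer, so every letter raises i and j together.
sumV-paths : ∀ N i j → sumV N (λ Q → paths (i + trues Q) (j + falses Q)) ≡ paths (i + N) (j + N)
sumV-paths zero    i j = refl
sumV-paths (suc N) i j =
  trans (sym (sumV-+ N _ _))
 (trans (sumV-cong N (λ Q → trans (cong₂ (λ x y → paths x (j + falses Q) + paths (i + trues Q) y) (+-suc i (trues Q)) (+-suc j (falses Q)))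
                                   (+-comm (paths (suc (i + trues Q)) (j + falses Q)) _)))
 (trans (sumV-paths N (suc i) (suc j)) (sym (cong₂ paths (+-suc i N) (+-suc j N)))))

total : ℕ → ℕ
total N = sumS N (pairs 0 0)

total-sum : ∀ N → total N + 2 * 2 ^ N ≡ sumV N (edges (pairs 0 0)) + paths (2 + N) (2 + N)
total-sum N = trans (cong₂ _+_ (sym (sumV-splits N (pairs 0 0))) (sym (sumV-const N 2)))
         (trans (sym (sumV-+ N (splits (pairs 0 0)) (λ _ → 2)))
         (trans (sumV-cong N splits-total)
         (trans (sumV-+ N (edges (pairs 0 0)) _)
                (cong (sumV N (edges (pairs 0 0)) +_) (sumV-paths N 2 2)))))

total-suc : ∀ N → total (suc N) + 2 * 2 ^ suc N ≡ 2 * total N + paths (3 + N) (3 + N)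
total-suc N = trans (total-sum (suc N)) (cong (_+ paths (3 + N) (3 + N)) (sumV-edges N (pairs 0 0)))

-- Words, split words and shapes as finite sets

data Word : ℕ → ℕ → Set where
  []  : Word 0 0
  t∷_ : ∀ {a b} → Word a b → Word (suc a) b
  f∷_ : ∀ {a b} → Word a b → Word a (suc b)

toList : ∀ {a b} → Word a b → List Bool
toList []     = []
toList (t∷ w) = true ∷ toList w
toList (f∷ w) = false ∷ toList w

fromList : ∀ w → Word (trues w) (falses w)
fromList []          = []
fromList (true ∷ w)  = t∷ fromList w
fromList (false ∷ w) = f∷ fromList w

toList-fromList : ∀ w → toList (fromList w) ≡ w
toList-fromList []          = refl
toList-fromList (true ∷ w)  = cong (true ∷_) (toList-fromList w)
toList-fromList (false ∷ w) = cong (false ∷_) (toList-fromList w)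

trues-toList : ∀ {a b} (w : Word a b) → trues (toList w) ≡ a
trues-toList []     = refl
trues-toList (t∷ w) = cong suc (trues-toList w)
trues-toList (f∷ w) = trues-toList w

falses-toList : ∀ {a b} (w : Word a b) → falses (toList w) ≡ b
falses-toList []     = refl
falses-toList (t∷ w) = falses-toList w
falses-toList (f∷ w) = cong suc (falses-toList w)

toList-injective : ∀ {a b} (v w : Word a b) → toList v ≡ toList w → v ≡ w
toList-injective []     []     _ = refl
toList-injective (t∷ v) (t∷ w) p = cong t∷_ (toList-injective v w (∷-injectiveʳ p))
toList-injective (f∷ v) (f∷ w) p = cong f∷_ (toList-injective v w (∷-injectiveʳ p))
toList-injective (t∷ v) (f∷ w) ()
toList-injective (f∷ v) (t∷ w) ()

Word↔Fin : ∀ a b → Word a b ↔ Fin (paths a b)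
Word↔Fin zero    zero    = ↔-trans (mk↔ₛ′ (λ _ → tt) (λ _ → []) (λ _ → refl) (λ { [] → refl })) (↔-sym 1↔⊤)
Word↔Fin zero    (suc b) = ↔-trans (mk↔ₛ′ (λ { (f∷ w) → w }) f∷_ (λ _ → refl) (λ { (f∷ _) → refl })) (Word↔Fin 0 b)
Word↔Fin (suc a) zero    = subst (λ m → Word (suc a) 0 ↔ Fin m) (paths-zeroʳ a)
  (↔-trans (mk↔ₛ′ (λ { (t∷ w) → w }) t∷_ (λ _ → refl) (λ { (t∷ _) → refl })) (Word↔Fin a 0))
Word↔Fin (suc a) (suc b) =
  ↔-trans (mk↔ₛ′ (λ { (t∷ w) → inj₁ w ; (f∷ w) → inj₂ w }) (λ { (inj₁ w) → t∷ w ; (inj₂ w) → f∷ w })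
                 (λ { (inj₁ _) → refl ; (inj₂ _) → refl }) (λ { (t∷ _) → refl ; (f∷ _) → refl }))
 (↔-trans (Word↔Fin a (suc b) ⊎-↔ Word↔Fin (suc a) b) (↔-sym +↔⊎))

-- A word of length N with a marked cut, built along the recursion of `sumS`: letters before the cut
-- are constructors, those after it form a vector.
data Split : ℕ → Set where
  stop : ∀ {N} → Vec Bool N → Split N
  _∷_  : ∀ {N} → Bool → Split N → Split (suc N)

leftWord rightWord : ∀ {N} → Split N → List Bool
leftWord (stop R)  = []
leftWord (x ∷ s)   = x ∷ leftWord s
rightWord (stop R) = Vec.toList R
rightWord (x ∷ s)  = rightWord s

Split-length : ∀ {N} (s : Split N) → length (leftWord s) + length (rightWord s) ≡ N
Split-length (stop [])      = refl
Split-length (stop (x ∷ R)) = cong suc (Split-length (stop R))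
Split-length (x ∷ s)        = cong suc (Split-length s)

mkSplit : ∀ (L R : List Bool) → Split (length L + length R)
mkSplit []      R = stop (Vec.fromList R)
mkSplit (x ∷ L) R = x ∷ mkSplit L R

leftWord-mkSplit : ∀ (L R : List Bool) → leftWord (mkSplit L R) ≡ L
leftWord-mkSplit []      R = refl
leftWord-mkSplit (x ∷ L) R = cong (x ∷_) (leftWord-mkSplit L R)

rightWord-mkSplit : ∀ (L R : List Bool) → rightWord (mkSplit L R) ≡ R
rightWord-mkSplit []      []      = refl
rightWord-mkSplit []      (x ∷ R) = cong (x ∷_) (rightWord-mkSplit [] R)
rightWord-mkSplit (x ∷ L) R       = rightWord-mkSplit L R

Vec-toList-injective : ∀ {N} (v w : Vec Bool N) → Vec.toList v ≡ Vec.toList w → v ≡ w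
Vec-toList-injective []      []       _ = refl
Vec-toList-injective (x ∷ v) (y ∷ w) p with Vec.toList v | Vec.toList w | Vec-toList-injective v w
Vec-toList-injective (x ∷ v) (.x ∷ w) refl | l | .l | ih = cong (x ∷_) (ih refl)

Split-injective : ∀ {N} (s t : Split N) → leftWord s ≡ leftWord t → rightWord s ≡ rightWord t → s ≡ t
Split-injective (stop R) (stop R') _ q = cong stop (Vec-toList-injective R R' q)
Split-injective (x ∷ s) (y ∷ t) p q with leftWord s | leftWord t | Split-injective s t
Split-injective (x ∷ s) (.x ∷ t) refl q | l | .l | ih = cong (x ∷_) (ih refl q)
Split-injective (stop R) (y ∷ t) ()
Split-injective (x ∷ s) (stop R) ()

Vec↔Fin : ∀ N {X : List Bool → Set} {f} → (∀ l → X l ↔ Fin (f l)) → (Σ (Vec Bool N) (X ∘ Vec.toList)) ↔ Fin (sumV N f)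
Vec↔Fin zero    h = ↔-trans (mk↔ₛ′ (λ { ([] , x) → x }) ([] ,_) (λ _ → refl) (λ { ([] , x) → refl })) (h [])
Vec↔Fin (suc N) h =
  ↔-trans (mk↔ₛ′ (λ { ((true ∷ v) , x) → inj₁ (v , x) ; ((false ∷ v) , x) → inj₂ (v , x) })
                 (λ { (inj₁ (v , x)) → (true ∷ v) , x ; (inj₂ (v , x)) → (false ∷ v) , x })
                 (λ { (inj₁ _) → refl ; (inj₂ _) → refl })
                 (λ { ((true ∷ _) , _) → refl ; ((false ∷ _) , _) → refl }))
 (↔-trans (Vec↔Fin N (h ∘ (true ∷_)) ⊎-↔ Vec↔Fin N (h ∘ (false ∷_))) (↔-sym +↔⊎))

Split↔Fin : ∀ N {X : List Bool → List Bool → Set} {f} → (∀ l r → X l r ↔ Fin (f l r)) →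
            (Σ (Split N) λ s → X (leftWord s) (rightWord s)) ↔ Fin (sumS N f)
Split↔Fin zero h = ↔-trans (mk↔ₛ′ (λ { (stop [] , x) → x }) (stop [] ,_) (λ _ → refl) (λ { (stop [] , x) → refl })) (h [] [])
Split↔Fin (suc N) h =
  ↔-trans (mk↔ₛ′ (λ { (stop v , x) → inj₁ (v , x) ; ((true ∷ s) , x) → inj₂ (inj₁ (s , x)) ; ((false ∷ s) , x) → inj₂ (inj₂ (s , x)) })
                 (λ { (inj₁ (v , x)) → stop v , x ; (inj₂ (inj₁ (s , x))) → (true ∷ s) , x ; (inj₂ (inj₂ (s , x))) → (false ∷ s) , x })
                 (λ { (inj₁ _) → refl ; (inj₂ (inj₁ _)) → refl ; (inj₂ (inj₂ _)) → refl })
                 (λ { (stop _ , _) → refl ; ((true ∷ _) , _) → refl ; ((false ∷ _) , _) → refl }))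
 (↔-trans (Vec↔Fin (suc N) (h []) ⊎-↔ ↔-trans (Split↔Fin N (h ∘ (true ∷_)) ⊎-↔ Split↔Fin N (h ∘ (false ∷_))) (↔-sym +↔⊎))
          (↔-sym +↔⊎))

-- The two words are the parts of the long path before and after the marked vertex; their indices
-- are the arguments of the two factors of `pairs 0 0`.
Shape : ℕ → Set
Shape N = Σ (Split N) λ s → Word (suc (trues (leftWord s))) (suc (falses (rightWord s)))
                          × Word (suc (trues (rightWord s))) (suc (falses (leftWord s)))

Shape↔Fin : ∀ N → Shape N ↔ Fin (total N)
Shape↔Fin N = Split↔Fin N (λ l r → ↔-trans (Word↔Fin (suc (trues l)) (suc (falses r)) ×-↔ Word↔Fin (suc (trues r)) (suc (falses l))) (↔-sym *↔×))

-- Lines of an alternating sign matrix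

nth : ∀ {A : Set} → A → List A → ℕ → A
nth d []       _       = d
nth d (x ∷ xs) zero    = x
nth d (x ∷ xs) (suc i) = nth d xs i

-- For entries 0, 1 and -1 these conditions amount to alternation with sum 1. Unlike partial sums
-- they mention only the order, so that reversal and the passage from rows to columns are immediate.
record Line (_≺_ : ℕ → ℕ → Set) (One Neg : ℕ → Set) : Set where
  field
    sepOne : ∀ {x y} → One x → One y → x ≺ y → ∃ λ z → x ≺ z × z ≺ y × Neg z
    sepNeg : ∀ {x y} → Neg x → Neg y → x ≺ y → ∃ λ z → x ≺ z × z ≺ y × One z
    before : ∀ {x} → Neg x → ∃ λ z → z ≺ x × One z
    after  : ∀ {x} → Neg x → ∃ λ z → x ≺ z × One z
    some   : ∃ One
open Line public

flipLine : ∀ {_≺_ One Neg} → Line _≺_ One Neg → Line (λ x y → y ≺ x) One Neg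
flipLine ℓ = record
  { sepOne = λ p q l → let (z , a , b , m) = sepOne ℓ q p l in z , b , a , m
  ; sepNeg = λ p q l → let (z , a , b , m) = sepNeg ℓ q p l in z , b , a , m
  ; before = after ℓ ; after = before ℓ ; some = some ℓ }

Ternary : ℤ → Set
Ternary x = (x ≡ 0ℤ) ⊎ (x ≡ 1ℤ) ⊎ (x ≡ -1ℤ)

LineOf : (ℕ → ℤ) → Set
LineOf f = Line _<_ (λ x → f x ≡ 1ℤ) (λ x → f x ≡ -1ℤ)

-- Run s t xs: reading xs, the partial sums stay in {0,1} and move from s to t, where true stands for 1.
data Run : Bool → Bool → List ℤ → Set where
  []   : ∀ {s} → Run s s []
  skip : ∀ {s t xs} → Run s t xs → Run s t (0ℤ ∷ xs)
  up   : ∀ {t xs} → Run true t xs → Run false t (1ℤ ∷ xs)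
  down : ∀ {t xs} → Run false t xs → Run true t (-1ℤ ∷ xs)

sign : Bool → ℤ
sign true  = 1ℤ
sign false = -1ℤ

level : Bool → ℤ
level true  = 1ℤ
level false = 0ℤ

sum : List ℤ → ℤ
sum = foldr ℤ._+_ 0ℤ

-- `sign s` stands for the last nonzero entry already read, which fixes the level s on which the run
-- continues.
runAfter : ∀ s xs → (∀ i → Ternary (nth 0ℤ xs i)) → Alternates (sign s ∷ nonzeros xs) → ∃ λ t → Run s t xs
runAfter s [] _ _ = s , []
runAfter s (x ∷ xs) tern alt with tern 0
runAfter s     (_ ∷ xs) tern alt       | inj₁ refl        = let (t , r) = runAfter s xs (tern ∘ suc) alt in t , skip r
runAfter false (_ ∷ xs) tern (_ , alt) | inj₂ (inj₁ refl) = let (t , r) = runAfter true xs (tern ∘ suc) alt in t , up r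
runAfter true  (_ ∷ xs) tern (_ , alt) | inj₂ (inj₂ refl) = let (t , r) = runAfter false xs (tern ∘ suc) alt in t , down r
runAfter true  (_ ∷ xs) tern (+<+ () , alt) | inj₂ (inj₁ refl)
runAfter false (_ ∷ xs) tern (+<+ () , alt) | inj₂ (inj₂ refl)

runOf : ∀ xs → (∀ i → Ternary (nth 0ℤ xs i)) → Alternates (nonzeros xs) → ∃ λ s → ∃ λ t → Run s t xs
runOf [] _ _ = true , true , []
runOf (x ∷ xs) tern alt with tern 0
... | inj₁ refl        = let (s , t , r) = runOf xs (tern ∘ suc) alt in s , t , skip r
-- The first nonzero entry dictates the initial level: 0 before a 1, and 1 before a -1.
... | inj₂ (inj₁ refl) = let (t , r) = runAfter true xs (tern ∘ suc) alt in false , t , up r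
... | inj₂ (inj₂ refl) = let (t , r) = runAfter false xs (tern ∘ suc) alt in true , t , down r

flank : Bool → Bool → ℤ
flank s t = level t ℤ.- level s

Run-sum : ∀ {s t xs} → Run s t xs → sum xs ≡ flank s t
Run-sum {true}  []  = refl
Run-sum {false} []  = refl
Run-sum {s} {t} (skip r) = trans (cong (λ z → 0ℤ ℤ.+ z) (Run-sum r)) (lem s t)
  where lem : ∀ s t → 0ℤ ℤ.+ flank s t ≡ flank s t
        lem true true = refl
        lem true false = refl
        lem false true = refl
        lem false false = refl
Run-sum {t = true}  (up r)   = cong (λ z → 1ℤ ℤ.+ z) (Run-sum r)
Run-sum {t = false} (up r)   = cong (λ z → 1ℤ ℤ.+ z) (Run-sum r)
Run-sum {t = true}  (down r) = cong (λ z → -1ℤ ℤ.+ z) (Run-sum r)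
Run-sum {t = false} (down r) = cong (λ z → -1ℤ ℤ.+ z) (Run-sum r)

-- The sum is the final level minus the initial one, so the value 1 leaves only the passage from 0
-- to 1.
Good⇒Run : ∀ {xs} → (∀ i → Ternary (nth 0ℤ xs i)) → GoodLine xs → Run false true xs
Good⇒Run {xs} tern (s≡1 , alt) with runOf xs tern alt
... | false , true  , r = r
... | true  , true  , r with () ← trans (sym s≡1) (Run-sum r)
... | false , false , r with () ← trans (sym s≡1) (Run-sum r)
... | true  , false , r with () ← trans (sym s≡1) (Run-sum r)

Run⇒Alternates : ∀ {s t xs} → Run s t xs → Alternates (sign s ∷ nonzeros xs)
Run⇒Alternates {true}  []       = tt
Run⇒Alternates {false} []       = tt
Run⇒Alternates (skip r) = Run⇒Alternates r
Run⇒Alternates (up r)   = -<+ , Run⇒Alternates r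
Run⇒Alternates (down r) = -<+ , Run⇒Alternates r

Alternates-tail : ∀ x xs → Alternates (x ∷ xs) → Alternates xs
Alternates-tail x []       _        = tt
Alternates-tail x (y ∷ xs) (_ , alt) = alt

Run⇒Good : ∀ {xs} → Run false true xs → GoodLine xs
Run⇒Good r = Run-sum r , Alternates-tail -1ℤ _ (Run⇒Alternates r)

private
  O N : List ℤ → ℕ → Set
  O xs i = nth 0ℤ xs i ≡ 1ℤ
  N xs i = nth 0ℤ xs i ≡ -1ℤ

toNeg : ∀ {t xs y} → Run true t xs → O xs y → ∃ λ z → z < y × N xs z
toNeg {y = zero}  (skip r) ()
toNeg {y = suc y} (skip r) o = let (z , l , m) = toNeg r o in suc z , s<s l , m
toNeg {y = zero}  (down r) ()
toNeg {y = suc y} (down r) o = zero , z<s , refl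

toOne : ∀ {t xs y} → Run false t xs → N xs y → ∃ λ z → z < y × O xs z
toOne {y = zero}  (skip r) ()
toOne {y = suc y} (skip r) o = let (z , l , m) = toOne r o in suc z , s<s l , m
toOne {y = zero}  (up r) ()
toOne {y = suc y} (up r) o = zero , z<s , refl

someOne : ∀ {xs} → Run false true xs → ∃ (O xs)
someOne (skip r) = let (z , m) = someOne r in suc z , m
someOne (up r)   = zero , refl

Run-sepOne : ∀ {s t xs x y} → Run s t xs → O xs x → O xs y → x < y → ∃ λ z → x < z × z < y × N xs z
Run-sepOne {x = zero}  {y = suc y} (skip r) () q l
Run-sepOne {x = zero}  {y = suc y} (down r) () q l
Run-sepOne {x = zero}  {y = suc y} (up r)   p q l = let (z , a , m) = toNeg r q in suc z , z<s , s<s a , m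
Run-sepOne {x = suc x} {y = suc y} (skip r) p q (s≤s l) = let (z , a , b , m) = Run-sepOne r p q l in suc z , s<s a , s<s b , m
Run-sepOne {x = suc x} {y = suc y} (up r)   p q (s≤s l) = let (z , a , b , m) = Run-sepOne r p q l in suc z , s<s a , s<s b , m
Run-sepOne {x = suc x} {y = suc y} (down r) p q (s≤s l) = let (z , a , b , m) = Run-sepOne r p q l in suc z , s<s a , s<s b , m

Run-sepNeg : ∀ {s t xs x y} → Run s t xs → N xs x → N xs y → x < y → ∃ λ z → x < z × z < y × O xs z
Run-sepNeg {x = zero}  {y = suc y} (skip r) () q l
Run-sepNeg {x = zero}  {y = suc y} (up r) () q l
Run-sepNeg {x = zero}  {y = suc y} (down r)   p q l = let (z , a , m) = toOne r q in suc z , z<s , s<s a , m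
Run-sepNeg {x = suc x} {y = suc y} (skip r) p q (s≤s l) = let (z , a , b , m) = Run-sepNeg r p q l in suc z , s<s a , s<s b , m
Run-sepNeg {x = suc x} {y = suc y} (up r)   p q (s≤s l) = let (z , a , b , m) = Run-sepNeg r p q l in suc z , s<s a , s<s b , m
Run-sepNeg {x = suc x} {y = suc y} (down r) p q (s≤s l) = let (z , a , b , m) = Run-sepNeg r p q l in suc z , s<s a , s<s b , m

Run-after : ∀ {s xs x} → Run s true xs → N xs x → ∃ λ z → x < z × O xs z
Run-after {x = zero}  (skip r) ()
Run-after {x = zero}  (up r) ()
Run-after {x = zero}  (down r) p = let (z , m) = someOne r in suc z , z<s , m
Run-after {x = suc x} (skip r) p = let (z , a , m) = Run-after r p in suc z , s<s a , m
Run-after {x = suc x} (up r)   p = let (z , a , m) = Run-after r p in suc z , s<s a , m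
Run-after {x = suc x} (down r) p = let (z , a , m) = Run-after r p in suc z , s<s a , m

Good⇒Line : ∀ {xs} → (∀ i → Ternary (nth 0ℤ xs i)) → GoodLine xs → LineOf (nth 0ℤ xs)
Good⇒Line {xs} tern g = let r = Good⇒Run {xs} tern g in record
  { sepOne = Run-sepOne r ; sepNeg = Run-sepNeg r ; before = toOne r ; after = Run-after r ; some = someOne r }

-- What the rest of a line has to satisfy when it is entered on the given level. On level 0 a
-- further one must come, since the run has to end on level 1.
Entry : Bool → (ℕ → Set) → (ℕ → Set) → Set
Entry true  One Neg = ∀ {y} → One y → ∃ λ z → z < y × Neg z
Entry false One Neg = (∀ {y} → Neg y → ∃ λ z → z < y × One z) × ∃ One

Sep : (ℕ → Set) → (ℕ → Set) → Set
Sep P Q = ∀ {x y} → P x → P y → x < y → ∃ λ z → x < z × z < y × Q z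

Sep-suc : ∀ {P Q} → Sep P Q → Sep (P ∘ suc) (Q ∘ suc)
Sep-suc {P} {Q} h p q l with h p q (s<s l)
... | suc z , s≤s a , s≤s b , m = z , a , b , m

After-suc : ∀ {P Q : ℕ → Set} → (∀ {x} → P x → ∃ λ z → x < z × Q z) → ∀ {x} → P (suc x) → ∃ λ z → x < z × Q (suc z)
After-suc h p with h p
... | suc z , s≤s l , q = z , l , q

-- The separation conditions pass to the tail unchanged. After a 1 the new `Entry` comes from the
-- separation of ones; after a -1 it comes from the separation of negative entries together with the
-- one that follows.
Line⇒Run : ∀ s xs → (∀ i → Ternary (nth 0ℤ xs i)) → Sep (O xs) (N xs) → Sep (N xs) (O xs) →
           (∀ {x} → N xs x → ∃ λ z → x < z × O xs z) → Entry s (O xs) (N xs) → Run s true xs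
Line⇒Run true  [] tern so sn af en = []
Line⇒Run false [] tern so sn af (_ , _ , ())
Line⇒Run s (x ∷ xs) tern so sn af en with tern 0
Line⇒Run s (_ ∷ xs) tern so sn af en | inj₁ refl =
  skip (Line⇒Run s xs (tern ∘ suc) (Sep-suc so) (Sep-suc sn) (After-suc af) (en' s en))
  where
  en' : ∀ s → Entry s (O (0ℤ ∷ xs)) (N (0ℤ ∷ xs)) → Entry s (O xs) (N xs)
  en' true  h o with h {suc _} o
  ... | suc z , s≤s a , m = z , a , m
  ... | zero , _ , ()
  en' false (h , suc z , o) = (λ m → pre (h {suc _} m)) , z , o
    where pre : ∀ {y} → (∃ λ z → z < suc y × O (0ℤ ∷ xs) z) → ∃ λ z → z < y × O xs z
          pre (suc z , s≤s a , m) = z , a , m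
Line⇒Run true  (_ ∷ xs) tern so sn af en | inj₂ (inj₁ refl) with en {0} refl
... | _ , () , _
Line⇒Run false (_ ∷ xs) tern so sn af en | inj₂ (inj₁ refl) =
  up (Line⇒Run true xs (tern ∘ suc) (Sep-suc so) (Sep-suc sn) (After-suc af) en')
  where
  en' : ∀ {y} → O xs y → ∃ λ z → z < y × N xs z
  en' o with so {0} {suc _} refl o z<s
  ... | suc z , _ , s≤s a , m = z , a , m
Line⇒Run true (_ ∷ xs) tern so sn af en | inj₂ (inj₂ refl) =
  down (Line⇒Run false xs (tern ∘ suc) (Sep-suc so) (Sep-suc sn) (After-suc af) (en' , en''))
  where
  en' : ∀ {y} → N xs y → ∃ λ z → z < y × O xs z
  en' m with sn {0} {suc _} refl m z<s
  ... | suc z , _ , s≤s a , o = z , a , o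
  en'' : ∃ (O xs)
  en'' with af {0} refl
  ... | suc z , _ , o = z , o
Line⇒Run false (_ ∷ xs) tern so sn af (h , _) | inj₂ (inj₂ refl) with h {0} refl
... | _ , () , _

Line⇒Good : ∀ {xs} → (∀ i → Ternary (nth 0ℤ xs i)) → LineOf (nth 0ℤ xs) → GoodLine xs
Line⇒Good {xs} tern ℓ = Run⇒Good (Line⇒Run false xs tern (sepOne ℓ) (sepNeg ℓ) (after ℓ) (before ℓ , some ℓ))

-- Three negative entries in one row

record Ord (_≺_ : ℕ → ℕ → Set) : Set where
  field
    tr  : ∀ {x y z} → x ≺ y → y ≺ z → x ≺ z
    irr : ∀ {x} → ¬ (x ≺ x)
    cmp : ∀ x y → x ≺ y ⊎ x ≡ y ⊎ y ≺ x
  asym : ∀ {x y} → x ≺ y → ¬ (y ≺ x)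
  asym p q = irr (tr p q)

rev3 : ∀ {A B C : Set} → A ⊎ B ⊎ C → C ⊎ B ⊎ A
rev3 (inj₁ a)        = inj₂ (inj₂ a)
rev3 (inj₂ (inj₁ b)) = inj₂ (inj₁ b)
rev3 (inj₂ (inj₂ c)) = inj₁ c

rev4 : ∀ {A B C D : Set} → (A ⊎ B) ⊎ (C ⊎ D) → (D ⊎ C) ⊎ (B ⊎ A)
rev4 (inj₁ (inj₁ a)) = inj₂ (inj₂ a)
rev4 (inj₁ (inj₂ b)) = inj₂ (inj₁ b)
rev4 (inj₂ (inj₁ c)) = inj₁ (inj₂ c)
rev4 (inj₂ (inj₂ d)) = inj₁ (inj₁ d)

flipOrd : ∀ {_≺_} → Ord _≺_ → Ord (λ x y → y ≺ x)
flipOrd o = record { tr = λ p q → tr q p ; irr = irr ; cmp = λ x y → rev3 (cmp x y) }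
  where open Ord o

Free2143 Free3412 : (ℕ → ℕ → Set) → (ℕ → ℕ → Set) → (ℕ → ℕ → Set) → Set
Free2143 One _≺_ _⊰_ = ∀ {i1 i2 i3 i4 j1 j2 j3 j4} → One i1 j2 → One i2 j1 → One i3 j4 → One i4 j3 →
                       i1 ≺ i2 → i2 ≺ i3 → i3 ≺ i4 → j1 ⊰ j2 → j2 ⊰ j3 → j3 ⊰ j4 → ⊥
Free3412 One _≺_ _⊰_ = ∀ {i1 i2 i3 i4 j1 j2 j3 j4} → One i1 j3 → One i2 j4 → One i3 j1 → One i4 j2 →
                       i1 ≺ i2 → i2 ≺ i3 → i3 ≺ i4 → j1 ⊰ j2 → j2 ⊰ j3 → j3 ⊰ j4 → ⊥

-- The entries of an alternating sign matrix whose negative entries are (r,d1), (r,d2), (r,d3), with respect to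
-- arbitrary orders ≺ on rows and ⊰ on columns; reversing an order exchanges the two patterns.
record Geo (n : ℕ) (One Neg : ℕ → ℕ → Set) (_≺_ _⊰_ : ℕ → ℕ → Set)
           (r c1 d1 c2 d2 c3 d3 c4 u1 u2 u3 l1 l2 l3 : ℕ) : Set where
  field
    ordR    : Ord _≺_
    ordC    : Ord _⊰_
    rowLine : ∀ {i} → i < n → Line _⊰_ (One i) (Neg i)
    colLine : ∀ {j} → j < n → Line _≺_ (λ i → One i j) (λ i → Neg i j)
    dom     : ∀ {i j} → One i j → i < n × j < n
    no2143  : Free2143 One _≺_ _⊰_
    no3412  : Free3412 One _≺_ _⊰_
    negs    : ∀ {i j} → Neg i j → i ≡ r × (j ≡ d1 ⊎ j ≡ d2 ⊎ j ≡ d3)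
    ones    : ∀ {j} → One r j → (j ≡ c1 ⊎ j ≡ c2) ⊎ (j ≡ c3 ⊎ j ≡ c4)
    c1d1    : c1 ⊰ d1
    d1c2    : d1 ⊰ c2
    c2d2    : c2 ⊰ d2
    d2c3    : d2 ⊰ c3
    c3d3    : c3 ⊰ d3
    d3c4    : d3 ⊰ c4
    oc1     : One r c1
    oc2     : One r c2
    oc3     : One r c3
    oc4     : One r c4
    ou1     : One u1 d1
    ou2     : One u2 d2
    ou3     : One u3 d3
    u1r     : u1 ≺ r
    u2r     : u2 ≺ r
    u3r     : u3 ≺ r
    ol1     : One l1 d1
    ol2     : One l2 d2
    ol3     : One l3 d3
    rl1     : r ≺ l1
    rl2     : r ≺ l2
    rl3     : r ≺ l3

module _ {n : ℕ} {One Neg : ℕ → ℕ → Set} where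

  -- Read from the other end, the columns of 2143 give 3412 and conversely, so the two avoidance
  -- fields trade places.
  flipC : ∀ {_≺_ _⊰_ r c1 d1 c2 d2 c3 d3 c4 u1 u2 u3 l1 l2 l3} →
          Geo n One Neg _≺_ _⊰_ r c1 d1 c2 d2 c3 d3 c4 u1 u2 u3 l1 l2 l3 →
          Geo n One Neg _≺_ (λ x y → y ⊰ x) r c4 d3 c3 d2 c2 d1 c1 u3 u2 u1 l3 l2 l1
  flipC g = record
    { ordR = ordR ; ordC = flipOrd ordC ; rowLine = flipLine ∘ rowLine ; colLine = colLine ; dom = dom
    ; no2143 = λ a b c d p q s x y z → no3412 a b c d p q s z y x
    ; no3412 = λ a b c d p q s x y z → no2143 a b c d p q s z y x
    ; negs = λ m → proj₁ (negs m) , rev3 (proj₂ (negs m)) ; ones = rev4 ∘ ones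
    ; c1d1 = d3c4 ; d1c2 = c3d3 ; c2d2 = d2c3 ; d2c3 = c2d2 ; c3d3 = d1c2 ; d3c4 = c1d1
    ; oc1 = oc4 ; oc2 = oc3 ; oc3 = oc2 ; oc4 = oc1
    ; ou1 = ou3 ; ou2 = ou2 ; ou3 = ou1 ; u1r = u3r ; u2r = u2r ; u3r = u1r
    ; ol1 = ol3 ; ol2 = ol2 ; ol3 = ol1 ; rl1 = rl3 ; rl2 = rl2 ; rl3 = rl1 }
    where
    open Geo g

  flipR : ∀ {_≺_ _⊰_ r c1 d1 c2 d2 c3 d3 c4 u1 u2 u3 l1 l2 l3} →
          Geo n One Neg _≺_ _⊰_ r c1 d1 c2 d2 c3 d3 c4 u1 u2 u3 l1 l2 l3 →
          Geo n One Neg (λ x y → y ≺ x) _⊰_ r c1 d1 c2 d2 c3 d3 c4 l1 l2 l3 u1 u2 u3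
  flipR g = record
    { ordR = flipOrd ordR ; ordC = ordC ; rowLine = rowLine ; colLine = flipLine ∘ colLine ; dom = dom
    ; no2143 = λ a b c d p q s x y z → no3412 d c b a s q p x y z
    ; no3412 = λ a b c d p q s x y z → no2143 d c b a s q p x y z
    ; negs = negs ; ones = ones
    ; c1d1 = c1d1 ; d1c2 = d1c2 ; c2d2 = c2d2 ; d2c3 = d2c3 ; c3d3 = c3d3 ; d3c4 = d3c4
    ; oc1 = oc1 ; oc2 = oc2 ; oc3 = oc3 ; oc4 = oc4
    ; ou1 = ol1 ; ou2 = ol2 ; ou3 = ol3 ; u1r = rl1 ; u2r = rl2 ; u3r = rl3
    ; ol1 = ou1 ; ol2 = ou2 ; ol3 = ou3 ; rl1 = u1r ; rl2 = u2r ; rl3 = u3r }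
    where open Geo g

module Corner {n One Neg _≺_ _⊰_ r c1 d1 c2 d2 c3 d3 c4 u1 u2 u3 l1 l2 l3}
              (g : Geo n One Neg _≺_ _⊰_ r c1 d1 c2 d2 c3 d3 c4 u1 u2 u3 l1 l2 l3) where
  open Geo g public
  module R = Ord ordR
  module C = Ord ordC

  d1d2 : d1 ⊰ d2
  d1d2 = C.tr d1c2 c2d2
  d2d3 : d2 ⊰ d3
  d2d3 = C.tr d2c3 c3d3
  d1d3 : d1 ⊰ d3
  d1d3 = C.tr d1d2 d2d3

  -- Two ones of a column are separated by a negative entry, which would have to lie in row r, below
  -- both.
  colUpper : ∀ {i i' j} → One i j → One i' j → i ≺ r → i' ≺ r → i ≡ i'
  colUpper {i} {i'} p q ir i'r with R.cmp i i'
  ... | inj₁ l with (z , _ , b , m) ← sepOne (colLine (proj₂ (dom p))) p q l with refl , _ ← negs m = ⊥-elim (R.asym b i'r)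
  ... | inj₂ (inj₁ e) = e
  ... | inj₂ (inj₂ l) with (z , _ , b , m) ← sepOne (colLine (proj₂ (dom p))) q p l with refl , _ ← negs m = ⊥-elim (R.asym b ir)

  colUnique : ∀ {i i' j} → One i j → One i' j → ¬ (j ≡ d1 ⊎ j ≡ d2 ⊎ j ≡ d3) → i ≡ i'
  colUnique {i} {i'} p q nd with R.cmp i i'
  ... | inj₁ l with (z , _ , _ , m) ← sepOne (colLine (proj₂ (dom p))) p q l = ⊥-elim (nd (proj₂ (negs m)))
  ... | inj₂ (inj₁ e) = e
  ... | inj₂ (inj₂ l) with (z , _ , _ , m) ← sepOne (colLine (proj₂ (dom p))) q p l = ⊥-elim (nd (proj₂ (negs m)))

  rowUnique : ∀ {i j j'} → One i j → One i j' → ¬ (i ≡ r) → j ≡ j'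
  rowUnique {i} {j} {j'} p q nr with C.cmp j j'
  ... | inj₁ l with (z , _ , _ , m) ← sepOne (rowLine (proj₁ (dom p))) p q l = ⊥-elim (nr (proj₁ (negs m)))
  ... | inj₂ (inj₁ e) = e
  ... | inj₂ (inj₂ l) with (z , _ , _ , m) ← sepOne (rowLine (proj₁ (dom p))) q p l = ⊥-elim (nr (proj₁ (negs m)))

  -- A descent would form 2143 together with (r,c4) and (l3,d3).
  increasing : ∀ {i i' j j'} → One i j → One i' j' → i ≺ i' → i' ≺ r → j ⊰ d3 → j' ⊰ d3 → j ⊰ j'
  increasing {i} {i'} {j} {j'} p q ii' i'r jd j'd with C.cmp j j'
  ... | inj₁ l           = l
  ... | inj₂ (inj₁ refl) = ⊥-elim (R.irr (subst (_≺ _) (colUpper p q (R.tr ii' i'r) i'r) ii'))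
  ... | inj₂ (inj₂ l)    = ⊥-elim (no2143 p q oc4 ol3 ii' i'r rl3 l jd d3c4)

  upperRow≢ : ∀ {i} → i ≺ r → ¬ (i ≡ r)
  upperRow≢ ir refl = R.irr ir

module Centre {n One Neg _≺_ _⊰_ r c1 d1 c2 d2 c3 d3 c4 u1 u2 u3 l1 l2 l3}
              (g : Geo n One Neg _≺_ _⊰_ r c1 d1 c2 d2 c3 d3 c4 u1 u2 u3 l1 l2 l3) where
  open Corner g public
  private
    module Cᶜ = Corner (flipC g)
    module Cʳ = Corner (flipR g)

  decreasing : ∀ {i i' j j'} → One i j → One i' j' → i ≺ i' → i' ≺ r → d1 ⊰ j → d1 ⊰ j' → j' ⊰ j
  decreasing = Cᶜ.increasing

  -- A one between the rows u2 and r contradicts `increasing` if it lies to the left of d2, and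
  -- `decreasing` if it lies to the right.
  last : ∀ {i j} → One i j → i ≺ r → i ≡ u2 ⊎ i ≺ u2
  last {i} {j} p ir with R.cmp i u2
  ... | inj₁ l = inj₂ l
  ... | inj₂ (inj₁ e) = inj₁ e
  ... | inj₂ (inj₂ l) with C.cmp j d2
  ...   | inj₁ m = ⊥-elim (C.asym m (increasing ou2 p l ir d2d3 (C.tr m d2d3)))
  ...   | inj₂ (inj₁ refl) = inj₁ (colUpper p ou2 ir u2r)
  ...   | inj₂ (inj₂ m) = ⊥-elim (C.asym m (decreasing ou2 p l ir d1d2 (C.tr d1d2 m)))

  -- Strictly between d1 and d3 both monotonicity laws hold, so such a one cannot be in a row other
  -- than u2, whose only one is in d2.
  centre : ∀ {i j} → One i j → i ≺ r → d1 ⊰ j → j ⊰ d3 → j ≡ d2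
  centre p ir a b with last p ir
  ... | inj₁ refl = rowUnique p ou2 (upperRow≢ ir)
  ... | inj₂ l    = ⊥-elim (C.asym (increasing p ou2 l u2r b d2d3) (decreasing p ou2 l u2r a d1d2))

  -- Otherwise (i,j), (r,c1), (l2,d2), (l1,d1) form 2143.
  adjacentUpper : ∀ {i j} → One i j → i ≺ r → c1 ⊰ j → j ⊰ d1 → ⊥
  adjacentUpper p ir a b with Cʳ.R.cmp l1 l2
  -- The order of `Cʳ` is reversed: in this case row l2 is closer to r than row l1.
  ... | inj₁ l = no2143 p oc1 ol2 ol1 ir rl2 l a b d1d2
  ... | inj₂ (inj₁ refl) = C.irr (subst (_⊰ d2) (Cʳ.rowUnique ol1 ol2 (Cʳ.upperRow≢ rl1)) d1d2)
  ... | inj₂ (inj₂ l) = C.asym d1d2 (Cʳ.increasing ol2 ol1 l rl1 d2d3 d1d3)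

-- Matching marked rows with marked columns

at : List Bool → ℕ → Bool
at = nth false

rank : List Bool → ℕ → ℕ
rank []          _       = 0
rank (_ ∷ _)     zero    = 0
rank (true ∷ w)  (suc i) = suc (rank w i)
rank (false ∷ w) (suc i) = rank w i

-- Equal ranks: the only increasing matching of the marked rows with the marked columns.
Diag : List Bool → List Bool → ℕ → ℕ → Set
Diag ρ κ i j = at ρ i ≡ true × at κ j ≡ true × rank ρ i ≡ rank κ j

at-length : ∀ ρ {i} → at ρ i ≡ true → i < length ρ
at-length (x ∷ ρ) {zero}  p = z<s
at-length (x ∷ ρ) {suc i} p = s<s (at-length ρ p)

rank-mono : ∀ ρ {i i'} → at ρ i ≡ true → i < i' → rank ρ i < rank ρ i'
rank-mono (true  ∷ ρ) {zero}  {suc i'} p l = z<s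
rank-mono (true  ∷ ρ) {suc i} {suc i'} p (s≤s l) = s<s (rank-mono ρ p l)
rank-mono (false ∷ ρ) {suc i} {suc i'} p (s≤s l) = rank-mono ρ p l

rank<trues : ∀ ρ {i} → at ρ i ≡ true → rank ρ i < trues ρ
rank<trues (true  ∷ ρ) {zero}  p = z<s
rank<trues (true  ∷ ρ) {suc i} p = s<s (rank<trues ρ p)
rank<trues (false ∷ ρ) {suc i} p = rank<trues ρ p

select : ∀ ρ {k} → k < trues ρ → ∃ λ i → at ρ i ≡ true × rank ρ i ≡ k
select (true  ∷ ρ) {zero}  l = 0 , refl , refl
select (true  ∷ ρ) {suc k} (s≤s l) = let (i , p , q) = select ρ l in suc i , p , cong suc q
select (false ∷ ρ) l = let (i , p , q) = select ρ l in suc i , p , q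

rank-injective : ∀ ρ {i i'} → at ρ i ≡ true → at ρ i' ≡ true → rank ρ i ≡ rank ρ i' → i ≡ i'
rank-injective ρ {i} {i'} p q e with <-cmp i i'
... | tri< l _ _ = ⊥-elim (<-irrefl e (rank-mono ρ p l))
... | tri≈ _ r _ = r
... | tri> _ _ l = ⊥-elim (<-irrefl (sym e) (rank-mono ρ q l))

Diag-sym : ∀ {ρ κ i j} → Diag ρ κ i j → Diag κ ρ j i
Diag-sym (p , q , e) = q , p , sym e

Diag-total : ∀ {ρ κ i} → trues ρ ≡ trues κ → at ρ i ≡ true → ∃ λ j → Diag ρ κ i j
Diag-total {ρ} {κ} t p = let (j , q , e) = select κ (subst (_ <_) t (rank<trues ρ p)) in j , p , q , sym e

Diag-mono : ∀ {ρ κ i i' j j'} → Diag ρ κ i j → Diag ρ κ i' j' → i < i' → j < j'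
Diag-mono {ρ} {κ} {j = j} {j'} (p , q , e) (p' , q' , e') l with <-cmp j j'
... | tri< m _ _    = m
... | tri≈ _ refl _ = ⊥-elim (<-irrefl (trans e (sym e')) (rank-mono ρ p l))
... | tri> _ _ m    = ⊥-elim (<-asym (rank-mono ρ p l) (subst₂ _<_ (sym e') (sym e) (rank-mono κ q' m)))

record Chain (ρ κ : List Bool) (B : ℕ → ℕ → Set) : Set where
  field
    marked : ∀ {i j} → B i j → at ρ i ≡ true × at κ j ≡ true
    onRow  : ∀ {i} → at ρ i ≡ true → ∃ λ j → B i j
    onCol  : ∀ {j} → at κ j ≡ true → ∃ λ i → B i j
    rowMono : ∀ {i i' j j'} → B i j → B i' j' → i < i' → j < j'
    colMono : ∀ {i i' j j'} → B i j → B i' j' → j < j' → i < i'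
open Chain

-- A monotone relation that is total on the marks of both sides must match equal ranks. Unmarked
-- first letters are stripped; if both first letters are marked, they are matched with each other,
-- and both are stripped.
Chain-rank : ∀ ρ κ {B} → Chain ρ κ B → (∀ {i j} → B i j → rank ρ i ≡ rank κ j) × trues ρ ≡ trues κ
Chain-rank [] [] c = (λ b → refl) , refl
Chain-rank [] (true ∷ κ) c with onCol c {0} refl
... | _ , b with () ← proj₁ (marked c b)
Chain-rank (true ∷ ρ) [] c with onRow c {0} refl
... | _ , b with () ← proj₂ (marked c b)
Chain-rank [] (false ∷ κ) {B} c = (λ b → ⊥-elim (f b)) , proj₂ (Chain-rank [] κ {λ i j → B i (suc j)} record
  { marked = λ b → ⊥-elim (f b) ; onRow = λ () ; onCol = λ p → onCol c p
  ; rowMono = λ b → ⊥-elim (f b) ; colMono = λ b → ⊥-elim (f b) })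
  where f : ∀ {i j} → ¬ B i j
        f b with () ← proj₁ (marked c b)
Chain-rank (false ∷ ρ) κ {B} c = f , proj₂ ih
  where
  ih = Chain-rank ρ κ {λ i j → B (suc i) j} record
    { marked = λ b → marked c b ; onRow = λ p → onRow c p ; onCol = λ p → inColumn (onCol c p)
    ; rowMono = λ b b' l → rowMono c b b' (s≤s l) ; colMono = λ b b' l → s≤s⁻¹ (colMono c b b' l) }
    where inColumn : ∀ {j} → (∃ λ i → B i j) → ∃ λ i → B (suc i) j
          inColumn (suc i , b) = i , b
          inColumn (zero , b) with () ← proj₁ (marked c b)
  f : ∀ {i j} → B i j → rank (false ∷ ρ) i ≡ rank κ j
  f {zero}  b with () ← proj₁ (marked c b)
  f {suc i} b = proj₁ ih b
Chain-rank (true ∷ ρ) (false ∷ κ) {B} c = f , proj₂ ih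
  where
  ih = Chain-rank (true ∷ ρ) κ {λ i j → B i (suc j)} record
    { marked = λ b → marked c b ; onRow = λ p → inLine (onRow c p) ; onCol = λ p → onCol c p
    ; rowMono = λ b b' l → s≤s⁻¹ (rowMono c b b' l) ; colMono = λ b b' l → colMono c b b' (s≤s l) }
    where inLine : ∀ {i} → (∃ λ j → B i j) → ∃ λ j → B i (suc j)
          inLine (suc i , b) = i , b
          inLine (zero , b) with () ← proj₂ (marked c b)
  f : ∀ {i j} → B i j → rank (true ∷ ρ) i ≡ rank (false ∷ κ) j
  f {i} {zero}  b with () ← proj₂ (marked c b)
  f {i} {suc j} b = proj₁ ih b
Chain-rank (true ∷ ρ) (true ∷ κ) {B} c = f , cong suc (proj₂ ih)
  where
  -- If row 0 were matched to a later column and column 0 to a later row, these two pairs would be a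
  -- descent.
  corner : B 0 0
  corner with onRow c {0} refl | onCol c {0} refl
  ... | zero  , b | _ = b
  ... | suc j , b | zero  , b' = b'
  ... | suc j , b | suc i , b' with () ← rowMono c b b' z<s
  ih = Chain-rank ρ κ {λ i j → B (suc i) (suc j)} record
    { marked = λ b → marked c b ; onRow = λ p → inLine (onRow c p) ; onCol = λ p → inColumn (onCol c p)
    ; rowMono = λ b b' l → s≤s⁻¹ (rowMono c b b' (s≤s l)) ; colMono = λ b b' l → s≤s⁻¹ (colMono c b b' (s≤s l)) }
    where inLine : ∀ {i} → (∃ λ j → B (suc i) j) → ∃ λ j → B (suc i) (suc j)
          inLine (suc i , b) = i , b
          inLine (zero , b) with () ← rowMono c corner b z<s
          inColumn : ∀ {j} → (∃ λ i → B i (suc j)) → ∃ λ i → B (suc i) (suc j)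
          inColumn (suc i , b) = i , b
          inColumn (zero , b) with () ← colMono c corner b z<s
  f : ∀ {i j} → B i j → rank (true ∷ ρ) i ≡ rank (true ∷ κ) j
  f {zero}  {zero}  b = refl
  f {zero}  {suc j} b with () ← colMono c corner b z<s
  f {suc i} {zero}  b with () ← rowMono c corner b z<s
  f {suc i} {suc j} b = cong suc (proj₁ ih b)

-- The shape of the matrices

uniqueLine : ∀ {_≺_ One Neg} → Ord _≺_ → ∃ One → (∀ {x y} → One x → One y → x ≡ y) → (∀ {x} → ¬ Neg x) → Line _≺_ One Neg
uniqueLine {_≺_} o e f m = record
  { sepOne = λ {x} {y} p q l → ⊥-elim (Ord.irr o (subst (_≺ y) (f p q) l)) ; sepNeg = λ p → ⊥-elim (m p)
  ; before = λ p → ⊥-elim (m p) ; after = λ p → ⊥-elim (m p) ; some = e }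

tripleLine : ∀ {_≺_ One Neg a b c} → Ord _≺_ → One a → One c → (∀ {x} → One x → x ≡ a ⊎ x ≡ c) →
             Neg b → (∀ {x} → Neg x → x ≡ b) → a ≺ b → b ≺ c → Line _≺_ One Neg
tripleLine {_≺_} {One} {Neg} {a} {b} {c} o oa oc ones nb negs ab bc = record
  { sepOne = λ p q → so (ones p) (ones q)
  ; sepNeg = λ p q l → ⊥-elim (irr (subst₂ _≺_ (negs p) (negs q) l))
  ; before = λ m → a , subst (a ≺_) (sym (negs m)) ab , oa
  ; after = λ m → c , subst (_≺ c) (sym (negs m)) bc , oc
  ; some = a , oa }
  where
  open Ord o
  so : ∀ {x y} → x ≡ a ⊎ x ≡ c → y ≡ a ⊎ y ≡ c → x ≺ y → ∃ λ z → x ≺ z × z ≺ y × Neg z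
  so (inj₁ refl) (inj₁ refl) l = ⊥-elim (irr l)
  so (inj₁ refl) (inj₂ refl) l = b , ab , bc , nb
  so (inj₂ refl) (inj₁ refl) l = ⊥-elim (asym l (tr ab bc))
  so (inj₂ refl) (inj₂ refl) l = ⊥-elim (irr l)

-- One quadrant seen from its outer corner. Between the columns beyond `c` and the inner column `d`
-- it skips `c` itself, whose only one lies in the row of the negative entries.
record Quad (n : ℕ) (Q : ℕ → ℕ → Set) (_≺_ _⊰_ : ℕ → ℕ → Set) (u c d : ℕ) : Set where
  field
    inRow : ∀ {i j} → Q i j → i ≺ u
    inCol : ∀ {i j} → Q i j → j ⊰ c ⊎ j ≡ d
    range : ∀ {i j} → Q i j → i < n × j < n
    mono  : ∀ {i i' j j'} → Q i j → Q i' j' → i ≺ i' → j ⊰ j'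
    monoᵀ : ∀ {i i' j j'} → Q i j → Q i' j' → j ⊰ j' → i ≺ i'
    inner : ∃ λ i → Q i d
open Quad

-- The shape of the matrices to be counted, with respect to arbitrary orders ≺ on rows and ⊰ on columns: four monotone
-- quadrants around the row r, whose nonzero entries lie in the consecutive columns c1, d1, c2, d2, c3, d3, c4.
record Layout (n : ℕ) (One Neg UL UR DL DR : ℕ → ℕ → Set) (_≺_ _⊰_ : ℕ → ℕ → Set)
              (u r l c1 d1 c2 d2 c3 d3 c4 : ℕ) : Set where
  field
    ordR : Ord _≺_
    ordC : Ord _⊰_
    ul   : Quad n UL _≺_ _⊰_ u c1 d1
    ur   : Quad n UR _≺_ (λ x y → y ⊰ x) u c4 d3
    dl   : Quad n DL (λ x y → y ≺ x) _⊰_ l c1 d1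
    dr   : Quad n DR (λ x y → y ≺ x) (λ x y → y ⊰ x) l c4 d3
    rowU : ∀ {i} → i < n → i ≺ u → (∃ λ j → UL i j) ⊎ (∃ λ j → UR i j)
    rowD : ∀ {i} → i < n → l ≺ i → (∃ λ j → DL i j) ⊎ (∃ λ j → DR i j)
    colL : ∀ {j} → j < n → j ⊰ c1 → (∃ λ i → UL i j) ⊎ (∃ λ i → DL i j)
    colR : ∀ {j} → j < n → c4 ⊰ j → (∃ λ i → UR i j) ⊎ (∃ λ i → DR i j)
    notU : ∀ {i j j'} → UL i j → UR i j' → ⊥
    notD : ∀ {i j j'} → DL i j → DR i j' → ⊥
    notL : ∀ {i i' j} → j ⊰ c1 → UL i j → DL i' j → ⊥
    notR : ∀ {i i' j} → c4 ⊰ j → UR i j → DR i' j → ⊥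
    rows : ∀ {i} → i < n → (i ≺ u ⊎ i ≡ u) ⊎ (i ≡ r) ⊎ (l ≺ i ⊎ i ≡ l)
    cols : ∀ {j} → j < n → ((j ⊰ c1 ⊎ j ≡ c1) ⊎ (j ≡ d1 ⊎ j ≡ c2)) ⊎ (j ≡ d2) ⊎ ((c4 ⊰ j ⊎ j ≡ c4) ⊎ (j ≡ d3 ⊎ j ≡ c3))
    ur<  : u ≺ r
    rl<  : r ≺ l
    c1d1 : c1 ⊰ d1
    d1c2 : d1 ⊰ c2
    c2d2 : c2 ⊰ d2
    d2c3 : d2 ⊰ c3
    c3d3 : c3 ⊰ d3
    d3c4 : d3 ⊰ c4
    ulOne : ∀ {i j} → UL i j → One i j
    urOne : ∀ {i j} → UR i j → One i j
    dlOne : ∀ {i j} → DL i j → One i j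
    drOne : ∀ {i j} → DR i j → One i j
    uOne  : One u d2
    lOne  : One l d2
    c1One : One r c1
    c2One : One r c2
    c3One : One r c3
    c4One : One r c4
    class : ∀ {i j} → One i j → ((UL i j ⊎ UR i j) ⊎ (DL i j ⊎ DR i j)) ⊎ (j ≡ d2 × (i ≡ u ⊎ i ≡ l)) ⊎
                                (i ≡ r × ((j ≡ c1 ⊎ j ≡ c2) ⊎ (j ≡ c3 ⊎ j ≡ c4)))
    negs  : ∀ {i j} → Neg i j → i ≡ r × (j ≡ d1 ⊎ j ≡ d2 ⊎ j ≡ d3)
    d1Neg : Neg r d1
    d2Neg : Neg r d2
    d3Neg : Neg r d3

private
  map1 : ∀ {A B C : Set} → (A → B) → A ⊎ C → B ⊎ C
  map1 f (inj₁ a) = inj₁ (f a)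
  map1 f (inj₂ c) = inj₂ c

  map2 : ∀ {A B C : Set} → (B → C) → A ⊎ B → A ⊎ C
  map2 f (inj₁ a) = inj₁ a
  map2 f (inj₂ c) = inj₂ (f c)

module _ {n : ℕ} {One Neg : ℕ → ℕ → Set} where

  flipLC : ∀ {UL UR DL DR _≺_ _⊰_ u r l c1 d1 c2 d2 c3 d3 c4} →
           Layout n One Neg UL UR DL DR _≺_ _⊰_ u r l c1 d1 c2 d2 c3 d3 c4 →
           Layout n One Neg UR UL DR DL _≺_ (λ x y → y ⊰ x) u r l c4 d3 c3 d2 c2 d1 c1
  flipLC g = record
    { ordR = ordR ; ordC = flipOrd ordC ; ul = ur ; ur = ul ; dl = dr ; dr = dl
    ; rowU = λ a b → swap (rowU a b) ; rowD = λ a b → swap (rowD a b) ; colL = colR ; colR = colL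
    ; notU = λ a b → notU b a ; notD = λ a b → notD b a ; notL = notR ; notR = notL
    ; rows = rows ; cols = rev3 ∘ cols
    ; ur< = ur< ; rl< = rl< ; c1d1 = d3c4 ; d1c2 = c3d3 ; c2d2 = d2c3 ; d2c3 = c2d2 ; c3d3 = d1c2 ; d3c4 = c1d1
    ; ulOne = urOne ; urOne = ulOne ; dlOne = drOne ; drOne = dlOne ; uOne = uOne ; lOne = lOne
    ; c1One = c4One ; c2One = c3One ; c3One = c2One ; c4One = c1One
    ; class = λ p → map1 (λ { (inj₁ a) → inj₁ (swap a) ; (inj₂ b) → inj₂ (swap b) })
                         (map2 (map2 (λ (a , b) → a , rev4 b)) (class p))
    ; negs = λ m → proj₁ (negs m) , rev3 (proj₂ (negs m)) ; d1Neg = d3Neg ; d2Neg = d2Neg ; d3Neg = d1Neg }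
    where open Layout g

  flipLR : ∀ {UL UR DL DR _≺_ _⊰_ u r l c1 d1 c2 d2 c3 d3 c4} →
           Layout n One Neg UL UR DL DR _≺_ _⊰_ u r l c1 d1 c2 d2 c3 d3 c4 →
           Layout n One Neg DL DR UL UR (λ x y → y ≺ x) _⊰_ l r u c1 d1 c2 d2 c3 d3 c4
  flipLR g = record
    { ordR = flipOrd ordR ; ordC = ordC ; ul = dl ; ur = dr ; dl = ul ; dr = ur
    ; rowU = rowD ; rowD = rowU ; colL = λ a b → swap (colL a b) ; colR = λ a b → swap (colR a b)
    ; notU = notD ; notD = notU ; notL = λ p a b → notL p b a ; notR = λ p a b → notR p b a
    ; rows = rev3 ∘ rows ; cols = cols
    ; ur< = rl< ; rl< = ur< ; c1d1 = c1d1 ; d1c2 = d1c2 ; c2d2 = c2d2 ; d2c3 = d2c3 ; c3d3 = c3d3 ; d3c4 = d3c4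
    ; ulOne = dlOne ; urOne = drOne ; dlOne = ulOne ; drOne = urOne ; uOne = lOne ; lOne = uOne
    ; c1One = c1One ; c2One = c2One ; c3One = c3One ; c4One = c4One
    ; class = λ p → map1 swap (map2 (map1 (λ (a , b) → a , swap b)) (class p))
    ; negs = negs ; d1Neg = d1Neg ; d2Neg = d2Neg ; d3Neg = d3Neg }
    where open Layout g

quadRow : ∀ {n Q _≺_ _⊰_ u c d i j j'} → Ord _≺_ → Ord _⊰_ → Quad n Q _≺_ _⊰_ u c d → Q i j → Q i j' → j ≡ j'
quadRow {j = j} {j'} o o' q p p' with Ord.cmp o' j j'
... | inj₁ l        = ⊥-elim (Ord.irr o (monoᵀ q p p' l))
... | inj₂ (inj₁ e) = e
... | inj₂ (inj₂ l) = ⊥-elim (Ord.irr o (monoᵀ q p' p l))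

quadCol : ∀ {n Q _≺_ _⊰_ u c d i i' j} → Ord _≺_ → Ord _⊰_ → Quad n Q _≺_ _⊰_ u c d → Q i j → Q i' j → i ≡ i'
quadCol {i = i} {i'} o o' q p p' with Ord.cmp o i i'
... | inj₁ l        = ⊥-elim (Ord.irr o' (mono q p p' l))
... | inj₂ (inj₁ e) = e
... | inj₂ (inj₂ l) = ⊥-elim (Ord.irr o' (mono q p' p l))

module Positions {n One Neg UL UR DL DR _≺_ _⊰_ u r l c1 d1 c2 d2 c3 d3 c4}
                 (g : Layout n One Neg UL UR DL DR _≺_ _⊰_ u r l c1 d1 c2 d2 c3 d3 c4) where
  open Layout g public
  module R = Ord ordR
  module C = Ord ordC

  ul≺ : u ≺ l
  ul≺ = R.tr ur< rl<
  d1d2 : d1 ⊰ d2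
  d1d2 = C.tr d1c2 c2d2
  d2d3 : d2 ⊰ d3
  d2d3 = C.tr d2c3 c3d3
  c1c2 : c1 ⊰ c2
  c1c2 = C.tr c1d1 d1c2
  c3c4 : c3 ⊰ c4
  c3c4 = C.tr c3d3 d3c4
  c2c3 : c2 ⊰ c3
  c2c3 = C.tr c2d2 d2c3
  d1d3 : d1 ⊰ d3
  d1d3 = C.tr d1d2 d2d3

  ul⊰c2 : ∀ {i j} → UL i j → j ⊰ c2
  ul⊰c2 p with inCol ul p
  ... | inj₁ a    = C.tr a c1c2
  ... | inj₂ refl = d1c2

  dr⊱c3 : ∀ {i j} → DR i j → c3 ⊰ j
  dr⊱c3 p with inCol dr p
  ... | inj₁ a    = C.tr c3c4 a
  ... | inj₂ refl = c3d3

module Chains {n One Neg UL UR DL DR _≺_ _⊰_ u r l c1 d1 c2 d2 c3 d3 c4}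
              (g : Layout n One Neg UL UR DL DR _≺_ _⊰_ u r l c1 d1 c2 d2 c3 d3 c4) where
  open Positions g

  V H : ℕ → ℕ → Set
  V i j = j ≡ d2 × (i ≡ u ⊎ i ≡ l)
  H i j = i ≡ r × ((j ≡ c1 ⊎ j ≡ c2) ⊎ (j ≡ c3 ⊎ j ≡ c4))

  diagonal : ∀ {i i' j j'} → UL i j ⊎ DR i j → UL i' j' ⊎ DR i' j' → i ≺ i' → j ⊰ j'
  diagonal (inj₁ p) (inj₁ q) s = mono ul p q s
  diagonal (inj₁ p) (inj₂ q) s = C.tr (ul⊰c2 p) (C.tr c2c3 (dr⊱c3 q))
  diagonal (inj₂ p) (inj₁ q) s = ⊥-elim (R.asym s (R.tr (inRow ul q) (R.tr ul≺ (inRow dr p))))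
  diagonal (inj₂ p) (inj₂ q) s = mono dr q p s

  u≼V : ∀ {i} → i ≡ u ⊎ i ≡ l → ¬ (i ≺ u)
  u≼V (inj₁ refl) s = R.irr s
  u≼V (inj₂ refl) s = R.asym ul≺ s

  V≼l : ∀ {i} → i ≡ u ⊎ i ≡ l → ¬ (l ≺ i)
  V≼l (inj₁ refl) s = R.asym ul≺ s
  V≼l (inj₂ refl) s = R.irr s

  -- Column d2 separates UL from DR, so its two ones create no descent; as they share this column,
  -- the conclusion is only weak.
  vertical : ∀ {i i' j j'} → (UL i j ⊎ DR i j) ⊎ V i j → (UL i' j' ⊎ DR i' j') ⊎ V i' j' → i ≺ i' → ¬ (j' ⊰ j)
  vertical (inj₁ p) (inj₁ q) s t = C.asym t (diagonal p q s)
  vertical (inj₁ (inj₁ p)) (inj₂ (refl , _)) s t = C.asym t (C.tr (ul⊰c2 p) c2d2)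
  vertical (inj₁ (inj₂ p)) (inj₂ (refl , q)) s t = V≼l q (R.tr (inRow dr p) s)
  vertical (inj₂ (refl , p)) (inj₁ (inj₁ q)) s t = u≼V p (R.tr s (inRow ul q))
  vertical (inj₂ (refl , p)) (inj₁ (inj₂ q)) s t = C.asym t (C.tr d2c3 (dr⊱c3 q))
  vertical (inj₂ (refl , p)) (inj₂ (refl , q)) s t = C.irr t

  -- The four ones of row r also fit between UL and DR, except that the inner column d1 of UL lies
  -- to the right of c1, and the inner column d3 of DR to the left of c4.
  horizontal : ∀ {i i' j j'} → (UL i j ⊎ DR i j) ⊎ H i j → (UL i' j' ⊎ DR i' j') ⊎ H i' j' → i ≺ i' → j' ⊰ j →
               (j ≡ d1 × i' ≡ r × j' ≡ c1) ⊎ (i ≡ r × j ≡ c4 × j' ≡ d3)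
  horizontal (inj₁ p) (inj₁ q) s t = ⊥-elim (C.asym t (diagonal p q s))
  horizontal (inj₁ (inj₁ p)) (inj₂ (refl , q)) s t with inCol ul p | q
  ... | inj₂ refl | inj₁ (inj₁ refl) = inj₁ (refl , refl , refl)
  ... | inj₁ a    | inj₁ (inj₁ refl) = ⊥-elim (C.asym t a)
  ... | _         | inj₁ (inj₂ refl) = ⊥-elim (C.asym t (ul⊰c2 p))
  ... | _         | inj₂ (inj₁ refl) = ⊥-elim (C.asym t (C.tr (ul⊰c2 p) c2c3))
  ... | _         | inj₂ (inj₂ refl) = ⊥-elim (C.asym t (C.tr (ul⊰c2 p) (C.tr c2c3 c3c4)))
  horizontal (inj₁ (inj₂ p)) (inj₂ (refl , q)) s t = ⊥-elim (R.asym s (R.tr rl< (inRow dr p)))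
  horizontal (inj₂ (refl , p)) (inj₁ (inj₁ q)) s t = ⊥-elim (R.asym s (R.tr (inRow ul q) ur<))
  horizontal (inj₂ (refl , p)) (inj₁ (inj₂ q)) s t with inCol dr q | p
  ... | inj₂ refl | inj₂ (inj₂ refl) = inj₂ (refl , refl , refl)
  ... | inj₁ a    | inj₂ (inj₂ refl) = ⊥-elim (C.asym t a)
  ... | _         | inj₂ (inj₁ refl) = ⊥-elim (C.asym t (dr⊱c3 q))
  ... | _         | inj₁ (inj₂ refl) = ⊥-elim (C.asym t (C.tr c2c3 (dr⊱c3 q)))
  ... | _         | inj₁ (inj₁ refl) = ⊥-elim (C.asym t (C.tr c1c2 (C.tr c2c3 (dr⊱c3 q))))
  horizontal (inj₂ (refl , p)) (inj₂ (refl , q)) s t = ⊥-elim (R.irr s)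

-- The ones other than the four in row r, and likewise those other than the two in column d2, lie on the increasing
-- quadrants UL, DR and the decreasing quadrants UR, DL; the omitted ones fit either kind of quadrants, up to few exceptions.
module Avoidance {n One Neg UL UR DL DR _≺_ _⊰_ u r l c1 d1 c2 d2 c3 d3 c4}
                 (g : Layout n One Neg UL UR DL DR _≺_ _⊰_ u r l c1 d1 c2 d2 c3 d3 c4) where
  open Positions g
  open Chains g
  private module X = Chains (flipLC g)

  Inc1 Inc2 Dec1 Dec2 : ℕ → ℕ → Set
  Inc1 i j = (UL i j ⊎ DR i j) ⊎ V i j
  Inc2 i j = (UL i j ⊎ DR i j) ⊎ H i j
  Dec1 i j = (UR i j ⊎ DL i j) ⊎ X.H i j
  Dec2 i j = (UR i j ⊎ DL i j) ⊎ V i j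

  label1 : ∀ {i j} → One i j → Inc1 i j ⊎ Dec1 i j
  label1 p with class p
  ... | inj₁ (inj₁ (inj₁ a)) = inj₁ (inj₁ (inj₁ a))
  ... | inj₁ (inj₁ (inj₂ a)) = inj₂ (inj₁ (inj₁ a))
  ... | inj₁ (inj₂ (inj₁ a)) = inj₂ (inj₁ (inj₂ a))
  ... | inj₁ (inj₂ (inj₂ a)) = inj₁ (inj₁ (inj₂ a))
  ... | inj₂ (inj₁ v)        = inj₁ (inj₂ v)
  ... | inj₂ (inj₂ (e , h))  = inj₂ (inj₂ (e , rev4 h))

  label2 : ∀ {i j} → One i j → Inc2 i j ⊎ Dec2 i j
  label2 p with class p
  ... | inj₁ (inj₁ (inj₁ a)) = inj₁ (inj₁ (inj₁ a))
  ... | inj₁ (inj₁ (inj₂ a)) = inj₂ (inj₁ (inj₁ a))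
  ... | inj₁ (inj₂ (inj₁ a)) = inj₂ (inj₁ (inj₂ a))
  ... | inj₁ (inj₂ (inj₂ a)) = inj₁ (inj₁ (inj₂ a))
  ... | inj₂ (inj₁ v)        = inj₂ (inj₂ v)
  ... | inj₂ (inj₂ h)        = inj₁ (inj₂ h)

  descent1 : ∀ {i i' j j'} → One i j → One i' j' → i ≺ i' → j' ⊰ j → Dec1 i j ⊎ Dec1 i' j'
  descent1 p q s t with label1 p | label1 q
  ... | inj₂ a | _      = inj₁ a
  ... | inj₁ _ | inj₂ b = inj₂ b
  ... | inj₁ a | inj₁ b = ⊥-elim (vertical a b s t)

  descent2 : ∀ {i i' j j'} → One i j → One i' j' → i ≺ i' → j' ⊰ j → (Dec2 i j ⊎ Dec2 i' j') ⊎
             ((j ≡ d1 × i' ≡ r × j' ≡ c1) ⊎ (i ≡ r × j ≡ c4 × j' ≡ d3))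
  descent2 p q s t with label2 p | label2 q
  ... | inj₂ a | _      = inj₁ (inj₁ a)
  ... | inj₁ _ | inj₂ b = inj₁ (inj₂ b)
  ... | inj₁ a | inj₁ b = inj₂ (horizontal a b s t)

  -- The pattern consists of two descents, the second to the lower right of the first. Each descent
  -- contains a one of decreasing label, and the two chosen ones are in ascending position, which a
  -- decreasing chain forbids up to the exceptions of `X.horizontal`.
  avoids2143 : Free2143 One _≺_ _⊰_
  avoids2143 {i1} {i2} {i3} {i4} {j1} {j2} {j3} {j4} p1 p2 p3 p4 i12 i23 i34 j12 j23 j34 =
    pick (descent1 p1 p2 i12 j12) (descent1 p3 p4 i34 j34)
    where
    i13 = R.tr i12 i23
    i24 = R.tr i23 i34
    i14 = R.tr i12 i24
    j13 = C.tr j12 j23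
    j24 = C.tr j23 j34
    j14 = C.tr j12 j24

    -- The surviving ascents end in (r,c4) or start in (r,c1). The second labelling counts row r as
    -- increasing: then either two decreasing ones contradict `X.vertical`, or an exceptional
    -- descent of this labelling occurs, which clashes with the position of the ascent.
    exception : ∀ {i i' j j'} → (j ≡ d3 × i' ≡ r × j' ≡ c4) ⊎ (i ≡ r × j ≡ c1 × j' ≡ d1) →
                i ≺ i3 → i ≺ i4 → i1 ≺ i' → i2 ≺ i' → j ⊰ j3 → j ⊰ j4 → j1 ⊰ j' → j2 ⊰ j' → ⊥
    exception x a b c d s t v w with descent2 p1 p2 i12 j12 | descent2 p3 p4 i34 j34
    ... | inj₁ (inj₁ p) | inj₁ (inj₁ q) = X.vertical p q i13 j24
    ... | inj₁ (inj₁ p) | inj₁ (inj₂ q) = X.vertical p q i14 j23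
    ... | inj₁ (inj₂ p) | inj₁ (inj₁ q) = X.vertical p q i23 j14
    ... | inj₁ (inj₂ p) | inj₁ (inj₂ q) = X.vertical p q i24 j13
    exception (inj₁ (refl , refl , refl)) a b c d s t v w | inj₂ (inj₁ (_ , refl , _)) | _ = R.irr d
    exception (inj₁ (refl , refl , refl)) a b c d s t v w | inj₂ (inj₂ (refl , _ , _)) | _ = R.irr c
    exception (inj₁ (refl , refl , refl)) a b c d s t v w | _ | inj₂ (inj₁ (refl , _ , _)) = C.asym t d1d3
    exception (inj₁ (refl , refl , refl)) a b c d s t v w | _ | inj₂ (inj₂ (_ , _ , refl)) = C.irr s
    exception (inj₂ (refl , refl , refl)) a b c d s t v w | inj₂ (inj₁ (refl , _ , _)) | _ = C.irr w
    exception (inj₂ (refl , refl , refl)) a b c d s t v w | inj₂ (inj₂ (_ , _ , refl)) | _ = C.asym v d1d3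
    exception (inj₂ (refl , refl , refl)) a b c d s t v w | _ | inj₂ (inj₁ (_ , refl , _)) = R.irr b
    exception (inj₂ (refl , refl , refl)) a b c d s t v w | _ | inj₂ (inj₂ (refl , _ , _)) = R.irr a

    pick : Dec1 i1 j2 ⊎ Dec1 i2 j1 → Dec1 i3 j4 ⊎ Dec1 i4 j3 → ⊥
    pick (inj₁ x) (inj₁ y) = exception (X.horizontal x y i13 j24) i13 i14 i13 i23 j23 j24 j14 j24
    pick (inj₁ x) (inj₂ y) = exception (X.horizontal x y i14 j23) i13 i14 i14 i24 j23 j24 j13 j23
    pick (inj₂ x) (inj₁ y) = exception (X.horizontal x y i23 j14) i23 i24 i13 i23 j13 j14 j14 j24
    pick (inj₂ x) (inj₂ y) = exception (X.horizontal x y i24 j13) i23 i24 i14 i24 j13 j14 j13 j23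

module Lines {n One Neg UL UR DL DR _≺_ _⊰_ u r l c1 d1 c2 d2 c3 d3 c4}
             (g : Layout n One Neg UL UR DL DR _≺_ _⊰_ u r l c1 d1 c2 d2 c3 d3 c4) where
  open Positions g
  private module G = Positions (flipLC g)

  d1≢c : ∀ {j} → ((j ≡ c1 ⊎ j ≡ c2) ⊎ (j ≡ c3 ⊎ j ≡ c4)) → j ≡ d1 → ⊥
  d1≢c (inj₁ (inj₁ refl)) refl = C.irr c1d1
  d1≢c (inj₁ (inj₂ refl)) refl = C.irr d1c2
  d1≢c (inj₂ (inj₁ refl)) refl = C.irr (C.tr d1d2 d2c3)
  d1≢c (inj₂ (inj₂ refl)) refl = C.irr (C.tr d1d3 d3c4)

  d2≢c : ∀ {j} → ((j ≡ c1 ⊎ j ≡ c2) ⊎ (j ≡ c3 ⊎ j ≡ c4)) → j ≡ d2 → ⊥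
  d2≢c (inj₁ (inj₁ refl)) refl = C.irr (C.tr c1d1 d1d2)
  d2≢c (inj₁ (inj₂ refl)) refl = C.irr c2d2
  d2≢c (inj₂ (inj₁ refl)) refl = C.irr d2c3
  d2≢c (inj₂ (inj₂ refl)) refl = C.irr (C.tr d2d3 d3c4)

  nonCentralRow : ∀ {i} → ¬ (i ≡ r) → ∃ (One i) → (∀ {j j'} → One i j → One i j' → j ≡ j') → Line _⊰_ (One i) (Neg i)
  nonCentralRow i≢r e f = uniqueLine ordC e f (λ m → i≢r (proj₁ (negs m)))

  upperRow : ∀ {i} → i < n → i ≺ u → Line _⊰_ (One i) (Neg i)
  upperRow {i} i<n i≺u = nonCentralRow (λ { refl → R.asym i≺u ur< }) some' unique
    where
    upper : ∀ {j} → One i j → UL i j ⊎ UR i j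
    upper p with class p
    ... | inj₁ (inj₁ a)        = a
    ... | inj₁ (inj₂ (inj₁ a)) = ⊥-elim (R.asym i≺u (R.tr ul≺ (inRow dl a)))
    ... | inj₁ (inj₂ (inj₂ a)) = ⊥-elim (R.asym i≺u (R.tr ul≺ (inRow dr a)))
    ... | inj₂ (inj₁ (_ , inj₁ refl)) = ⊥-elim (R.irr i≺u)
    ... | inj₂ (inj₁ (_ , inj₂ refl)) = ⊥-elim (R.asym i≺u ul≺)
    ... | inj₂ (inj₂ (refl , _))      = ⊥-elim (R.asym i≺u ur<)
    some' : ∃ (One i)
    some' with rowU i<n i≺u
    ... | inj₁ (j , a) = j , ulOne a
    ... | inj₂ (j , a) = j , urOne a
    unique : ∀ {j j'} → One i j → One i j' → j ≡ j'
    unique p q with upper p | upper q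
    ... | inj₁ a | inj₁ b = quadRow ordR ordC ul a b
    ... | inj₁ a | inj₂ b = ⊥-elim (notU a b)
    ... | inj₂ a | inj₁ b = ⊥-elim (notU b a)
    ... | inj₂ a | inj₂ b = quadRow ordR (flipOrd ordC) ur a b

  lastRow : Line _⊰_ (One u) (Neg u)
  lastRow = nonCentralRow (λ { refl → R.irr ur< }) (_ , uOne) (λ p q → trans (at-d2 p) (sym (at-d2 q)))
    where
    at-d2 : ∀ {j} → One u j → j ≡ d2
    at-d2 p with class p
    ... | inj₁ (inj₁ (inj₁ a)) = ⊥-elim (R.irr (inRow ul a))
    ... | inj₁ (inj₁ (inj₂ a)) = ⊥-elim (R.irr (inRow ur a))
    ... | inj₁ (inj₂ (inj₁ a)) = ⊥-elim (R.asym ul≺ (inRow dl a))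
    ... | inj₁ (inj₂ (inj₂ a)) = ⊥-elim (R.asym ul≺ (inRow dr a))
    ... | inj₂ (inj₁ (refl , _)) = refl
    ... | inj₂ (inj₂ (refl , _)) = ⊥-elim (R.irr ur<)

  rowOnes : ∀ {j} → One r j → (j ≡ c1 ⊎ j ≡ c2) ⊎ (j ≡ c3 ⊎ j ≡ c4)
  rowOnes p with class p
  ... | inj₁ (inj₁ (inj₁ a)) = ⊥-elim (R.asym ur< (inRow ul a))
  ... | inj₁ (inj₁ (inj₂ a)) = ⊥-elim (R.asym ur< (inRow ur a))
  ... | inj₁ (inj₂ (inj₁ a)) = ⊥-elim (R.asym rl< (inRow dl a))
  ... | inj₁ (inj₂ (inj₂ a)) = ⊥-elim (R.asym rl< (inRow dr a))
  ... | inj₂ (inj₁ (_ , inj₁ refl)) = ⊥-elim (R.irr ur<)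
  ... | inj₂ (inj₁ (_ , inj₂ refl)) = ⊥-elim (R.irr rl<)
  ... | inj₂ (inj₂ (_ , h)) = h

  centralRow : Line _⊰_ (One r) (Neg r)
  centralRow = record
    { sepOne = λ p q s → so (rowOnes p) (rowOnes q) s
    ; sepNeg = λ p q s → sn (proj₂ (negs p)) (proj₂ (negs q)) s
    ; before = λ m → bf (proj₂ (negs m))
    ; after  = λ m → af (proj₂ (negs m))
    ; some   = _ , c1One }
    where
    C4 D3 : ℕ → Set
    C4 j = (j ≡ c1 ⊎ j ≡ c2) ⊎ (j ≡ c3 ⊎ j ≡ c4)
    D3 j = j ≡ d1 ⊎ j ≡ d2 ⊎ j ≡ d3
    so : ∀ {x y} → C4 x → C4 y → x ⊰ y → ∃ λ z → x ⊰ z × z ⊰ y × Neg r z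
    so (inj₁ (inj₁ refl)) (inj₁ (inj₁ refl)) s = ⊥-elim (C.irr s)
    so (inj₁ (inj₁ refl)) (inj₁ (inj₂ refl)) s = d1 , c1d1 , d1c2 , d1Neg
    so (inj₁ (inj₁ refl)) (inj₂ (inj₁ refl)) s = d1 , c1d1 , C.tr d1d2 d2c3 , d1Neg
    so (inj₁ (inj₁ refl)) (inj₂ (inj₂ refl)) s = d1 , c1d1 , C.tr d1d3 d3c4 , d1Neg
    so (inj₁ (inj₂ refl)) (inj₁ (inj₁ refl)) s = ⊥-elim (C.asym s c1c2)
    so (inj₁ (inj₂ refl)) (inj₁ (inj₂ refl)) s = ⊥-elim (C.irr s)
    so (inj₁ (inj₂ refl)) (inj₂ (inj₁ refl)) s = d2 , c2d2 , d2c3 , d2Neg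
    so (inj₁ (inj₂ refl)) (inj₂ (inj₂ refl)) s = d2 , c2d2 , C.tr d2c3 c3c4 , d2Neg
    so (inj₂ (inj₁ refl)) (inj₁ (inj₁ refl)) s = ⊥-elim (C.asym s (C.tr c1c2 c2c3))
    so (inj₂ (inj₁ refl)) (inj₁ (inj₂ refl)) s = ⊥-elim (C.asym s c2c3)
    so (inj₂ (inj₁ refl)) (inj₂ (inj₁ refl)) s = ⊥-elim (C.irr s)
    so (inj₂ (inj₁ refl)) (inj₂ (inj₂ refl)) s = d3 , c3d3 , d3c4 , d3Neg
    so (inj₂ (inj₂ refl)) (inj₁ (inj₁ refl)) s = ⊥-elim (C.asym s (C.tr c1c2 (C.tr c2c3 c3c4)))
    so (inj₂ (inj₂ refl)) (inj₁ (inj₂ refl)) s = ⊥-elim (C.asym s (C.tr c2c3 c3c4))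
    so (inj₂ (inj₂ refl)) (inj₂ (inj₁ refl)) s = ⊥-elim (C.asym s c3c4)
    so (inj₂ (inj₂ refl)) (inj₂ (inj₂ refl)) s = ⊥-elim (C.irr s)
    sn : ∀ {x y} → D3 x → D3 y → x ⊰ y → ∃ λ z → x ⊰ z × z ⊰ y × One r z
    sn (inj₁ refl) (inj₁ refl) s = ⊥-elim (C.irr s)
    sn (inj₁ refl) (inj₂ (inj₁ refl)) s = c2 , d1c2 , c2d2 , c2One
    sn (inj₁ refl) (inj₂ (inj₂ refl)) s = c2 , d1c2 , C.tr c2d2 d2d3 , c2One
    sn (inj₂ (inj₁ refl)) (inj₁ refl) s = ⊥-elim (C.asym s d1d2)
    sn (inj₂ (inj₁ refl)) (inj₂ (inj₁ refl)) s = ⊥-elim (C.irr s)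
    sn (inj₂ (inj₁ refl)) (inj₂ (inj₂ refl)) s = c3 , d2c3 , c3d3 , c3One
    sn (inj₂ (inj₂ refl)) (inj₁ refl) s = ⊥-elim (C.asym s d1d3)
    sn (inj₂ (inj₂ refl)) (inj₂ (inj₁ refl)) s = ⊥-elim (C.asym s d2d3)
    sn (inj₂ (inj₂ refl)) (inj₂ (inj₂ refl)) s = ⊥-elim (C.irr s)
    bf : ∀ {x} → D3 x → ∃ λ z → z ⊰ x × One r z
    bf (inj₁ refl)        = c1 , c1d1 , c1One
    bf (inj₂ (inj₁ refl)) = c2 , c2d2 , c2One
    bf (inj₂ (inj₂ refl)) = c3 , c3d3 , c3One
    af : ∀ {x} → D3 x → ∃ λ z → x ⊰ z × One r z
    af (inj₁ refl)        = c2 , d1c2 , c2One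
    af (inj₂ (inj₁ refl)) = c3 , d2c3 , c3One
    af (inj₂ (inj₂ refl)) = c4 , d3c4 , c4One

  uniqueCol : ∀ {j} → ¬ (j ≡ d1 ⊎ j ≡ d2 ⊎ j ≡ d3) → ∃ (λ i → One i j) → (∀ {i i'} → One i j → One i' j → i ≡ i') →
              Line _≺_ (λ i → One i j) (λ i → Neg i j)
  uniqueCol j≢d e f = uniqueLine ordR e f (λ m → j≢d (proj₂ (negs m)))

  dr⊱d2 : ∀ {i j} → DR i j → d2 ⊰ j
  dr⊱d2 p = C.tr d2c3 (dr⊱c3 p)

  ur⊱d2 : ∀ {i j} → UR i j → d2 ⊰ j
  ur⊱d2 p = C.tr d2c3 (G.ul⊰c2 p)

  dl⊰d2 : ∀ {i j} → DL i j → j ⊰ d2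
  dl⊰d2 p = C.tr (G.dr⊱c3 p) c2d2

  ul⊰d2 : ∀ {i j} → UL i j → j ⊰ d2
  ul⊰d2 p = C.tr (ul⊰c2 p) c2d2

  leftClass : ∀ {i j} → j ⊰ d2 → One i j → (UL i j ⊎ DL i j) ⊎ (i ≡ r × (j ≡ c1 ⊎ j ≡ c2))
  leftClass s p with class p
  ... | inj₁ (inj₁ (inj₁ a)) = inj₁ (inj₁ a)
  ... | inj₁ (inj₁ (inj₂ a)) = ⊥-elim (C.asym s (ur⊱d2 a))
  ... | inj₁ (inj₂ (inj₁ a)) = inj₁ (inj₂ a)
  ... | inj₁ (inj₂ (inj₂ a)) = ⊥-elim (C.asym s (dr⊱d2 a))
  ... | inj₂ (inj₁ (refl , _)) = ⊥-elim (C.irr s)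
  ... | inj₂ (inj₂ (e , inj₁ a)) = inj₂ (e , a)
  ... | inj₂ (inj₂ (e , inj₂ (inj₁ refl))) = ⊥-elim (C.asym s d2c3)
  ... | inj₂ (inj₂ (e , inj₂ (inj₂ refl))) = ⊥-elim (C.asym s (C.tr d2d3 d3c4))

  outer≢d : ∀ {j} → j ⊰ c1 → ¬ (j ≡ d1 ⊎ j ≡ d2 ⊎ j ≡ d3)
  outer≢d s (inj₁ refl)        = C.asym s c1d1
  outer≢d s (inj₂ (inj₁ refl)) = C.asym s (C.tr c1d1 d1d2)
  outer≢d s (inj₂ (inj₂ refl)) = C.asym s (C.tr c1d1 d1d3)

  outerCol : ∀ {j} → j < n → j ⊰ c1 → Line _≺_ (λ i → One i j) (λ i → Neg i j)
  outerCol {j} j<n j⊰c1 = uniqueCol (outer≢d j⊰c1) some' unique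
    where
    outer : ∀ {i} → One i j → UL i j ⊎ DL i j
    outer p with leftClass (C.tr j⊰c1 (C.tr c1d1 d1d2)) p
    ... | inj₁ a = a
    ... | inj₂ (_ , inj₁ refl) = ⊥-elim (C.irr j⊰c1)
    ... | inj₂ (_ , inj₂ refl) = ⊥-elim (C.asym j⊰c1 c1c2)
    some' : ∃ (λ i → One i j)
    some' with colL j<n j⊰c1
    ... | inj₁ (j , a) = j , ulOne a
    ... | inj₂ (j , a) = j , dlOne a
    unique : ∀ {i i'} → One i j → One i' j → i ≡ i'
    unique p q with outer p | outer q
    ... | inj₁ a | inj₁ b = quadCol ordR ordC ul a b
    ... | inj₁ a | inj₂ b = ⊥-elim (notL j⊰c1 a b)
    ... | inj₂ a | inj₁ b = ⊥-elim (notL j⊰c1 b a)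
    ... | inj₂ a | inj₂ b = quadCol (flipOrd ordR) ordC dl a b

  col-c1 : Line _≺_ (λ i → One i c1) (λ i → Neg i c1)
  col-c1 = uniqueCol
    (λ { (inj₁ e) → C.irr (subst (c1 ⊰_) (sym e) c1d1) ; (inj₂ (inj₁ e)) → C.irr (subst (c1 ⊰_) (sym e) (C.tr c1d1 d1d2))
       ; (inj₂ (inj₂ e)) → C.irr (subst (c1 ⊰_) (sym e) (C.tr c1d1 d1d3)) })
    (_ , c1One) (λ p q → trans (at-r p) (sym (at-r q)))
    where
    outside : c1 ⊰ c1 ⊎ c1 ≡ d1 → ⊥
    outside (inj₁ s) = C.irr s
    outside (inj₂ e) = C.irr (subst (c1 ⊰_) (sym e) c1d1)
    at-r : ∀ {i} → One i c1 → i ≡ r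
    at-r p with leftClass (C.tr c1d1 d1d2) p
    ... | inj₁ (inj₁ a) = ⊥-elim (outside (inCol ul a))
    ... | inj₁ (inj₂ a) = ⊥-elim (outside (inCol dl a))
    ... | inj₂ (e , _) = e

  col-c2 : Line _≺_ (λ i → One i c2) (λ i → Neg i c2)
  col-c2 = uniqueCol
    (λ { (inj₁ e) → C.irr (subst (d1 ⊰_) e d1c2) ; (inj₂ (inj₁ e)) → C.irr (subst (c2 ⊰_) (sym e) c2d2)
       ; (inj₂ (inj₂ e)) → C.irr (subst (c2 ⊰_) (sym e) (C.tr c2d2 d2d3)) })
    (_ , c2One) (λ p q → trans (at-r p) (sym (at-r q)))
    where
    at-r : ∀ {i} → One i c2 → i ≡ r
    at-r p with leftClass c2d2 p
    ... | inj₁ (inj₁ a) = ⊥-elim (C.irr (ul⊰c2 a))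
    ... | inj₁ (inj₂ a) = ⊥-elim (C.irr (G.dr⊱c3 a))
    ... | inj₂ (e , _) = e

  col-d1 : Line _≺_ (λ i → One i d1) (λ i → Neg i d1)
  col-d1 = let (i , a) = inner ul ; (i' , b) = inner dl in
    tripleLine ordR (ulOne a) (dlOne b) ones d1Neg (λ m → proj₁ (negs m))
               (R.tr (inRow ul a) ur<) (R.tr rl< (inRow dl b))
    where
    ones : ∀ {i} → One i d1 → i ≡ proj₁ (inner ul) ⊎ i ≡ proj₁ (inner dl)
    ones p with leftClass d1d2 p
    ... | inj₁ (inj₁ a) = inj₁ (quadCol ordR ordC ul a (proj₂ (inner ul)))
    ... | inj₁ (inj₂ a) = inj₂ (quadCol (flipOrd ordR) ordC dl a (proj₂ (inner dl)))
    ... | inj₂ (_ , inj₁ e) = ⊥-elim (C.irr (subst (c1 ⊰_) e c1d1))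
    ... | inj₂ (_ , inj₂ e) = ⊥-elim (C.irr (subst (_⊰ c2) e d1c2))

  col-d2 : Line _≺_ (λ i → One i d2) (λ i → Neg i d2)
  col-d2 = tripleLine ordR uOne lOne ones d2Neg (λ m → proj₁ (negs m)) ur< rl<
    where
    ones : ∀ {i} → One i d2 → i ≡ u ⊎ i ≡ l
    ones p with class p
    ... | inj₁ (inj₁ (inj₁ a)) = ⊥-elim (C.irr (ul⊰d2 a))
    ... | inj₁ (inj₁ (inj₂ a)) = ⊥-elim (C.irr (ur⊱d2 a))
    ... | inj₁ (inj₂ (inj₁ a)) = ⊥-elim (C.irr (dl⊰d2 a))
    ... | inj₁ (inj₂ (inj₂ a)) = ⊥-elim (C.irr (dr⊱d2 a))
    ... | inj₂ (inj₁ (_ , e))  = e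
    ... | inj₂ (inj₂ (_ , h))  = ⊥-elim (d2≢c h refl)

-- `Lines` treats the upper rows, row r, the left columns and column d2; the other lines are the
-- same ones in the flipped layouts.
module Assembly {n One Neg UL UR DL DR _≺_ _⊰_ u r l c1 d1 c2 d2 c3 d3 c4}
                (g : Layout n One Neg UL UR DL DR _≺_ _⊰_ u r l c1 d1 c2 d2 c3 d3 c4) where
  open Layout g
  private
    module A = Lines g
    module Aᶜ = Lines (flipLC g)
    module Aʳ = Lines (flipLR g)

  rowLines : ∀ {i} → i < n → Line _⊰_ (One i) (Neg i)
  rowLines i<n with rows i<n
  ... | inj₁ (inj₁ s)           = A.upperRow i<n s
  ... | inj₁ (inj₂ refl)        = A.lastRow
  ... | inj₂ (inj₁ refl)        = A.centralRow
  ... | inj₂ (inj₂ (inj₁ s))    = Aʳ.upperRow i<n s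
  ... | inj₂ (inj₂ (inj₂ refl)) = Aʳ.lastRow

  colLines : ∀ {j} → j < n → Line _≺_ (λ i → One i j) (λ i → Neg i j)
  colLines j<n with cols j<n
  ... | inj₁ (inj₁ (inj₁ s))           = A.outerCol j<n s
  ... | inj₁ (inj₁ (inj₂ refl))        = A.col-c1
  ... | inj₁ (inj₂ (inj₁ refl))        = A.col-d1
  ... | inj₁ (inj₂ (inj₂ refl))        = A.col-c2
  ... | inj₂ (inj₁ refl)               = A.col-d2
  ... | inj₂ (inj₂ (inj₁ (inj₁ s)))    = Aᶜ.outerCol j<n s
  ... | inj₂ (inj₂ (inj₁ (inj₂ refl))) = Aᶜ.col-c1
  ... | inj₂ (inj₂ (inj₂ (inj₁ refl))) = Aᶜ.col-d1
  ... | inj₂ (inj₂ (inj₂ (inj₂ refl))) = Aᶜ.col-c2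

  avoids2143 : Free2143 One _≺_ _⊰_
  avoids2143 = Avoidance.avoids2143 g

  avoids3412 : Free3412 One _≺_ _⊰_
  avoids3412 p1 p2 p3 p4 a b c x y z = Avoidance.avoids2143 (flipLC g) p1 p2 p3 p4 a b c z y x

-- Layouts from words

neg : List Bool → List Bool
neg = List.map not

-- The columns c1 and d1 adjoined to the left word: the former is empty in either half, the latter nonempty in both.
ext : List Bool → List Bool
ext κ = κ ++ false ∷ true ∷ []

trues-neg : ∀ w → trues (neg w) ≡ falses w
trues-neg []          = refl
trues-neg (true ∷ w)  = trues-neg w
trues-neg (false ∷ w) = cong suc (trues-neg w)

at-neg⁺ : ∀ w {i} → i < length w → at w i ≡ false → at (neg w) i ≡ true
at-neg⁺ (x ∷ w) {zero}  _ refl = refl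
at-neg⁺ (x ∷ w) {suc i} (s≤s l) p = at-neg⁺ w l p

at-neg⁻ : ∀ w {i} → at (neg w) i ≡ true → at w i ≡ false
at-neg⁻ []          {i}     ()
at-neg⁻ (false ∷ w) {zero}  _ = refl
at-neg⁻ (x ∷ w)     {suc i} p = at-neg⁻ w p

trues-ext : ∀ κ → trues (ext κ) ≡ suc (trues κ)
trues-ext []          = refl
trues-ext (true ∷ κ)  = cong suc (trues-ext κ)
trues-ext (false ∷ κ) = trues-ext κ

length-ext : ∀ κ → length (ext κ) ≡ 2 + length κ
length-ext κ = trans (length-++ κ) (+-comm (length κ) 2)

at-ext⁺ : ∀ κ {i} → at κ i ≡ true → at (ext κ) i ≡ true
at-ext⁺ (x ∷ κ) {zero}  p = p
at-ext⁺ (x ∷ κ) {suc i} p = at-ext⁺ κ p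

at-ext-last : ∀ κ → at (ext κ) (suc (length κ)) ≡ true
at-ext-last []      = refl
at-ext-last (x ∷ κ) = at-ext-last κ

at-ext⁻ : ∀ κ {i} → at (ext κ) i ≡ true → at κ i ≡ true ⊎ i ≡ suc (length κ)
at-ext⁻ []      {suc zero} p = inj₂ refl
at-ext⁻ (x ∷ κ) {zero}  p = inj₁ p
at-ext⁻ (x ∷ κ) {suc i} p with at-ext⁻ κ p
... | inj₁ q = inj₁ q
... | inj₂ e = inj₂ (cong suc e)

at-ext : ∀ κ {i} → i < length κ → at (ext κ) i ≡ true → at κ i ≡ true
at-ext κ i< p with at-ext⁻ κ p
... | inj₁ q    = q
... | inj₂ refl = ⊥-elim (<-asym i< ≤-refl)

Diag? : ∀ ρ κ i j → Dec (Diag ρ κ i j)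
Diag? ρ κ i j = (at ρ i Bool.≟ true) ×-dec (at κ j Bool.≟ true) ×-dec (rank ρ i ≟ rank κ j)

-- Links an index i to its distance a from the border at which a word starts, so that all four
-- quadrants can be read from their outer corners.
record Coord (n : ℕ) (X : ℕ → ℕ → Set) (_≺_ : ℕ → ℕ → Set) : Set where
  field
    to    : ∀ {i} → i < n → ∃ λ a → X i a
    from  : ∀ {a} → a < n → ∃ λ i → X i a
    dom   : ∀ {i a} → X i a → i < n
    mono  : ∀ {i i' a a'} → X i a → X i' a' → i ≺ i' → a < a'
    mono⁻ : ∀ {i i' a a'} → X i a → X i' a' → a < a' → i ≺ i'
    func  : ∀ {i a a'} → X i a → X i a' → a ≡ a'
    inj   : ∀ {i i' a} → X i a → X i' a → i ≡ i'

<-ord : Ord _<_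
<-ord = record { tr = <-trans ; irr = <-irrefl refl ; cmp = cmp }
  where cmp : ∀ x y → x < y ⊎ x ≡ y ⊎ y < x
        cmp x y with <-cmp x y
        ... | tri< a _ _ = inj₁ a
        ... | tri≈ _ b _ = inj₂ (inj₁ b)
        ... | tri> _ _ c = inj₂ (inj₂ c)

Forward Backward : ℕ → ℕ → ℕ → Set
Forward  n i a = i ≡ a × i < n
Backward n i a = i + suc a ≡ n

forward : ∀ n → Coord n (Forward n) _<_
forward n = record
  { to = λ l → _ , refl , l ; from = λ l → _ , refl , l ; dom = proj₂
  ; mono = λ { (refl , _) (refl , _) l → l } ; mono⁻ = λ { (refl , _) (refl , _) l → l }
  ; func = λ { (refl , _) (refl , _) → refl } ; inj = λ { (refl , _) (refl , _) → refl } }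

backward : ∀ n → Coord n (Backward n) (λ x y → y < x)
backward n = record
  { to = λ {i} l → n ∸ suc i , trans (+-suc i _) (m+[n∸m]≡n l)
  ; from = λ {a} l → n ∸ suc a , trans (+-comm _ (suc a)) (m+[n∸m]≡n l)
  ; dom = λ {i} {a} e → subst (i <_) e (m<m+n i z<s)
  ; mono = λ {i} {i'} {a} {a'} e e' l → s≤s⁻¹ (+-cancelˡ-< i _ _ (subst (_< i + suc a') (trans e' (sym e)) (+-monoˡ-< (suc a') l)))
  ; mono⁻ = λ {i} {i'} {a} {a'} e e' l → +-cancelʳ-< (suc a) _ _ (subst (i' + suc a <_) (trans e' (sym e)) (+-monoʳ-< i' (s<s l)))
  ; func = λ {i} e e' → suc-injective (+-cancelˡ-≡ i _ _ (trans e (sym e')))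
  ; inj = λ {i} {i'} {a} e e' → +-cancelʳ-≡ (suc a) i i' (trans e (sym e')) }

-- A quadrant in the coordinates of its outer corner; the columns `c` and `d` enter as the two last
-- letters of `ext κ`.
Block : (X Y : ℕ → ℕ → Set) (ρ κ : List Bool) → ℕ → ℕ → Set
Block X Y ρ κ i j = ∃ λ a → ∃ λ b → X i a × Y j b × Diag ρ (ext κ) a b

module BlockProps {n X Y _≺_ _⊰_} (cX : Coord n X _≺_) (cY : Coord n Y _⊰_) (ρ κ : List Bool)
                  (ρ≤ : length ρ ≤ n) (κ≤ : 2 + length κ ≤ n) (ρκ : trues ρ ≡ suc (trues κ)) where
  private
    module X = Coord cX
    module Y = Coord cY

  -- The inner column marked by `ext` needs a row of its own, hence the one additional mark in ρ.
  balanced : trues ρ ≡ trues (ext κ)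
  balanced = trans ρκ (sym (trues-ext κ))

  rowTotal : ∀ {i a} → X i a → at ρ a ≡ true → ∃ λ j → Block X Y ρ κ i j
  rowTotal x p =
    let (b , D) = Diag-total {ρ} {ext κ} balanced p
        (j , y) = Y.from (<-≤-trans (at-length (ext κ) (proj₁ (proj₂ D))) (subst (_≤ n) (sym (length-ext κ)) κ≤))
    in j , _ , b , x , y , D

  colTotal : ∀ {j b} → Y j b → at (ext κ) b ≡ true → ∃ λ i → Block X Y ρ κ i j
  colTotal y p =
    let (a , D) = Diag-total {ext κ} {ρ} (sym balanced) p
        (i , x) = X.from (<-≤-trans (at-length ρ (proj₁ (proj₂ D))) ρ≤)
    in i , a , _ , x , y , Diag-sym {ext κ} {ρ} D

  rowMarked : ∀ {i j a} → Block X Y ρ κ i j → X i a → at ρ a ≡ true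
  rowMarked (_ , _ , x , _ , p , _) x' = subst (λ a → at ρ a ≡ true) (X.func x x') p

  colMarked : ∀ {i j b} → Block X Y ρ κ i j → Y j b → at (ext κ) b ≡ true
  colMarked (_ , _ , _ , y , _ , p , _) y' = subst (λ b → at (ext κ) b ≡ true) (Y.func y y') p

  quad : ∀ {u c d} → X u (length ρ) → Y c (length κ) → Y d (suc (length κ)) → Quad n (Block X Y ρ κ) _≺_ _⊰_ u c d
  quad {u} {c} {d} xu yc yd = record
    { inRow = λ { (a , b , x , y , p , _) → X.mono⁻ x xu (at-length ρ p) }
    ; inCol = λ { (a , b , x , y , _ , p , _) → inColumn y p }
    ; range = λ { (a , b , x , y , _) → X.dom x , Y.dom y }
    ; mono  = λ { (a , b , x , y , D) (a' , b' , x' , y' , D') l → Y.mono⁻ y y' (Diag-mono {ρ} {ext κ} D D' (X.mono x x' l)) }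
    ; monoᵀ = λ { (a , b , x , y , D) (a' , b' , x' , y' , D') l →
                  X.mono⁻ x x' (Diag-mono {ext κ} {ρ} (Diag-sym {ρ} {ext κ} D) (Diag-sym {ρ} {ext κ} D') (Y.mono y y' l)) }
    ; inner = colTotal yd (at-ext-last κ) }
    where
    inColumn : ∀ {j b} → Y j b → at (ext κ) b ≡ true → j ⊰ c ⊎ j ≡ d
    inColumn y p with at-ext⁻ κ p
    ... | inj₁ q    = inj₁ (Y.mono⁻ y yc (at-length κ q))
    ... | inj₂ refl = inj₂ (Y.inj y yd)

  Block? : ∀ i j → Dec (Block X Y ρ κ i j)
  Block? i j with i <? n | j <? n
  ... | no  i≮n | _       = no λ { (_ , _ , x , _) → i≮n (X.dom x) }
  ... | yes _   | no  j≮n = no λ { (_ , _ , _ , y , _) → j≮n (Y.dom y) }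
  ... | yes i<n | yes j<n =
    let (a , x) = X.to i<n ; (b , y) = Y.to j<n in
    map′ (λ D → a , b , x , y , D)
         (λ { (a' , b' , x' , y' , D) → subst₂ (Diag ρ (ext κ)) (X.func x' x) (Y.func y' y) D })
         (Diag? ρ (ext κ) a b)

at? : ∀ w {i} → i < length w → at w i ≡ true ⊎ at (neg w) i ≡ true
at? w {i} l with at w i in e
... | true  = inj₁ refl
... | false = inj₂ (at-neg⁺ w l e)

at-neg-⊥ : ∀ w {i} → at w i ≡ true → at (neg w) i ≡ true → ⊥
at-neg-⊥ w p q with () ← trans (sym p) (at-neg⁻ w q)

-- The words are read from the outside towards the centre. A letter of U tells whether the one of that row is on the left,
-- of D whether it is on the right, of L whether the one of that column is in the upper half, of R whether it is in the lower one.
module Words (n : ℕ) (U D L R : List Bool)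
             (tU : trues U ≡ suc (trues L)) (fU : falses U ≡ suc (falses R))
             (tD : trues D ≡ suc (trues R)) (fD : falses D ≡ suc (falses L))
             (UDn : 2 + length U + suc (length D) ≡ n) (LRn : 6 + length L + suc (length R) ≡ n) where

  u r l c1 d1 c2 d2 c3 d3 c4 : ℕ
  u = length U
  r = suc u
  l = suc r
  c1 = length L
  d1 = suc c1
  c2 = suc d1
  d2 = suc c2
  c3 = suc d2
  d3 = suc c3
  c4 = suc d3

  UL UR DL DR : ℕ → ℕ → Set
  UL = Block (Forward n) (Forward n) U L
  UR = Block (Forward n) (Backward n) (neg U) (neg R)
  DL = Block (Backward n) (Forward n) (neg D) (neg L)
  DR = Block (Backward n) (Backward n) D R

  u<n : u < n
  u<n = subst (u <_) UDn (<-trans (≤-trans ≤-refl (n≤1+n _)) (m<m+n l z<s))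
  l<n : l < n
  l<n = subst (l <_) UDn (m<m+n l z<s)
  c4<n : c4 < n
  c4<n = subst (c4 <_) LRn (m<m+n c4 z<s)
  D≤n : length D ≤ n
  D≤n = subst (length D ≤_) UDn (≤-trans (n≤1+n _) (m≤n+m _ l))
  R≤n : 2 + length R ≤ n
  R≤n = subst (2 + length R ≤_) LRn (≤-trans (m≤n+m (2 + length R) d3) (≤-reflexive (+-suc d3 (suc (length R)))))
  L≤n : 2 + length L ≤ n
  L≤n = ≤-trans (m≤n+m (2 + length L) 5) c4<n

  module P1 = BlockProps (forward n) (forward n) U L (<⇒≤ u<n) L≤n tU
  module P2 = BlockProps (forward n) (backward n) (neg U) (neg R) (subst (_≤ n) (sym (length-map not U)) (<⇒≤ u<n))
                         (subst (λ m → 2 + m ≤ n) (sym (length-map not R)) R≤n)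
                         (trans (trues-neg U) (trans fU (cong suc (sym (trues-neg R)))))
  module P3 = BlockProps (backward n) (forward n) (neg D) (neg L) (subst (_≤ n) (sym (length-map not D)) D≤n)
                         (subst (λ m → 2 + m ≤ n) (sym (length-map not L)) L≤n)
                         (trans (trues-neg D) (trans fD (cong suc (sym (trues-neg L)))))
  module P4 = BlockProps (backward n) (backward n) D R D≤n R≤n tD
  module B = Coord (backward n)

  One Neg : ℕ → ℕ → Set
  One i j = ((UL i j ⊎ UR i j) ⊎ (DL i j ⊎ DR i j)) ⊎ (j ≡ d2 × (i ≡ u ⊎ i ≡ l)) ⊎
            (i ≡ r × ((j ≡ c1 ⊎ j ≡ c2) ⊎ (j ≡ c3 ⊎ j ≡ c4)))
  Neg i j = i ≡ r × (j ≡ d1 ⊎ j ≡ d2 ⊎ j ≡ d3)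

  One? : ∀ i j → Dec (One i j)
  One? i j = ((P1.Block? i j ⊎-dec P2.Block? i j) ⊎-dec (P3.Block? i j ⊎-dec P4.Block? i j)) ⊎-dec
             (((j ≟ d2) ×-dec ((i ≟ u) ⊎-dec (i ≟ l))) ⊎-dec
              ((i ≟ r) ×-dec (((j ≟ c1) ⊎-dec (j ≟ c2)) ⊎-dec ((j ≟ c3) ⊎-dec (j ≟ c4)))))

  Neg? : ∀ i j → Dec (Neg i j)
  Neg? i j = (i ≟ r) ×-dec ((j ≟ d1) ⊎-dec ((j ≟ d2) ⊎-dec (j ≟ d3)))

  -- The size equations have the form of `Backward`: the lengths of D and R are the distances of row
  -- l and of column c4 from the far border.
  lRow : Backward n l (length D)
  lRow = UDn
  c4Col : Backward n c4 (length R)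
  c4Col = LRn
  d3Col : Backward n d3 (suc (length R))
  d3Col = trans (+-suc d3 (suc (length R))) LRn

  split≤ : ∀ {j m} → j < suc m → j < m ⊎ j ≡ m
  split≤ p = m≤n⇒m<n∨m≡n (s≤s⁻¹ p)

  layout : Layout n One Neg UL UR DL DR _<_ _<_ u r l c1 d1 c2 d2 c3 d3 c4
  layout = record
    { ordR = <-ord ; ordC = <-ord
    ; ul = P1.quad (refl , u<n) (refl , <-trans ≤-refl L≤n) (refl , L≤n)
    ; ur = P2.quad (sym (length-map not U) , u<n) (subst (Backward n c4) (sym (length-map not R)) c4Col)
                   (subst (λ m → Backward n d3 (suc m)) (sym (length-map not R)) d3Col)
    ; dl = P3.quad (subst (Backward n l) (sym (length-map not D)) lRow) (sym (length-map not L) , <-trans ≤-refl L≤n)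
                   (cong suc (sym (length-map not L)) , L≤n)
    ; dr = P4.quad lRow c4Col d3Col
    ; rowU = λ {i} i<n i<u → case2 (at? U i<u) (P1.rowTotal (refl , i<n)) (P2.rowTotal (refl , i<n))
    ; rowD = λ {i} i<n l<i → let (a , x) = B.to i<n in
               case2 (swap2 (at? D (B.mono x lRow l<i))) (P3.rowTotal x) (P4.rowTotal x)
    ; colL = λ {j} j<n j<c → case2 (at? L j<c) (P1.colTotal (refl , j<n) ∘ at-ext⁺ L) (P3.colTotal (refl , j<n) ∘ at-ext⁺ (neg L))
    ; colR = λ {j} j<n c<j → let (b , y) = B.to j<n in
               case2 (swap2 (at? R (B.mono y c4Col c<j))) (P2.colTotal y ∘ at-ext⁺ (neg R)) (P4.colTotal y ∘ at-ext⁺ R)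
    ; notU = λ { p@(_ , _ , x , _) q → at-neg-⊥ U (P1.rowMarked p x) (P2.rowMarked q x) }
    ; notD = λ { p@(_ , _ , x , _) q → at-neg-⊥ D (P4.rowMarked q x) (P3.rowMarked p x) }
    ; notL = λ { j<c p@(_ , _ , _ , y@(refl , _) , _) q → at-neg-⊥ L
               (at-ext L j<c (P1.colMarked p y))
               (at-ext (neg L) (subst (_ <_) (sym (length-map not L)) j<c) (P3.colMarked q y)) }
    ; notR = λ { c<j p@(_ , _ , _ , y , _) q → at-neg-⊥ R
               (at-ext R (B.mono y c4Col c<j) (P4.colMarked q y))
               (at-ext (neg R) (subst (_ <_) (sym (length-map not R)) (B.mono y c4Col c<j)) (P2.colMarked p y)) }
    ; rows = rows' ; cols = cols'
    ; ur< = ≤-refl ; rl< = ≤-refl ; c1d1 = ≤-refl ; d1c2 = ≤-refl ; c2d2 = ≤-refl ; d2c3 = ≤-refl ; c3d3 = ≤-refl ; d3c4 = ≤-refl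
    ; ulOne = inj₁ ∘ inj₁ ∘ inj₁ ; urOne = inj₁ ∘ inj₁ ∘ inj₂ ; dlOne = inj₁ ∘ inj₂ ∘ inj₁ ; drOne = inj₁ ∘ inj₂ ∘ inj₂
    ; uOne = inj₂ (inj₁ (refl , inj₁ refl)) ; lOne = inj₂ (inj₁ (refl , inj₂ refl))
    ; c1One = inj₂ (inj₂ (refl , inj₁ (inj₁ refl))) ; c2One = inj₂ (inj₂ (refl , inj₁ (inj₂ refl)))
    ; c3One = inj₂ (inj₂ (refl , inj₂ (inj₁ refl))) ; c4One = inj₂ (inj₂ (refl , inj₂ (inj₂ refl)))
    ; class = λ p → p ; negs = λ m → m
    ; d1Neg = refl , inj₁ refl ; d2Neg = refl , inj₂ (inj₁ refl) ; d3Neg = refl , inj₂ (inj₂ refl) }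
    where
    case2 : ∀ {A B C D : Set} → A ⊎ B → (A → C) → (B → D) → C ⊎ D
    case2 (inj₁ a) f g = inj₁ (f a)
    case2 (inj₂ b) f g = inj₂ (g b)
    swap2 : ∀ {A B : Set} → A ⊎ B → B ⊎ A
    swap2 (inj₁ a) = inj₂ a
    swap2 (inj₂ b) = inj₁ b
    rows' : ∀ {i} → i < n → (i < u ⊎ i ≡ u) ⊎ (i ≡ r) ⊎ (l < i ⊎ i ≡ l)
    rows' {i} _ with <-cmp i r
    ... | tri< p _ _ = inj₁ (split≤ p)
    ... | tri≈ _ e _ = inj₂ (inj₁ e)
    ... | tri> _ _ p with m≤n⇒m<n∨m≡n p
    ...   | inj₁ q = inj₂ (inj₂ (inj₁ q))
    ...   | inj₂ e = inj₂ (inj₂ (inj₂ (sym e)))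
    cols' : ∀ {j} → j < n → ((j < c1 ⊎ j ≡ c1) ⊎ (j ≡ d1 ⊎ j ≡ c2)) ⊎ (j ≡ d2) ⊎ ((c4 < j ⊎ j ≡ c4) ⊎ (j ≡ d3 ⊎ j ≡ c3))
    cols' {j} _ with <-cmp j d2
    ... | tri≈ _ e _ = inj₂ (inj₁ e)
    ... | tri< p _ _ with split≤ p
    ...   | inj₂ e = inj₁ (inj₂ (inj₂ e))
    ...   | inj₁ q with split≤ q
    ...     | inj₂ e = inj₁ (inj₂ (inj₁ e))
    ...     | inj₁ s = inj₁ (inj₁ (split≤ s))
    cols' {j} _ | tri> _ _ p with m≤n⇒m<n∨m≡n p
    ...   | inj₂ e = inj₂ (inj₂ (inj₂ (inj₂ (sym e))))
    ...   | inj₁ q with m≤n⇒m<n∨m≡n q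
    ...     | inj₂ e = inj₂ (inj₂ (inj₂ (inj₁ (sym e))))
    ...     | inj₁ s with m≤n⇒m<n∨m≡n s
    ...       | inj₂ e = inj₂ (inj₂ (inj₁ (inj₂ (sym e))))
    ...       | inj₁ t = inj₂ (inj₂ (inj₁ (inj₁ t)))

  size : ∀ {i j} → One i j → i < n × j < n
  size p with p
  ... | inj₁ (inj₁ (inj₁ a)) = Quad.range (Layout.ul layout) a
  ... | inj₁ (inj₁ (inj₂ a)) = Quad.range (Layout.ur layout) a
  ... | inj₁ (inj₂ (inj₁ a)) = Quad.range (Layout.dl layout) a
  ... | inj₁ (inj₂ (inj₂ a)) = Quad.range (Layout.dr layout) a
  ... | inj₂ (inj₁ (refl , inj₁ refl)) = u<n , ≤-trans (m≤n+m _ 3) c4<n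
  ... | inj₂ (inj₁ (refl , inj₂ refl)) = l<n , ≤-trans (m≤n+m _ 3) c4<n
  ... | inj₂ (inj₂ (refl , inj₁ (inj₁ refl))) = ≤-trans (n≤1+n _) l<n , ≤-trans (m≤n+m _ 6) c4<n
  ... | inj₂ (inj₂ (refl , inj₁ (inj₂ refl))) = ≤-trans (n≤1+n _) l<n , ≤-trans (m≤n+m _ 4) c4<n
  ... | inj₂ (inj₂ (refl , inj₂ (inj₁ refl))) = ≤-trans (n≤1+n _) l<n , ≤-trans (m≤n+m _ 2) c4<n
  ... | inj₂ (inj₂ (refl , inj₂ (inj₂ refl))) = ≤-trans (n≤1+n _) l<n , c4<n

-- Matrices as functions

nth-lookup : ∀ {A : Set} {n} d (v : Vec A n) k → nth d (Vec.toList v) (toℕ k) ≡ lookup v k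
nth-lookup d (x ∷ v) Fin.zero    = refl
nth-lookup d (x ∷ v) (Fin.suc k) = nth-lookup d v k

nth-beyond : ∀ {A : Set} {n} d (v : Vec A n) {i} → n ≤ i → nth d (Vec.toList v) i ≡ d
nth-beyond d []      _       = refl
nth-beyond d (x ∷ v) {suc i} (s≤s p) = nth-beyond d v p

-- Extension by 0 to all natural indices, so that positions can be compared and computed without
-- carrying bounds.
cell : ∀ {n} → Matrix n → ℕ → ℕ → ℤ
cell A i j = nth 0ℤ (nth [] (Vec.toList (Vec.map Vec.toList A)) i) j

cell-row : ∀ {n} (A : Matrix n) i j → cell A (toℕ i) j ≡ nth 0ℤ (row A i) j
cell-row A i j = cong (λ xs → nth 0ℤ xs j) (trans (nth-lookup [] (Vec.map Vec.toList A) i) (lookup-map i Vec.toList A))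

cell-entry : ∀ {n} (A : Matrix n) i j → cell A (toℕ i) (toℕ j) ≡ entry A i j
cell-entry A i j = trans (cell-row A i (toℕ j)) (nth-lookup 0ℤ (lookup A i) j)

cell-col : ∀ {n} (A : Matrix n) i j → cell A i (toℕ j) ≡ nth 0ℤ (col A j) i
cell-col A i j = go A i
  where
  go : ∀ {m} (A : Vec (Vec ℤ _) m) i → nth 0ℤ (nth [] (Vec.toList (Vec.map Vec.toList A)) i) (toℕ j)
       ≡ nth 0ℤ (Vec.toList (Vec.map (λ r → lookup r j) A)) i
  go []      i       = refl
  go (x ∷ A) zero    = nth-lookup 0ℤ x j
  go (x ∷ A) (suc i) = go A i

cell-beyondʳ : ∀ {n} (A : Matrix n) i {j} → n ≤ j → cell A i j ≡ 0ℤ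
cell-beyondʳ {n} A i {j} n≤j = go A i
  where
  go : ∀ {m} (A : Vec (Vec ℤ n) m) i → nth 0ℤ (nth [] (Vec.toList (Vec.map Vec.toList A)) i) j ≡ 0ℤ
  go []      i       = refl
  go (x ∷ A) zero    = nth-beyond 0ℤ x n≤j
  go (x ∷ A) (suc i) = go A i

cell-beyondˡ : ∀ {n} (A : Matrix n) {i} j → n ≤ i → cell A i j ≡ 0ℤ
cell-beyondˡ A j n≤i = cong (λ xs → nth 0ℤ xs j) (nth-beyond [] (Vec.map Vec.toList A) n≤i)

cell-size : ∀ {n} (A : Matrix n) {i j} → cell A i j ≢ 0ℤ → i < n × j < n
cell-size {n} A {i} {j} h with i <? n | j <? n
... | yes p | yes q = p , q
... | no  p | _     = ⊥-elim (h (cell-beyondˡ A j (≮⇒≥ p)))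
... | _     | no  q = ⊥-elim (h (cell-beyondʳ A i (≮⇒≥ q)))

atFin : ∀ {n} {P : ℕ → Set} → (∀ (i : Fin n) → P (toℕ i)) → ∀ {i} → i < n → P i
atFin {P = P} h p = subst P (toℕ-fromℕ< p) (h (fromℕ< p))

matrix-ext : ∀ {n} (A B : Matrix n) → (∀ {i j} → i < n → j < n → cell A i j ≡ cell B i j) → A ≡ B
matrix-ext A B h = trans (sym (tabulate∘lookup A)) (trans (tabulate-cong λ i →
    trans (sym (tabulate∘lookup (lookup A i))) (trans (tabulate-cong λ j →
      trans (sym (cell-entry A i j)) (trans (h (toℕ<n i) (toℕ<n j)) (cell-entry B i j)))
    (tabulate∘lookup (lookup B i)))) (tabulate∘lookup B))

mat : ∀ {n} → (ℕ → ℕ → ℤ) → Matrix n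
mat f = tabulate λ i → tabulate λ j → f (toℕ i) (toℕ j)

cell-mat : ∀ {n} f {i j} → i < n → j < n → cell {n} (mat f) i j ≡ f i j
cell-mat {n} f {i} {j} p q = atFin {P = λ i → cell {n} (mat f) i j ≡ f i j} (λ i → atFin {P = λ j → cell {n} (mat f) (toℕ i) j ≡ f (toℕ i) j}
  (λ j → trans (cell-entry {n} (mat f) i j) (trans (cong (λ r → lookup r j) (lookup∘tabulate {n = n} (λ i → tabulate {n = n} λ j → f (toℕ i) (toℕ j)) i))
                (lookup∘tabulate {n = n} (λ j → f (toℕ i) (toℕ j)) j))) q) p

transpose : ∀ {n} → Matrix n → Matrix n
transpose A = mat (λ i j → cell A j i)

cell-transpose : ∀ {n} (A : Matrix n) i j → cell (transpose A) i j ≡ cell A j i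
cell-transpose {n} A i j with i <? n | j <? n
... | yes p | yes q = cell-mat (λ i j → cell A j i) p q
... | no  p | _     = trans (cell-beyondˡ (transpose A) j (≮⇒≥ p)) (sym (cell-beyondʳ A j (≮⇒≥ p)))
... | _     | no  q = trans (cell-beyondʳ (transpose A) i (≮⇒≥ q)) (sym (cell-beyondˡ A i (≮⇒≥ q)))

transpose-involutive : ∀ {n} (A : Matrix n) → transpose (transpose A) ≡ A
transpose-involutive A = matrix-ext _ _ λ {i} {j} _ _ → trans (cell-transpose (transpose A) i j) (cell-transpose A j i)

record Conf (n : ℕ) (f : ℕ → ℕ → ℤ) : Set where
  field
    ternary : ∀ i j → Ternary (f i j)
    size    : ∀ {i j} → f i j ≢ 0ℤ → i < n × j < n
    rowLine : ∀ {i} → i < n → LineOf (f i)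
    colLine : ∀ {j} → j < n → LineOf (λ i → f i j)

No2143 No3412 : (ℕ → ℕ → ℤ) → Set
No2143 f = Free2143 (λ i j → f i j ≡ 1ℤ) _<_ _<_
No3412 f = Free3412 (λ i j → f i j ≡ 1ℤ) _<_ _<_

LineOf-cong : ∀ {f g} → (∀ i → f i ≡ g i) → LineOf f → LineOf g
LineOf-cong h ℓ = record
  { sepOne = λ p q l → let (z , a , b , m) = sepOne ℓ (trans (h _) p) (trans (h _) q) l in z , a , b , trans (sym (h z)) m
  ; sepNeg = λ p q l → let (z , a , b , m) = sepNeg ℓ (trans (h _) p) (trans (h _) q) l in z , a , b , trans (sym (h z)) m
  ; before = λ p → let (z , a , m) = before ℓ (trans (h _) p) in z , a , trans (sym (h z)) m
  ; after  = λ p → let (z , a , m) = after ℓ (trans (h _) p) in z , a , trans (sym (h z)) m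
  ; some   = let (z , m) = some ℓ in z , trans (sym (h z)) m }

IsASM⇒Conf : ∀ {n} {A : Matrix n} → IsASM A → Conf n (cell A)
IsASM⇒Conf {n} {A} (t , r , c) = record
  { ternary = tern ; size = cell-size A
  ; rowLine = atFin {P = λ i → LineOf (cell A i)} λ i → LineOf-cong (λ j → sym (cell-row A i j))
                (Good⇒Line {row A i} (λ j → subst Ternary (cell-row A i j) (tern (toℕ i) j)) (r i))
  ; colLine = atFin {P = λ j → LineOf (λ i → cell A i j)} λ j → LineOf-cong (λ i → sym (cell-col A i j))
                (Good⇒Line {col A j} (λ i → subst Ternary (cell-col A i j) (tern i (toℕ j))) (c j)) }
  where
  tern : ∀ i j → Ternary (cell A i j)
  tern i j with i <? n | j <? n
  ... | no  p | _     = inj₁ (cell-beyondˡ A j (≮⇒≥ p))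
  ... | _     | no  q = inj₁ (cell-beyondʳ A i (≮⇒≥ q))
  ... | yes p | yes q = atFin {P = λ i → Ternary (cell A i j)} (λ i → atFin {P = λ j → Ternary (cell A (toℕ i) j)}
                          (λ j → subst Ternary (sym (cell-entry A i j)) (t i j)) q) p

Conf⇒IsASM : ∀ {n} {A : Matrix n} → Conf n (cell A) → IsASM A
Conf⇒IsASM {n} {A} c =
    (λ i j → subst Ternary (cell-entry A i j) (ternary (toℕ i) (toℕ j)))
  , (λ i → Line⇒Good {row A i} (λ j → subst Ternary (cell-row A i j) (ternary (toℕ i) j)) (LineOf-cong (cell-row A i) (rowLine (toℕ<n i))))
  , (λ j → Line⇒Good {col A j} (λ i → subst Ternary (cell-col A i j) (ternary i (toℕ j))) (LineOf-cong (λ i → cell-col A i j) (colLine (toℕ<n j))))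
  where open Conf c

pattern #0 = Fin.zero
pattern #1 = Fin.suc Fin.zero
pattern #2 = Fin.suc (Fin.suc Fin.zero)
pattern #3 = Fin.suc (Fin.suc (Fin.suc Fin.zero))

quadruple : ∀ {n a b c d} → a < n → b < n → c < n → d < n → Fin 4 → Fin n
quadruple p q r s #0 = fromℕ< p
quadruple p q r s #1 = fromℕ< q
quadruple p q r s #2 = fromℕ< r
quadruple p q r s #3 = fromℕ< s

quadruple-increasing : ∀ {n a b c d} (p : a < n) (q : b < n) (r : c < n) (s : d < n) →
                       a < b → b < c → c < d → Increasing (quadruple p q r s)
quadruple-increasing {n} p q r s ab bc cd = inc
  where
  lift : ∀ {a b} (p : a < n) (q : b < n) → a < b → fromℕ< p Fin.< fromℕ< q
  lift p q = subst₂ _<_ (sym (toℕ-fromℕ< p)) (sym (toℕ-fromℕ< q))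
  inc : Increasing (quadruple p q r s)
  inc #0 #1 _ = lift p q ab
  inc #0 #2 _ = lift p r (<-trans ab bc)
  inc #0 #3 _ = lift p s (<-trans ab (<-trans bc cd))
  inc #1 #2 _ = lift q r bc
  inc #1 #3 _ = lift q s (<-trans bc cd)
  inc #2 #3 _ = lift r s cd
  inc #0 #0 ()
  inc #1 #0 ()
  inc #1 #1 (s≤s ())
  inc #2 #0 ()
  inc #2 #1 (s≤s ())
  inc #2 #2 (s≤s (s≤s ()))
  inc #3 #0 ()
  inc #3 #1 (s≤s ())
  inc #3 #2 (s≤s (s≤s ()))
  inc #3 #3 (s≤s (s≤s (s≤s ())))

one≢0 : ∀ {z} → z ≡ 1ℤ → z ≢ 0ℤ
one≢0 refl ()

module _ {n} (A : Matrix n) where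

  private
    sz : ∀ {i j} → cell A i j ≡ 1ℤ → i < n × j < n
    sz p = cell-size A (one≢0 p)

    entry-one : ∀ {i j} (p : i < n) (q : j < n) → cell A i j ≡ 1ℤ → entry A (fromℕ< p) (fromℕ< q) ≡ 1ℤ
    entry-one p q e = trans (sym (cell-entry A (fromℕ< p) (fromℕ< q)))
                            (trans (cong₂ (cell A) (toℕ-fromℕ< p) (toℕ-fromℕ< q)) e)

  Avoids⇒No2143 : Avoids A p2143 → No2143 (cell A)
  Avoids⇒No2143 av {i1} {i2} {i3} {i4} {j1} {j2} {j3} {j4} a b c d i12 i23 i34 j12 j23 j34 =
    av (quadruple (proj₁ (sz a)) (proj₁ (sz b)) (proj₁ (sz c)) (proj₁ (sz d)) ,
        quadruple (proj₂ (sz b)) (proj₂ (sz a)) (proj₂ (sz d)) (proj₂ (sz c)) ,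
        quadruple-increasing _ _ _ _ i12 i23 i34 , quadruple-increasing _ _ _ _ j12 j23 j34 ,
        λ { #0 → entry-one (proj₁ (sz a)) (proj₂ (sz a)) a ; #1 → entry-one (proj₁ (sz b)) (proj₂ (sz b)) b
          ; #2 → entry-one (proj₁ (sz c)) (proj₂ (sz c)) c ; #3 → entry-one (proj₁ (sz d)) (proj₂ (sz d)) d })

  Avoids⇒No3412 : Avoids A p3412 → No3412 (cell A)
  Avoids⇒No3412 av {i1} {i2} {i3} {i4} {j1} {j2} {j3} {j4} a b c d i12 i23 i34 j12 j23 j34 =
    av (quadruple (proj₁ (sz a)) (proj₁ (sz b)) (proj₁ (sz c)) (proj₁ (sz d)) ,
        quadruple (proj₂ (sz c)) (proj₂ (sz d)) (proj₂ (sz a)) (proj₂ (sz b)) ,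
        quadruple-increasing _ _ _ _ i12 i23 i34 , quadruple-increasing _ _ _ _ j12 j23 j34 ,
        λ { #0 → entry-one (proj₁ (sz a)) (proj₂ (sz a)) a ; #1 → entry-one (proj₁ (sz b)) (proj₂ (sz b)) b
          ; #2 → entry-one (proj₁ (sz c)) (proj₂ (sz c)) c ; #3 → entry-one (proj₁ (sz d)) (proj₂ (sz d)) d })

  No2143⇒Avoids : No2143 (cell A) → Avoids A p2143
  No2143⇒Avoids avoid (f , g , incf , incg , h) =
    avoid (one #0) (one #1) (one #2) (one #3)
       (incf #0 #1 ≤-refl) (incf #1 #2 ≤-refl) (incf #2 #3 ≤-refl)
       (incg #0 #1 ≤-refl) (incg #1 #2 ≤-refl) (incg #2 #3 ≤-refl)
    where one : ∀ k → cell A (toℕ (f k)) (toℕ (g (p2143 k))) ≡ 1ℤ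
          one k = trans (cell-entry A (f k) (g (p2143 k))) (h k)

  No3412⇒Avoids : No3412 (cell A) → Avoids A p3412
  No3412⇒Avoids avoid (f , g , incf , incg , h) =
    avoid (one #0) (one #1) (one #2) (one #3)
       (incf #0 #1 ≤-refl) (incf #1 #2 ≤-refl) (incf #2 #3 ≤-refl)
       (incg #0 #1 ≤-refl) (incg #1 #2 ≤-refl) (incg #2 #3 ≤-refl)
    where one : ∀ k → cell A (toℕ (f k)) (toℕ (g (p3412 k))) ≡ 1ℤ
          one k = trans (cell-entry A (f k) (g (p3412 k))) (h k)

-- Counting the negative entries

sumTo : ℕ → (ℕ → ℕ) → ℕ
sumTo zero    g = 0
sumTo (suc n) g = g 0 + sumTo n (g ∘ suc)

sumTo-cong : ∀ n {g h} → (∀ {i} → i < n → g i ≡ h i) → sumTo n g ≡ sumTo n h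
sumTo-cong zero    e = refl
sumTo-cong (suc n) e = cong₂ _+_ (e z<s) (sumTo-cong n (e ∘ s<s))

sumTo-0 : ∀ n → sumTo n (λ _ → 0) ≡ 0
sumTo-0 zero    = refl
sumTo-0 (suc n) = sumTo-0 n

sumTo-+ : ∀ n g h → sumTo n (λ i → g i + h i) ≡ sumTo n g + sumTo n h
sumTo-+ zero    g h = refl
sumTo-+ (suc n) g h = trans (cong (g 0 + h 0 +_) (sumTo-+ n (g ∘ suc) (h ∘ suc))) (interchange (g 0) (h 0) (sumTo n (g ∘ suc)) _)

sumTo-swap : ∀ m n (g : ℕ → ℕ → ℕ) → sumTo m (λ i → sumTo n (g i)) ≡ sumTo n (λ j → sumTo m (λ i → g i j))
sumTo-swap zero    n g = sym (sumTo-0 n)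
sumTo-swap (suc m) n g = trans (cong (sumTo n (g 0) +_) (sumTo-swap m n (g ∘ suc))) (sym (sumTo-+ n (g 0) _))

sumTo-single : ∀ n {g r} → r < n → (∀ {i} → i ≢ r → g i ≡ 0) → sumTo n g ≡ g r
sumTo-single (suc n) {g} {zero} _ h = trans (cong (g 0 +_) (trans (sumTo-cong n (λ {i} _ → h {suc i} λ ())) (sumTo-0 n))) (+-identityʳ (g 0))
sumTo-single (suc n) {g} {suc r} (s≤s p) h =
  trans (cong₂ _+_ (h {0} λ ()) (sumTo-single n p (λ i≢r → h (i≢r ∘ suc-injective)))) refl

isNeg : ℤ → ℕ
isNeg z with z ℤ.≟ -1ℤ
... | yes _ = 1
... | no  _ = 0

isNeg-yes : ∀ {z} → z ≡ -1ℤ → isNeg z ≡ 1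
isNeg-yes refl = refl

isNeg-no : ∀ {z} → z ≢ -1ℤ → isNeg z ≡ 0
isNeg-no {z} h with z ℤ.≟ -1ℤ
... | yes e = ⊥-elim (h e)
... | no _  = refl

negCells : ℕ → (ℕ → ℕ → ℤ) → ℕ
negCells n f = sumTo n (λ i → sumTo n (λ j → isNeg (f i j)))

private
  negsIn : List ℤ → ℕ
  negsIn xs = length (filter (λ x → x ℤ.≟ -1ℤ) xs)

  negsIn-++ : ∀ xs ys → negsIn (xs ++ ys) ≡ negsIn xs + negsIn ys
  negsIn-++ xs ys = trans (cong length (filter-++ (λ x → x ℤ.≟ -1ℤ) xs ys)) (length-++ (filter (λ x → x ℤ.≟ -1ℤ) xs))

  negsIn-∷ : ∀ x xs → negsIn (x ∷ xs) ≡ isNeg x + negsIn xs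
  negsIn-∷ x xs with x ℤ.≟ -1ℤ
  ... | yes p = refl
  ... | no  p = refl

  negsIn-line : ∀ {n} (v : Vec ℤ n) → negsIn (Vec.toList v) ≡ sumTo n (λ j → isNeg (nth 0ℤ (Vec.toList v) j))
  negsIn-line []      = refl
  negsIn-line (x ∷ v) = trans (negsIn-∷ x (Vec.toList v)) (cong (isNeg x +_) (negsIn-line v))

  negsIn-concat : ∀ n (h : Fin n → List ℤ) {g} → (∀ k → negsIn (h k) ≡ g (toℕ k)) → negsIn (concat (List.tabulate h)) ≡ sumTo n g
  negsIn-concat zero    h e = refl
  negsIn-concat (suc n) h e = trans (negsIn-++ (h Fin.zero) _) (cong₂ _+_ (e Fin.zero) (negsIn-concat n (h ∘ Fin.suc) (e ∘ Fin.suc)))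

negCount≡negCells : ∀ {n} (A : Matrix n) → negCount A ≡ negCells n (cell A)
negCount≡negCells {n} A = trans (cong (negsIn ∘ concat) (map-tabulate (λ i → i) (row A)))
  (negsIn-concat n (row A) λ i → trans (negsIn-line (lookup A i)) (sumTo-cong n (λ {j} _ → cong isNeg (sym (cell-row A i j)))))

record Facts (n : ℕ) (f : ℕ → ℕ → ℤ) : Set where
  field
    conf   : Conf n f
    no2143 : No2143 f
    no3412 : No3412 f
    three  : negCells n f ≡ 3

InASM3⇒Facts : ∀ {n} {A : Matrix n} → InASM3 A → Facts n (cell A)
InASM3⇒Facts {n} {A} (a , p , q , c) = record
  { conf = IsASM⇒Conf {A = A} a ; no2143 = Avoids⇒No2143 A p ; no3412 = Avoids⇒No3412 A q ; three = trans (sym (negCount≡negCells A)) c }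

Facts⇒InASM3 : ∀ {n} {A : Matrix n} → Facts n (cell A) → InASM3 A
Facts⇒InASM3 {n} {A} F = Conf⇒IsASM {A = A} conf , No2143⇒Avoids A no2143 , No3412⇒Avoids A no3412 , trans (negCount≡negCells A) three
  where open Facts F

Facts-cong : ∀ {n f g} → (∀ i j → f i j ≡ g i j) → Facts n f → Facts n g
Facts-cong {n} e F = record
  { conf = record
    { ternary = λ i j → subst Ternary (e i j) (ternary i j) ; size = λ h → size (λ z → h (trans (sym (e _ _)) z))
    ; rowLine = λ l → LineOf-cong (e _) (rowLine l) ; colLine = λ l → LineOf-cong (λ i → e i _) (colLine l) }
  ; no2143 = λ a b c d → no2143 (trans (e _ _) a) (trans (e _ _) b) (trans (e _ _) c) (trans (e _ _) d)
  ; no3412 = λ a b c d → no3412 (trans (e _ _) a) (trans (e _ _) b) (trans (e _ _) c) (trans (e _ _) d)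
  ; three = trans (sumTo-cong n (λ _ → sumTo-cong n (λ _ → cong isNeg (sym (e _ _))))) three }
  where open Facts F
        open Conf conf

-- Both 2143 and 3412 are involutions, so transposition preserves each pattern: its four ones are
-- merely listed by column.
Facts-flip : ∀ {n f} → Facts n f → Facts n (λ i j → f j i)
Facts-flip {n} {f} F = record
  { conf = record { ternary = λ i j → ternary j i ; size = λ h → proj₂ (size h) , proj₁ (size h) ; rowLine = colLine ; colLine = rowLine }
  ; no2143 = λ a b c d p q r x y z → no2143 b a d c x y z p q r
  ; no3412 = λ a b c d p q r x y z → no3412 c d a b x y z p q r
  ; three = trans (sumTo-swap n n (λ i j → isNeg (f j i))) three }
  where open Facts F
        open Conf conf

transpose-InASM3 : ∀ {n} {A : Matrix n} → InASM3 A → InASM3 (transpose A)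
transpose-InASM3 {n} {A} h = Facts⇒InASM3 {A = transpose A} (Facts-cong (λ i j → sym (cell-transpose A i j)) (Facts-flip (InASM3⇒Facts {A = A} h)))

-- Matrices from words

record Config (n : ℕ) : Set where
  field
    U D L R : List Bool
    tU  : trues U ≡ suc (trues L)
    fU  : falses U ≡ suc (falses R)
    tD  : trues D ≡ suc (trues R)
    fD  : falses D ≡ suc (falses L)
    UDn : 2 + length U + suc (length D) ≡ n
    LRn : 6 + length L + suc (length R) ≡ n

δ : ℕ → ℕ → ℕ
δ a j with j ≟ a
... | yes _ = 1
... | no  _ = 0

δ-yes : ∀ a → δ a a ≡ 1
δ-yes a with a ≟ a
... | yes _ = refl
... | no h  = ⊥-elim (h refl)

δ-no : ∀ {a j} → j ≢ a → δ a j ≡ 0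
δ-no {a} {j} h with j ≟ a
... | yes e = ⊥-elim (h e)
... | no _  = refl

sumTo-δ : ∀ {n a} → a < n → sumTo n (δ a) ≡ 1
sumTo-δ {n} {a} p = trans (sumTo-single n p δ-no) (δ-yes a)

-- Only row r contributes, and there the indicator of -1 is a sum of three point masses.
negCells-three : ∀ {n f r a b c} → r < n → a < b → b < c → c < n →
                 f r a ≡ -1ℤ → f r b ≡ -1ℤ → f r c ≡ -1ℤ →
                 (∀ {i j} → f i j ≡ -1ℤ → i ≡ r × (j ≡ a ⊎ j ≡ b ⊎ j ≡ c)) → negCells n f ≡ 3
negCells-three {n} {f} {r} {a} {b} {c} r<n ab bc c<n fa fb fc only =
  trans (sumTo-single n r<n (λ i≢r → trans (sumTo-cong n (λ _ → isNeg-no (i≢r ∘ proj₁ ∘ only))) (sumTo-0 n)))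
 (trans (sumTo-cong n (λ {j} _ → pointwise j))
 (trans (sumTo-+ n (λ j → δ a j + δ b j) (δ c))
        (cong₂ _+_ (trans (sumTo-+ n (δ a) (δ b)) (cong₂ _+_ (sumTo-δ (<-trans ab b<n)) (sumTo-δ b<n))) (sumTo-δ c<n))))
  where
  b<n : b < n
  b<n = <-trans bc c<n
  pointwise : ∀ j → isNeg (f r j) ≡ (δ a j + δ b j) + δ c j
  pointwise j with j ≟ a | j ≟ b | j ≟ c
  ... | yes refl | yes refl | _        = ⊥-elim (<-irrefl refl ab)
  ... | yes refl | _        | yes refl = ⊥-elim (<-irrefl refl (<-trans ab bc))
  ... | _        | yes refl | yes refl = ⊥-elim (<-irrefl refl bc)
  ... | yes refl | no _     | no _     = isNeg-yes fa
  ... | no _     | yes refl | no _     = isNeg-yes fb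
  ... | no _     | no _     | yes refl = isNeg-yes fc
  ... | no p     | no q     | no s     = isNeg-no (λ e → excluded (proj₂ (only e)))
    where excluded : ¬ (j ≡ a ⊎ j ≡ b ⊎ j ≡ c)
          excluded (inj₁ e)        = p e
          excluded (inj₂ (inj₁ e)) = q e
          excluded (inj₂ (inj₂ e)) = s e

Line-map : ∀ {_≺_ One Neg One' Neg'} → (∀ {x} → One x → One' x) → (∀ {x} → One' x → One x) →
           (∀ {x} → Neg x → Neg' x) → (∀ {x} → Neg' x → Neg x) → Line _≺_ One Neg → Line _≺_ One' Neg'
Line-map o o' m m' ℓ = record
  { sepOne = λ p q l → let (z , a , b , s) = sepOne ℓ (o' p) (o' q) l in z , a , b , m s
  ; sepNeg = λ p q l → let (z , a , b , s) = sepNeg ℓ (m' p) (m' q) l in z , a , b , o s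
  ; before = λ p → let (z , a , s) = before ℓ (m' p) in z , a , o s
  ; after  = λ p → let (z , a , s) = after ℓ (m' p) in z , a , o s
  ; some   = let (z , s) = some ℓ in z , o s }

cell-mat-full : ∀ {n} f → (∀ {i j} → f i j ≢ 0ℤ → i < n × j < n) → ∀ i j → cell {n} (mat f) i j ≡ f i j
cell-mat-full {n} f size i j with i <? n | j <? n
... | yes p | yes q = cell-mat f p q
... | no p  | _     = trans (cell-beyondˡ {n} (mat f) j (≮⇒≥ p)) (sym (decidable-stable (f i j ℤ.≟ 0ℤ) (p ∘ proj₁ ∘ size)))
... | yes _ | no q  = trans (cell-beyondʳ {n} (mat f) i (≮⇒≥ q)) (sym (decidable-stable (f i j ℤ.≟ 0ℤ) (q ∘ proj₂ ∘ size)))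

module Build {n : ℕ} (w : Config n) where
  open Config w public
  open Words n U D L R tU fU tD fD UDn LRn public
  private
    module Ln = Lines layout
    module Lc = Lines (flipLC layout)
    module As = Assembly layout

  disjoint : ∀ {i j} → One i j → Neg i j → ⊥
  disjoint p (refl , inj₁ e)        = Ln.d1≢c (Ln.rowOnes p) e
  disjoint p (refl , inj₂ (inj₁ e)) = Ln.d2≢c (Ln.rowOnes p) e
  disjoint p (refl , inj₂ (inj₂ e)) = Lc.d1≢c (Lc.rowOnes p) e

  val : ℕ → ℕ → ℤ
  val i j with One? i j | Neg? i j
  ... | yes _ | _     = 1ℤ
  ... | no _  | yes _ = -1ℤ
  ... | no _  | no _  = 0ℤ

  One⇒1 : ∀ {i j} → One i j → val i j ≡ 1ℤ
  One⇒1 {i} {j} p with One? i j | Neg? i j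
  ... | yes _ | _ = refl
  ... | no h  | _ = ⊥-elim (h p)

  1⇒One : ∀ {i j} → val i j ≡ 1ℤ → One i j
  1⇒One {i} {j} e with One? i j | Neg? i j
  ... | yes p | _ = p
  1⇒One {i} {j} () | no _ | yes _
  1⇒One {i} {j} () | no _ | no _

  Neg⇒-1 : ∀ {i j} → Neg i j → val i j ≡ -1ℤ
  Neg⇒-1 {i} {j} m with One? i j | Neg? i j
  ... | yes p | _     = ⊥-elim (disjoint p m)
  ... | no _  | yes _ = refl
  ... | no _  | no h  = ⊥-elim (h m)

  -1⇒Neg : ∀ {i j} → val i j ≡ -1ℤ → Neg i j
  -1⇒Neg {i} {j} e with One? i j | Neg? i j
  -1⇒Neg {i} {j} () | yes _ | _
  ... | no _ | yes m = m
  -1⇒Neg {i} {j} () | no _ | no _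

  val-ternary : ∀ i j → Ternary (val i j)
  val-ternary i j with One? i j | Neg? i j
  ... | yes _ | _     = inj₂ (inj₁ refl)
  ... | no _  | yes _ = inj₂ (inj₂ refl)
  ... | no _  | no _  = inj₁ refl

  Neg-size : ∀ {i j} → Neg i j → i < n × j < n
  Neg-size (refl , e) = ≤-trans (n≤1+n _) l<n , inColumn e
    where inColumn : ∀ {j} → j ≡ d1 ⊎ j ≡ d2 ⊎ j ≡ d3 → j < n
          inColumn (inj₁ refl)        = ≤-trans (m≤n+m _ 5) c4<n
          inColumn (inj₂ (inj₁ refl)) = ≤-trans (m≤n+m _ 3) c4<n
          inColumn (inj₂ (inj₂ refl)) = ≤-trans (m≤n+m _ 1) c4<n

  val-size : ∀ {i j} → val i j ≢ 0ℤ → i < n × j < n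
  val-size {i} {j} h with val-ternary i j
  ... | inj₁ z        = ⊥-elim (h z)
  ... | inj₂ (inj₁ p) = size (1⇒One p)
  ... | inj₂ (inj₂ m) = Neg-size (-1⇒Neg m)

  facts : Facts n val
  facts = record
    { conf = record
      { ternary = val-ternary ; size = val-size
      ; rowLine = λ p → Line-map One⇒1 1⇒One Neg⇒-1 -1⇒Neg (As.rowLines p)
      ; colLine = λ p → Line-map One⇒1 1⇒One Neg⇒-1 -1⇒Neg (As.colLines p) }
    ; no2143 = λ a b c d → As.avoids2143 (1⇒One a) (1⇒One b) (1⇒One c) (1⇒One d)
    ; no3412 = λ a b c d → As.avoids3412 (1⇒One a) (1⇒One b) (1⇒One c) (1⇒One d)
    ; three = negCells-three {f = val} (≤-trans (n≤1+n _) l<n) (n≤1+n _) (n≤1+n _) (≤-trans (n≤1+n _) c4<n)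
                (Neg⇒-1 (refl , inj₁ refl)) (Neg⇒-1 (refl , inj₂ (inj₁ refl))) (Neg⇒-1 (refl , inj₂ (inj₂ refl))) -1⇒Neg }

  abstract
    matrix : Matrix n
    matrix = mat val

    cell-matrix : ∀ i j → cell matrix i j ≡ val i j
    cell-matrix = cell-mat-full val val-size

  quadrantUL : ∀ {i j} → One i j → i < u → j < d2 → UL i j
  quadrantUL p s t with Ln.leftClass t p
  ... | inj₁ (inj₁ a) = a
  ... | inj₁ (inj₂ a) = ⊥-elim (<-asym s (<-trans (<-trans ≤-refl ≤-refl) (Quad.inRow (Layout.dl layout) a)))
  ... | inj₂ (refl , _) = ⊥-elim (<-asym s ≤-refl)

  quadrantDR : ∀ {i j} → One i j → l < i → d2 < j → DR i j
  quadrantDR p s t with Lc.leftClass t p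
  ... | inj₁ (inj₂ a) = a
  ... | inj₁ (inj₁ a) = ⊥-elim (<-asym s (<-trans (Quad.inRow (Layout.ur layout) a) (<-trans ≤-refl ≤-refl)))
  ... | inj₂ (refl , _) = ⊥-elim (<-asym s ≤-refl)

at-injective : ∀ v w → length v ≡ length w → (∀ {i} → at v i ≡ true → at w i ≡ true) →
               (∀ {i} → at w i ≡ true → at v i ≡ true) → v ≡ w
at-injective []          []          _ _ _ = refl
at-injective (true ∷ v)  (true ∷ w)  e f g = cong (true ∷_)  (at-injective v w (suc-injective e) (λ {i} → f {suc i}) (λ {i} → g {suc i}))
at-injective (false ∷ v) (false ∷ w) e f g = cong (false ∷_) (at-injective v w (suc-injective e) (λ {i} → f {suc i}) (λ {i} → g {suc i}))
at-injective (true ∷ v)  (false ∷ w) e f g with () ← f {0} refl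
at-injective (false ∷ v) (true ∷ w)  e f g with () ← g {0} refl

module Compare {n : ℕ} (w w' : Config n) (same : ∀ i j → Build.val w i j ≡ Build.val w' i j) where
  private
    module A = Build w
    module B = Build w'
    module Bk = Coord (backward n)

  one : ∀ {i j} → A.One i j → B.One i j
  one p = B.1⇒One (trans (sym (same _ _)) (A.One⇒1 p))

  neg1 : B.Neg A.r A.d1
  neg1 = B.-1⇒Neg (trans (sym (same _ _)) (A.Neg⇒-1 (refl , inj₁ refl)))

  U-length : length A.U ≡ length B.U
  U-length = suc-injective (proj₁ neg1)

  -- The leftmost negative entry of A is one of the three of B. Exchanging A and B gives the reverse
  -- inequality, hence equal lengths.
  L-length≥ : length B.L ≤ length A.L
  L-length≥ with proj₂ neg1
  ... | inj₁ e        = ≤-reflexive (sym (suc-injective e))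
  ... | inj₂ (inj₁ e) = subst (length B.L ≤_) (sym (suc-injective e)) (m≤n+m _ 2)
  ... | inj₂ (inj₂ e) = subst (length B.L ≤_) (sym (suc-injective e)) (m≤n+m _ 4)

  D-length : length A.D ≡ length B.D
  D-length = suc-injective (+-cancelˡ-≡ A.l _ _ (trans A.UDn (trans (sym B.UDn) (cong (λ m → 2 + m + suc (length B.D)) (sym U-length)))))

  module _ (L-length : length A.L ≡ length B.L) where
    private
      d2≡ : A.d2 ≡ B.d2
      d2≡ = cong (3 +_) L-length
      l≡ : A.l ≡ B.l
      l≡ = cong (2 +_) U-length

    R-length : length A.R ≡ length B.R
    R-length = suc-injective (+-cancelˡ-≡ A.c4 _ _ (trans A.LRn (trans (sym B.LRn) (cong (λ m → 6 + m + suc (length B.R)) (sym L-length)))))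

    ul : ∀ {i j} → A.UL i j → B.UL i j
    ul {i} {j} p = B.quadrantUL (one (inj₁ (inj₁ (inj₁ p)))) (subst (i <_) U-length (Quad.inRow (Layout.ul A.layout) p))
                        (subst (j <_) d2≡ (Lines.ul⊰d2 A.layout p))

    dr : ∀ {i j} → A.DR i j → B.DR i j
    dr {i} {j} p = B.quadrantDR (one (inj₁ (inj₂ (inj₂ p)))) (subst (_< i) l≡ (Quad.inRow (Layout.dr A.layout) p))
                        (subst (_< j) d2≡ (Lines.dr⊱d2 A.layout p))

    -- Each mark of U or L belongs to a one of UL, each mark of D or R to a one of DR, and both
    -- matrices have the same ones.
    U⊆ : ∀ {i} → at A.U i ≡ true → at B.U i ≡ true
    U⊆ p = let c = refl , <-trans (at-length A.U p) A.u<n ; (j , b) = A.P1.rowTotal c p in B.P1.rowMarked (ul b) c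

    L⊆ : ∀ {j} → at A.L j ≡ true → at B.L j ≡ true
    L⊆ p = let c = refl , <-trans (at-length A.L p) (<-trans ≤-refl A.L≤n) ; (i , b) = A.P1.colTotal c (at-ext⁺ A.L p) in
           at-ext B.L (subst (_ <_) L-length (at-length A.L p)) (B.P1.colMarked (ul b) c)

    D⊆ : ∀ {i} → at A.D i ≡ true → at B.D i ≡ true
    D⊆ p = let (i , c) = Bk.from (<-≤-trans (at-length A.D p) A.D≤n) ; (j , b) = A.P4.rowTotal c p in B.P4.rowMarked (dr b) c

    R⊆ : ∀ {j} → at A.R j ≡ true → at B.R j ≡ true
    R⊆ p = let (j , c) = Bk.from (<-≤-trans (at-length A.R p) (≤-trans (m≤n+m _ 2) A.R≤n)) ; (i , b) = A.P4.colTotal c (at-ext⁺ A.R p) in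
           at-ext B.R (subst (_ <_) R-length (at-length A.R p)) (B.P4.colMarked (dr b) c)

val-injective : ∀ {n} (w w' : Config n) → (∀ i j → Build.val w i j ≡ Build.val w' i j) →
                Config.U w ≡ Config.U w' × Config.D w ≡ Config.D w' × Config.L w ≡ Config.L w' × Config.R w ≡ Config.R w'
val-injective w w' same =
    at-injective _ _ C.U-length (C.U⊆ Ll) (C'.U⊆ (sym Ll)) , at-injective _ _ C.D-length (C.D⊆ Ll) (C'.D⊆ (sym Ll))
  , at-injective _ _ Ll (C.L⊆ Ll) (C'.L⊆ (sym Ll)) , at-injective _ _ (C.R-length Ll) (C.R⊆ Ll) (C'.R⊆ (sym Ll))
  where
  module C = Compare w w' same
  module C' = Compare w' w (λ i j → sym (same i j))
  Ll = ≤-antisym C'.L-length≥ C.L-length≥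

-- Words from matrices

-- What a pair of words has to record of the matrix for one quadrant; X and Y convert indices to
-- positions in the words. The decreasing quadrants use it with negated words.
record Marks (One : ℕ → ℕ → Set) (_≺_ _⊰_ : ℕ → ℕ → Set) (r u c d : ℕ) (X Y : ℕ → ℕ → Set) (ρ κ : List Bool) : Set where
  field
    ρ⁺ : ∀ {i a j} → X i a → i ≺ u → One i j → j ⊰ d → at ρ a ≡ true
    ρ⁻ : ∀ {i a} → X i a → at ρ a ≡ true → ∃ λ j → One i j × j ⊰ d
    κ⁺ : ∀ {i j b} → Y j b → j ⊰ c → One i j → i ≺ r → at κ b ≡ true
    κ⁻ : ∀ {j b} → Y j b → at κ b ≡ true → ∃ λ i → One i j × i ≺ r

module Read {n One Neg _≺_ _⊰_ r c1 d1 c2 d2 c3 d3 c4 u1 u2 u3 l1 l2 l3}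
            (g : Geo n One Neg _≺_ _⊰_ r c1 d1 c2 d2 c3 d3 c4 u1 u2 u3 l1 l2 l3)
            {X Y} (cX : Coord n X _≺_) (cY : Coord n Y _⊰_) (ρ κ : List Bool)
            (ρ≤ : length ρ ≤ n) (κ≤ : 2 + length κ ≤ n)
            (xu : X u2 (length ρ)) (yc : Y c1 (length κ)) (yd : Y d1 (suc (length κ)))
            (marks : Marks One _≺_ _⊰_ r u2 c1 d2 X Y ρ κ) where
  open Centre g
  open Marks marks
  private
    module X = Coord cX
    module Y = Coord cY

  Mem : ℕ → ℕ → Set
  Mem i j = One i j × i ≺ u2 × j ⊰ d2

  B : ℕ → ℕ → Set
  B a b = ∃ λ i → ∃ λ j → X i a × Y j b × Mem i j

  -- The only one of column c1 is in row r, and `adjacentUpper` and `centre` exclude ones between c1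
  -- and d1 and between d1 and d2.
  column : ∀ {i j} → Mem i j → j ⊰ c1 ⊎ j ≡ d1
  column {i} {j} (p , i≺u , j⊰d2) with C.cmp j d1
  ... | inj₂ (inj₁ e) = inj₂ e
  ... | inj₂ (inj₂ s) = ⊥-elim (C.irr (subst (_⊰ d2) (centre p (R.tr i≺u u2r) s (C.tr j⊰d2 d2d3)) j⊰d2))
  ... | inj₁ s with C.cmp j c1
  ...   | inj₁ t = inj₁ t
  ...   | inj₂ (inj₁ refl) = ⊥-elim (upperRow≢ (R.tr i≺u u2r) (colUnique p oc1 ndiag))
    where ndiag : ¬ (j ≡ d1 ⊎ j ≡ d2 ⊎ j ≡ d3)
          ndiag (inj₁ refl)        = C.irr s
          ndiag (inj₂ (inj₁ refl)) = C.irr j⊰d2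
          ndiag (inj₂ (inj₂ refl)) = C.asym j⊰d2 d2d3
  ...   | inj₂ (inj₂ t) = ⊥-elim (adjacentUpper p (R.tr i≺u u2r) t s)

  aboveU2 : ∀ {i j} → One i j → i ≺ r → j ⊰ d2 → Mem i j
  aboveU2 p i≺r s with last p i≺r
  ... | inj₁ refl = ⊥-elim (C.irr (subst (_⊰ d2) (rowUnique p ou2 (upperRow≢ u2r)) s))
  ... | inj₂ t    = p , t , s

  increasing' : ∀ {i i' j j'} → Mem i j → Mem i' j' → i ≺ i' → j ⊰ j'
  increasing' (p , s , t) (p' , s' , t') l = increasing p p' l (R.tr s' u2r) (C.tr t d2d3) (C.tr t' d2d3)

  increasingᵀ : ∀ {i i' j j'} → Mem i j → Mem i' j' → j ⊰ j' → i ≺ i'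
  increasingᵀ {i} {i'} m@(p , s , _) m'@(p' , _) l with R.cmp i i'
  ... | inj₁ t           = t
  ... | inj₂ (inj₁ refl) = ⊥-elim (C.irr (subst (_⊰ _) (rowUnique p p' (upperRow≢ (R.tr s u2r))) l))
  ... | inj₂ (inj₂ t)    = ⊥-elim (C.asym l (increasing' m' m t))

  -- Feeding the ones of the quadrant to `Chain-rank` yields both the equation between the numbers
  -- of marks and the place of every one.
  chain : Chain ρ (ext κ) B
  chain = record
    { marked = λ { (i , j , x , y , m@(p , s , t)) → ρ⁺ x s p t , mark y m (column m) }
    ; onRow  = λ p → let (i , x) = X.from (<-≤-trans (at-length ρ p) ρ≤) ; (j , o , s) = ρ⁻ x p
                         (b , y) = Y.to (proj₂ (dom o)) in b , i , j , x , y , o , X.mono⁻ x xu (at-length ρ p) , s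
    ; onCol  = λ p → inColumn p (at-ext⁻ κ p)
    ; rowMono = λ { (i , j , x , y , m) (i' , j' , x' , y' , m') l → Y.mono y y' (increasing' m m' (X.mono⁻ x x' l)) }
    ; colMono = λ { (i , j , x , y , m) (i' , j' , x' , y' , m') l → X.mono x x' (increasingᵀ m m' (Y.mono⁻ y y' l)) } }
    where
    mark : ∀ {i j b} → Y j b → Mem i j → j ⊰ c1 ⊎ j ≡ d1 → at (ext κ) b ≡ true
    mark y (p , s , _) (inj₁ t)    = at-ext⁺ κ (κ⁺ y t p (R.tr s u2r))
    mark y _           (inj₂ refl) = subst (λ b → at (ext κ) b ≡ true) (Y.func yd y) (at-ext-last κ)
    inColumn : ∀ {b} → at (ext κ) b ≡ true → at κ b ≡ true ⊎ b ≡ suc (length κ) → ∃ λ a → B a b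
    inColumn _ (inj₁ p) =
      let (j , y) = Y.from (<-≤-trans (at-length κ p) (≤-trans (m≤n+m _ 2) κ≤)) ; (i , o , s) = κ⁻ y p ; (a , x) = X.to (proj₁ (dom o))
      in a , i , j , x , y , aboveU2 o s (C.tr (Y.mono⁻ y yc (at-length κ p)) (C.tr c1d1 d1d2))
    -- The mark adjoined by `ext` is column d1, whose upper one is in row u1.
    inColumn _ (inj₂ refl) = let (a , x) = X.to (proj₁ (dom ou1)) in a , u1 , d1 , x , yd , aboveU2 ou1 u1r d1d2

  trues-ρ : trues ρ ≡ suc (trues κ)
  trues-ρ = trans (proj₂ (Chain-rank ρ (ext κ) chain)) (trues-ext κ)

  Mem⇒Block : ∀ {i j} → Mem i j → Block X Y ρ κ i j
  Mem⇒Block {i} {j} m@(p , _) =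
    let (a , x) = X.to (proj₁ (dom p)) ; (b , y) = Y.to (proj₂ (dom p)) ; q = i , j , x , y , m
    in a , b , x , y , proj₁ (marked chain q) , proj₂ (marked chain q) , proj₁ (Chain-rank ρ (ext κ) chain) q

  -- The marked row a contains some one of the quadrant, and the equality of ranks forces its column
  -- to be the one that the block prescribes.
  Block⇒One : ∀ {i j} → Block X Y ρ κ i j → One i j
  Block⇒One {i} {j} (a , b , x , y , p , q , e) with onRow chain p
  ... | b' , s@(i' , j' , x' , y' , o , _) =
    subst₂ One (X.inj x' x)
      (Y.inj y' (subst (Y j) (rank-injective (ext κ) q (proj₂ (marked chain s)) (trans (sym e) (proj₁ (Chain-rank ρ (ext κ) chain) s))) y)) o

module Neighbours {n One Neg _≺_ _⊰_ r c1 d1 c2 d2 c3 d3 c4 u1 u2 u3 l1 l2 l3}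
                  (g : Geo n One Neg _≺_ _⊰_ r c1 d1 c2 d2 c3 d3 c4 u1 u2 u3 l1 l2 l3) where
  open Centre g
  private module Cʳ = Centre (flipR g)

  -- Every row contains a one, and u2 is the last row above r that does.
  noRow : ∀ {i} → i < n → u2 ≺ i → i ≺ r → ⊥
  noRow i<n s t with last (proj₂ (some (rowLine i<n))) t
  ... | inj₁ refl = R.irr s
  ... | inj₂ s'   = R.asym s s'

  noColumn : ∀ {j} → j < n → c1 ⊰ j → j ⊰ d1 → ⊥
  noColumn {j} j<n s t with some (colLine j<n)
  ... | i , p with R.cmp i r
  ...   | inj₁ a        = adjacentUpper p a s t
  ...   | inj₂ (inj₂ a) = Cʳ.adjacentUpper p a s t
  ...   | inj₂ (inj₁ refl) with ones p
  ...     | inj₁ (inj₁ refl) = C.irr s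
  ...     | inj₁ (inj₂ refl) = C.asym t d1c2
  ...     | inj₂ (inj₁ refl) = C.asym t (C.tr d1d2 d2c3)
  ...     | inj₂ (inj₂ refl) = C.asym t (C.tr d1d3 d3c4)

  -- A column between d1 and d2 contains a one. Off row r this contradicts `centre` in the upper or
  -- in the lower half; in row r it can only be (r,c2).
  onlyC2 : ∀ {j} → j < n → d1 ⊰ j → j ⊰ d2 → j ≡ c2
  onlyC2 {j} j<n s t with some (colLine j<n)
  ... | i , p with R.cmp i r
  ...   | inj₁ a        = ⊥-elim (C.irr (subst (_⊰ d2) (centre p a s (C.tr t d2d3)) t))
  ...   | inj₂ (inj₂ a) = ⊥-elim (C.irr (subst (_⊰ d2) (Cʳ.centre p a s (C.tr t d2d3)) t))
  ...   | inj₂ (inj₁ refl) with ones p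
  ...     | inj₁ (inj₁ refl) = ⊥-elim (C.asym s c1d1)
  ...     | inj₁ (inj₂ e)    = e
  ...     | inj₂ (inj₁ refl) = ⊥-elim (C.asym t d2c3)
  ...     | inj₂ (inj₂ refl) = ⊥-elim (C.asym t (C.tr d2d3 d3c4))

  noColumn1 : ∀ {j} → j < n → d1 ⊰ j → j ⊰ c2 → ⊥
  noColumn1 j<n s t = C.irr (subst (_⊰ c2) (onlyC2 j<n s (C.tr t c2d2)) t)

  noColumn2 : ∀ {j} → j < n → c2 ⊰ j → j ⊰ d2 → ⊥
  noColumn2 j<n s t = C.irr (subst (c2 ⊰_) (onlyC2 j<n (C.tr d1c2 s) t) s)

succ : ∀ {n x y} → y < n → x < y → (∀ {z} → z < n → x < z → z < y → ⊥) → y ≡ suc x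
succ y<n x<y h with m≤n⇒m<n∨m≡n x<y
... | inj₁ l = ⊥-elim (h (<-trans l y<n) ≤-refl l)
... | inj₂ e = sym e

module ReadAll {n One Neg r c1 d1 c2 d2 c3 d3 c4 u1 u2 u3 l1 l2 l3}
               (g : Geo n One Neg _<_ _<_ r c1 d1 c2 d2 c3 d3 c4 u1 u2 u3 l1 l2 l3) (U D L R : List Bool)
               (eu : u2 ≡ length U) (er : r ≡ suc u2) (el : l2 ≡ suc r)
               (ec1 : c1 ≡ length L) (ed1 : d1 ≡ suc c1) (ec2 : c2 ≡ suc d1) (ed2 : d2 ≡ suc c2) (ec3 : c3 ≡ suc d2)
               (ed3 : d3 ≡ suc c3) (ec4 : c4 ≡ suc d3)
               (UDn : l2 + suc (length D) ≡ n) (LRn : c4 + suc (length R) ≡ n)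
               (mUL : Marks One _<_ _<_ r u2 c1 d2 (Forward n) (Forward n) U L)
               (mUR : Marks One _<_ (λ x y → y < x) r u2 c4 d2 (Forward n) (Backward n) (neg U) (neg R))
               (mDL : Marks One (λ x y → y < x) _<_ r l2 c1 d2 (Backward n) (Forward n) (neg D) (neg L))
               (mDR : Marks One (λ x y → y < x) (λ x y → y < x) r l2 c4 d2 (Backward n) (Backward n) D R) where
  open Centre g
  private
    module Cʳ = Centre (flipR g)

    u<n : u2 < n
    u<n = proj₁ (dom ou2)
    UDn' : 2 + length U + suc (length D) ≡ n
    UDn' = trans (cong (_+ suc (length D)) (sym (trans el (cong suc (trans er (cong suc eu)))))) UDn
    d3≡ : d3 ≡ 5 + length L
    d3≡ = trans ed3 (cong suc (trans ec3 (cong suc (trans ed2 (cong suc (trans ec2 (cong suc (trans ed1 (cong suc ec1)))))))))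
    LRn' : 6 + length L + suc (length R) ≡ n
    LRn' = trans (cong (_+ suc (length R)) (sym (trans ec4 (cong suc d3≡)))) LRn

    U≤n : length U ≤ n
    U≤n = subst (_≤ n) eu (<⇒≤ u<n)
    D≤n : length D ≤ n
    D≤n = subst (length D ≤_) UDn (≤-trans (n≤1+n _) (m≤n+m _ l2))
    L≤n : 2 + length L ≤ n
    L≤n = subst (_≤ n) (cong suc (trans ed1 (cong suc ec1))) (≤-trans d1d2 (<⇒≤ (proj₂ (dom ou2))))
    R≤n : 2 + length R ≤ n
    R≤n = subst (2 + length R ≤_) (trans (trans (+-suc d3 (suc (length R))) (cong (_+ suc (length R)) (sym ec4))) LRn) (m≤n+m (2 + length R) d3)

    d3Col : Backward n d3 (suc (length R))
    d3Col = trans (+-suc d3 (suc (length R))) (trans (cong (_+ suc (length R)) (sym ec4)) LRn)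

    len : ∀ w → length w ≡ length (neg w)
    len w = sym (length-map not w)

    module UL = Read g (forward n) (forward n) U L U≤n L≤n (eu , u<n) (ec1 , proj₂ (dom oc1)) (trans ed1 (cong suc ec1) , proj₂ (dom ou1))
                  mUL
    module UR = Read (flipC g) (forward n) (backward n) (neg U) (neg R) (subst (_≤ n) (len U) U≤n) (subst (λ m → 2 + m ≤ n) (len R) R≤n)
                  (trans eu (len U) , u<n) (subst (Backward n c4) (len R) LRn) (subst (λ m → Backward n d3 (suc m)) (len R) d3Col)
                  mUR
    module DL = Read (flipR g) (backward n) (forward n) (neg D) (neg L) (subst (_≤ n) (len D) D≤n) (subst (λ m → 2 + m ≤ n) (len L) L≤n)
                  (subst (Backward n l2) (len D) UDn) (trans ec1 (len L) , proj₂ (dom oc1))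
                  (trans (trans ed1 (cong suc ec1)) (cong suc (len L)) , proj₂ (dom ou1))
                  mDL
    module DR = Read (flipR (flipC g)) (backward n) (backward n) D R D≤n R≤n UDn LRn d3Col mDR

  config : Config n
  config = record
    { U = U ; D = D ; L = L ; R = R ; tU = UL.trues-ρ
    ; fU = trans (sym (trues-neg U)) (trans UR.trues-ρ (cong suc (trues-neg R)))
    ; tD = DR.trues-ρ ; fD = trans (sym (trues-neg D)) (trans DL.trues-ρ (cong suc (trues-neg L)))
    ; UDn = UDn' ; LRn = LRn' }

  module W = Build config

  u2≡ : u2 ≡ W.u
  u2≡ = eu
  r≡ : r ≡ W.r
  r≡ = trans er (cong suc u2≡)
  l2≡ : l2 ≡ W.l
  l2≡ = trans el (cong suc r≡)
  c1≡ : c1 ≡ W.c1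
  c1≡ = ec1
  d1≡ : d1 ≡ W.d1
  d1≡ = trans ed1 (cong suc c1≡)
  c2≡ : c2 ≡ W.c2
  c2≡ = trans ec2 (cong suc d1≡)
  d2≡ : d2 ≡ W.d2
  d2≡ = trans ed2 (cong suc c2≡)
  c3≡ : c3 ≡ W.c3
  c3≡ = trans ec3 (cong suc d2≡)
  c4≡ : c4 ≡ W.c4
  c4≡ = trans ec4 (cong suc d3≡)

  One⇒ : ∀ {i j} → One i j → W.One i j
  One⇒ {i} {j} p with R.cmp i r
  ... | inj₂ (inj₁ refl) = inj₂ (inj₂ (r≡ , cols (ones p)))
    where cols : (j ≡ c1 ⊎ j ≡ c2) ⊎ (j ≡ c3 ⊎ j ≡ c4) → (j ≡ W.c1 ⊎ j ≡ W.c2) ⊎ (j ≡ W.c3 ⊎ j ≡ W.c4)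
          cols (inj₁ (inj₁ e)) = inj₁ (inj₁ (trans e c1≡))
          cols (inj₁ (inj₂ e)) = inj₁ (inj₂ (trans e c2≡))
          cols (inj₂ (inj₁ e)) = inj₂ (inj₁ (trans e c3≡))
          cols (inj₂ (inj₂ e)) = inj₂ (inj₂ (trans e c4≡))
  ... | inj₁ s with last p s
  ...   | inj₁ refl = inj₂ (inj₁ (trans (rowUnique p ou2 (upperRow≢ s)) d2≡ , inj₁ u2≡))
  ...   | inj₂ t with C.cmp j d2
  ...     | inj₁ v           = inj₁ (inj₁ (inj₁ (UL.Mem⇒Block (p , t , v))))
  ...     | inj₂ (inj₂ v)    = inj₁ (inj₁ (inj₂ (UR.Mem⇒Block (p , t , v))))
  ...     | inj₂ (inj₁ refl) = ⊥-elim (R.irr (subst (_< u2) (colUpper p ou2 s u2r) t))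
  One⇒ {i} {j} p | inj₂ (inj₂ s) with Cʳ.last p s
  ...   | inj₁ refl = inj₂ (inj₁ (trans (Cʳ.rowUnique p ol2 (Cʳ.upperRow≢ s)) d2≡ , inj₂ l2≡))
  ...   | inj₂ t with C.cmp j d2
  ...     | inj₁ v           = inj₁ (inj₂ (inj₁ (DL.Mem⇒Block (p , t , v))))
  ...     | inj₂ (inj₂ v)    = inj₁ (inj₂ (inj₂ (DR.Mem⇒Block (p , t , v))))
  ...     | inj₂ (inj₁ refl) = ⊥-elim (R.irr (subst (l2 <_) (Cʳ.colUpper p ol2 s rl2) t))

  One⇐ : ∀ {i j} → W.One i j → One i j
  One⇐ (inj₁ (inj₁ (inj₁ a))) = UL.Block⇒One a
  One⇐ (inj₁ (inj₁ (inj₂ a))) = UR.Block⇒One a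
  One⇐ (inj₁ (inj₂ (inj₁ a))) = DL.Block⇒One a
  One⇐ (inj₁ (inj₂ (inj₂ a))) = DR.Block⇒One a
  One⇐ (inj₂ (inj₁ (e , inj₁ e'))) = subst₂ One (trans u2≡ (sym e')) (trans d2≡ (sym e)) ou2
  One⇐ (inj₂ (inj₁ (e , inj₂ e'))) = subst₂ One (trans l2≡ (sym e')) (trans d2≡ (sym e)) ol2
  One⇐ (inj₂ (inj₂ (e' , inj₁ (inj₁ e)))) = subst₂ One (trans r≡ (sym e')) (trans c1≡ (sym e)) oc1
  One⇐ (inj₂ (inj₂ (e' , inj₁ (inj₂ e)))) = subst₂ One (trans r≡ (sym e')) (trans c2≡ (sym e)) oc2
  One⇐ (inj₂ (inj₂ (e' , inj₂ (inj₁ e)))) = subst₂ One (trans r≡ (sym e')) (trans c3≡ (sym e)) oc3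
  One⇐ (inj₂ (inj₂ (e' , inj₂ (inj₂ e)))) = subst₂ One (trans r≡ (sym e')) (trans c4≡ (sym e)) oc4

  Neg⇒ : ∀ {i j} → Neg i j → W.Neg i j
  Neg⇒ m with negs m
  ... | refl , inj₁ e        = r≡ , inj₁ (trans e d1≡)
  ... | refl , inj₂ (inj₁ e) = r≡ , inj₂ (inj₁ (trans e d2≡))
  ... | refl , inj₂ (inj₂ e) = r≡ , inj₂ (inj₂ (trans e d3≡))

  Neg⇐ : Neg r d1 → Neg r d2 → Neg r d3 → ∀ {i j} → W.Neg i j → Neg i j
  Neg⇐ m1 m2 m3 (e , inj₁ e')        = subst₂ Neg (trans r≡ (sym e)) (trans d1≡ (sym e')) m1
  Neg⇐ m1 m2 m3 (e , inj₂ (inj₁ e')) = subst₂ Neg (trans r≡ (sym e)) (trans d2≡ (sym e')) m2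
  Neg⇐ m1 m2 m3 (e , inj₂ (inj₂ e')) = subst₂ Neg (trans r≡ (sym e)) (trans d3≡ (sym e')) m3

  reading : ∃ λ (w : Config n) → (∀ {i j} → One i j → Build.One w i j) × (∀ {i j} → Build.One w i j → One i j) ×
            (∀ {i j} → Neg i j → Build.Neg w i j) ×
            (Neg r d1 → Neg r d2 → Neg r d3 → ∀ {i j} → Build.Neg w i j → Neg i j)
  reading = config , One⇒ , One⇐ , Neg⇒ , Neg⇐

-- Reading the four words by bounded search

mask : ℕ → (ℕ → Bool) → List Bool
mask zero    p = []
mask (suc m) p = p 0 ∷ mask m (p ∘ suc)

length-mask : ∀ m p → length (mask m p) ≡ m
length-mask zero    p = refl
length-mask (suc m) p = cong suc (length-mask m (p ∘ suc))

mask⁺ : ∀ {m p i} → i < m → p i ≡ true → at (mask m p) i ≡ true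
mask⁺ {suc m} {p} {zero}  _       e = e
mask⁺ {suc m} {p} {suc i} (s≤s l) e = mask⁺ {m} {p ∘ suc} l e

mask⁻ : ∀ {m p i} → at (mask m p) i ≡ true → i < m × p i ≡ true
mask⁻ {suc m} {p} {zero}  e = z<s , e
mask⁻ {suc m} {p} {suc i} e = let (l , q) = mask⁻ {m} {p ∘ suc} e in s<s l , q

neg-mask : ∀ m p → neg (mask m p) ≡ mask m (not ∘ p)
neg-mask zero    p = refl
neg-mask (suc m) p = cong (not (p 0) ∷_) (neg-mask m (p ∘ suc))

negMask⁺ : ∀ {m p i} → i < m → p i ≡ false → at (neg (mask m p)) i ≡ true
negMask⁺ {m} {p} {i} l e = subst (λ w → at w i ≡ true) (sym (neg-mask m p)) (mask⁺ {m} {not ∘ p} l (cong not e))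

negMask⁻ : ∀ {m p i} → at (neg (mask m p)) i ≡ true → i < m × p i ≡ false
negMask⁻ {m} {p} {i} e with mask⁻ {m} {not ∘ p} (subst (λ w → at w i ≡ true) (neg-mask m p) e)
... | l , q with p i
...   | false = l , refl

not-true : ∀ {b} → b ≡ true → not b ≡ false
not-true refl = refl
not-false : ∀ {b} → b ≡ false → not b ≡ true
not-false refl = refl
not-true⁻ : ∀ {b} → not b ≡ true → b ≡ false
not-true⁻ {false} refl = refl
not-false⁻ : ∀ {b} → not b ≡ false → b ≡ true
not-false⁻ {true} refl = refl

module _ {P : ℕ → Set} (P? : ∀ j → Dec (P j)) where

  exists : ℕ → Bool
  exists m = does (anyUpTo? P? m)

  exists⁺ : ∀ {m j} → P j → j < m → exists m ≡ true
  exists⁺ {m} p l with anyUpTo? P? m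
  ... | yes _ = refl
  ... | no h  = ⊥-elim (h (_ , l , p))

  exists⁻ : ∀ {m} → exists m ≡ true → ∃ λ j → P j × j < m
  exists⁻ {m} e with anyUpTo? P? m
  ... | yes (j , l , p) = j , p , l

  ¬exists⁺ : ∀ {m} → (∀ {j} → P j → ¬ (j < m)) → exists m ≡ false
  ¬exists⁺ {m} h with anyUpTo? P? m
  ... | yes (j , l , p) = ⊥-elim (h p l)
  ... | no _ = refl

  ¬exists⁻ : ∀ {m} → exists m ≡ false → ∀ {j} → P j → ¬ (j < m)
  ¬exists⁻ {m} e p l with () ← trans (sym e) (exists⁺ p l)

module Sides {n One Neg _≺_ _⊰_ r c1 d1 c2 d2 c3 d3 c4 u1 u2 u3 l1 l2 l3}
             (g : Geo n One Neg _≺_ _⊰_ r c1 d1 c2 d2 c3 d3 c4 u1 u2 u3 l1 l2 l3) where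
  open Centre g

  rowSide : ∀ {i} → i < n → i ≺ u2 → ∃ λ j → One i j × (j ⊰ d2 ⊎ d2 ⊰ j)
  rowSide i<n s with some (rowLine i<n)
  ... | j , p with C.cmp j d2
  ...   | inj₁ t           = j , p , inj₁ t
  ...   | inj₂ (inj₂ t)    = j , p , inj₂ t
  ...   | inj₂ (inj₁ refl) = ⊥-elim (R.irr (subst (_≺ u2) (colUpper p ou2 (R.tr s u2r) u2r) s))

  outer≢d : ∀ {j} → j ⊰ c1 → ¬ (j ≡ d1 ⊎ j ≡ d2 ⊎ j ≡ d3)
  outer≢d s (inj₁ refl)        = C.asym s c1d1
  outer≢d s (inj₂ (inj₁ refl)) = C.asym s (C.tr c1d1 d1d2)
  outer≢d s (inj₂ (inj₂ refl)) = C.asym s (C.tr c1d1 d1d3)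

  outer≢r : ∀ {i j} → j ⊰ c1 → One i j → i ≢ r
  outer≢r s p refl with ones p
  ... | inj₁ (inj₁ refl) = C.irr s
  ... | inj₁ (inj₂ refl) = C.asym s (C.tr c1d1 d1c2)
  ... | inj₂ (inj₁ refl) = C.asym s (C.tr c1d1 (C.tr d1d2 d2c3))
  ... | inj₂ (inj₂ refl) = C.asym s (C.tr c1d1 (C.tr d1d3 d3c4))

  colSide : ∀ {j} → j < n → j ⊰ c1 → ∃ λ i → One i j × (i ≺ r ⊎ r ≺ i)
  colSide j<n s with some (colLine j<n)
  ... | i , p with R.cmp i r
  ...   | inj₁ t        = i , p , inj₁ t
  ...   | inj₂ (inj₂ t) = i , p , inj₂ t
  ...   | inj₂ (inj₁ e) = ⊥-elim (outer≢r s p e)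

  sameCol : ∀ {i i' j} → j ⊰ c1 → One i j → One i' j → i ≡ i'
  sameCol s p q = colUnique p q (outer≢d s)

  sameRow : ∀ {i j j'} → i ≺ u2 → One i j → One i j' → j ≡ j'
  sameRow s p q = rowUnique p q (upperRow≢ (R.tr s u2r))

module ReadGeo {n One Neg r c1 d1 c2 d2 c3 d3 c4 u1 u2 u3 l1 l2 l3}
               (g : Geo n One Neg _<_ _<_ r c1 d1 c2 d2 c3 d3 c4 u1 u2 u3 l1 l2 l3)
               (One? : ∀ i j → Dec (One i j)) where
  open Centre g
  private
    module S  = Sides g
    module Sᶜ = Sides (flipC g)
    module Sʳ = Sides (flipR g)
    module Nb  = Neighbours g
    module Nbᶜ = Neighbours (flipC g)
    module Nbʳ = Neighbours (flipR g)
    module Bk = Coord (backward n)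

    -- An outer row or column has a single one, so the value false places it in the opposite half;
    -- one Boolean thus serves two quadrants.
    left upper : ℕ → Bool
    left i  = exists (One? i) d2
    upper j = exists (λ i → One? i j) r

    U D L R : List Bool
    U = mask u2 left
    -- D and R start at the far border, so position a stands for the index n - 1 - a. Their letters
    -- mean right and lower, whence `not`.
    D = mask (n ∸ suc l2) (λ a → not (left (n ∸ suc a)))
    L = mask c1 upper
    R = mask (n ∸ suc c4) (λ b → not (upper (n ∸ suc b)))

    reflect : ∀ {i a} → Backward n i a → n ∸ suc a ≡ i
    reflect {i} {a} e = trans (cong (_∸ suc a) (sym e)) (m+n∸n≡m i (suc a))

    u<n : u2 < n
    u<n = proj₁ (dom ou2)
    r<n : r < n
    r<n = proj₁ (dom oc1)
    l<n : l2 < n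
    l<n = proj₁ (dom ol2)
    c1<n : c1 < n
    c1<n = proj₂ (dom oc1)
    c4<n : c4 < n
    c4<n = proj₂ (dom oc4)

    lB : Backward n l2 (n ∸ suc l2)
    lB = proj₂ (Bk.to l<n)
    c4B : Backward n c4 (n ∸ suc c4)
    c4B = proj₂ (Bk.to c4<n)

    leftF : ∀ {i j} → (∀ {j j'} → One i j → One i j' → j ≡ j') → One i j → d2 < j → left i ≡ false
    leftF {i} same p t = ¬exists⁺ (One? i) (λ q s → <-asym t (subst (_< d2) (same q p) s))

    upperF : ∀ {i j} → (∀ {i i'} → One i j → One i' j → i ≡ i') → One i j → r < i → upper j ≡ false
    upperF {i} {j} same p t = ¬exists⁺ (λ i → One? i j) (λ q s → <-asym t (subst (_< r) (same q p) s))

    leftF⁻ : ∀ {i} → (∃ λ j → One i j × (j < d2 ⊎ d2 < j)) → left i ≡ false → ∃ λ j → One i j × d2 < j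
    leftF⁻ {i} (j , p , inj₁ s) e = ⊥-elim (¬exists⁻ (One? i) e p s)
    leftF⁻ {i} (j , p , inj₂ s) e = j , p , s

    upperF⁻ : ∀ {j} → (∃ λ i → One i j × (i < r ⊎ r < i)) → upper j ≡ false → ∃ λ i → One i j × r < i
    upperF⁻ {j} (i , p , inj₁ s) e = ⊥-elim (¬exists⁻ (λ i → One? i j) e p s)
    upperF⁻ {j} (i , p , inj₂ s) e = i , p , s

    U⁺ : ∀ {i j} → i < u2 → One i j → j < d2 → at U i ≡ true
    U⁺ {i} s p t = mask⁺ s (exists⁺ (One? i) p t)

    U⁻ : ∀ {i} → at U i ≡ true → ∃ λ j → One i j × j < d2
    U⁻ {i} e = exists⁻ (One? i) (proj₂ (mask⁻ {u2} {left} e))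

    negU⁺ : ∀ {i j} → i < u2 → One i j → d2 < j → at (neg U) i ≡ true
    negU⁺ s p t = negMask⁺ s (leftF (S.sameRow s) p t)

    negU⁻ : ∀ {i} → at (neg U) i ≡ true → ∃ λ j → One i j × d2 < j
    negU⁻ e = let (s , q) = negMask⁻ {u2} {left} e in leftF⁻ (S.rowSide (<-trans s u<n) s) q

    D⁺ : ∀ {i a j} → Backward n i a → l2 < i → One i j → d2 < j → at D a ≡ true
    D⁺ x s p t = mask⁺ (Bk.mono x lB s) (trans (cong (not ∘ left) (reflect x)) (not-false (leftF (Sʳ.sameRow s) p t)))

    D⁻ : ∀ {i a} → Backward n i a → at D a ≡ true → ∃ λ j → One i j × d2 < j
    D⁻ {i} {a} x e = let (s , q) = mask⁻ {n ∸ suc l2} {λ a → not (left (n ∸ suc a))} e in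
      leftF⁻ (Sʳ.rowSide (Bk.dom x) (Bk.mono⁻ x lB s)) (not-true⁻ (trans (cong (not ∘ left) (sym (reflect x))) q))

    negD⁺ : ∀ {i a j} → Backward n i a → l2 < i → One i j → j < d2 → at (neg D) a ≡ true
    negD⁺ {i} x s p t = negMask⁺ (Bk.mono x lB s) (trans (cong (not ∘ left) (reflect x)) (not-true (exists⁺ (One? i) p t)))

    negD⁻ : ∀ {i a} → Backward n i a → at (neg D) a ≡ true → ∃ λ j → One i j × j < d2
    negD⁻ {i} {a} x e = let (s , q) = negMask⁻ {n ∸ suc l2} {λ a → not (left (n ∸ suc a))} e in
      exists⁻ (One? i) (not-false⁻ (trans (cong (not ∘ left) (sym (reflect x))) q))

    L⁺ : ∀ {i j} → j < c1 → One i j → i < r → at L j ≡ true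
    L⁺ {i} {j} s p t = mask⁺ s (exists⁺ (λ i → One? i j) p t)

    L⁻ : ∀ {j} → at L j ≡ true → ∃ λ i → One i j × i < r
    L⁻ {j} e = exists⁻ (λ i → One? i j) (proj₂ (mask⁻ {c1} {upper} e))

    negL⁺ : ∀ {i j} → j < c1 → One i j → r < i → at (neg L) j ≡ true
    negL⁺ s p t = negMask⁺ s (upperF (S.sameCol s) p t)

    negL⁻ : ∀ {j} → at (neg L) j ≡ true → ∃ λ i → One i j × r < i
    negL⁻ e = let (s , q) = negMask⁻ {c1} {upper} e in upperF⁻ (S.colSide (<-trans s c1<n) s) q

    R⁺ : ∀ {i j b} → Backward n j b → c4 < j → One i j → r < i → at R b ≡ true
    R⁺ y s p t = mask⁺ (Bk.mono y c4B s) (trans (cong (not ∘ upper) (reflect y)) (not-false (upperF (Sᶜ.sameCol s) p t)))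

    R⁻ : ∀ {j b} → Backward n j b → at R b ≡ true → ∃ λ i → One i j × r < i
    R⁻ {j} {b} y e = let (s , q) = mask⁻ {n ∸ suc c4} {λ b → not (upper (n ∸ suc b))} e in
      upperF⁻ (Sᶜ.colSide (Bk.dom y) (Bk.mono⁻ y c4B s)) (not-true⁻ (trans (cong (not ∘ upper) (sym (reflect y))) q))

    negR⁺ : ∀ {i j b} → Backward n j b → c4 < j → One i j → i < r → at (neg R) b ≡ true
    negR⁺ {i} {j} y s p t = negMask⁺ (Bk.mono y c4B s) (trans (cong (not ∘ upper) (reflect y)) (not-true (exists⁺ (λ i → One? i j) p t)))

    negR⁻ : ∀ {j b} → Backward n j b → at (neg R) b ≡ true → ∃ λ i → One i j × i < r
    negR⁻ {j} {b} y e = let (s , q) = negMask⁻ {n ∸ suc c4} {λ b → not (upper (n ∸ suc b))} e in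
      exists⁻ (λ i → One? i j) (not-false⁻ (trans (cong (not ∘ upper) (sym (reflect y))) q))

    mUL : Marks One _<_ _<_ r u2 c1 d2 (Forward n) (Forward n) U L
    mUL = record { ρ⁺ = λ { (refl , _) → U⁺ } ; ρ⁻ = λ { (refl , _) → U⁻ } ; κ⁺ = λ { (refl , _) → L⁺ } ; κ⁻ = λ { (refl , _) → L⁻ } }

    mUR : Marks One _<_ (λ x y → y < x) r u2 c4 d2 (Forward n) (Backward n) (neg U) (neg R)
    mUR = record { ρ⁺ = λ { (refl , _) → negU⁺ } ; ρ⁻ = λ { (refl , _) → negU⁻ } ; κ⁺ = negR⁺ ; κ⁻ = negR⁻ }

    mDL : Marks One (λ x y → y < x) _<_ r l2 c1 d2 (Backward n) (Forward n) (neg D) (neg L)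
    mDL = record { ρ⁺ = negD⁺ ; ρ⁻ = negD⁻ ; κ⁺ = λ { (refl , _) → negL⁺ } ; κ⁻ = λ { (refl , _) → negL⁻ } }

    mDR : Marks One (λ x y → y < x) (λ x y → y < x) r l2 c4 d2 (Backward n) (Backward n) D R
    mDR = record { ρ⁺ = D⁺ ; ρ⁻ = D⁻ ; κ⁺ = R⁺ ; κ⁻ = R⁻ }

    module All = ReadAll g U D L R
      (sym (length-mask u2 left)) (succ r<n u2r Nb.noRow) (succ l<n rl2 (λ z<n s t → Nbʳ.noRow z<n t s))
      (sym (length-mask c1 upper))
      (succ (proj₂ (dom ou1)) c1d1 Nb.noColumn) (succ (proj₂ (dom oc2)) d1c2 Nb.noColumn1) (succ (proj₂ (dom ou2)) c2d2 Nb.noColumn2)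
      (succ (proj₂ (dom oc3)) d2c3 (λ z<n s t → Nbᶜ.noColumn2 z<n t s)) (succ (proj₂ (dom ou3)) c3d3 (λ z<n s t → Nbᶜ.noColumn1 z<n t s))
      (succ c4<n d3c4 (λ z<n s t → Nbᶜ.noColumn z<n t s))
      (subst (Backward n l2) (sym (length-mask (n ∸ suc l2) _)) lB) (subst (Backward n c4) (sym (length-mask (n ∸ suc c4) _)) c4B)
      mUL mUR mDL mDR

  open All public using (reading)

-- The negative entries are collinear

-- Splits off the first -1, at d; the m' positions after it are renumbered from 0, ready for the
-- next application.
nextNeg : ∀ m h {k} → sumTo m (isNeg ∘ h) ≡ suc k → ∃ λ d → ∃ λ m' → m ≡ suc d + m' × h d ≡ -1ℤ ×
          (∀ {j} → j < m → h j ≡ -1ℤ → j ≡ d ⊎ (∃ λ j' → j ≡ suc d + j' × j' < m')) × sumTo m' (λ j → isNeg (h (suc d + j))) ≡ k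
nextNeg (suc m) h {k} e = go (h 0 ℤ.≟ -1ℤ)
  where
  go : Dec (h 0 ≡ -1ℤ) → ∃ λ d → ∃ λ m' → suc m ≡ suc d + m' × h d ≡ -1ℤ ×
       (∀ {j} → j < suc m → h j ≡ -1ℤ → j ≡ d ⊎ (∃ λ j' → j ≡ suc d + j' × j' < m')) × sumTo m' (λ j → isNeg (h (suc d + j))) ≡ k
  go (yes p) = 0 , m , refl , p , cover , suc-injective (trans (cong (_+ sumTo m (isNeg ∘ h ∘ suc)) (sym (isNeg-yes p))) e)
    where cover : ∀ {j} → j < suc m → h j ≡ -1ℤ → j ≡ 0 ⊎ (∃ λ j' → j ≡ suc j' × j' < m)
          cover {zero}  _       _ = inj₁ refl
          cover {suc j} (s≤s l) _ = inj₂ (j , refl , l)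
  go (no q) =
    let (d , m' , e' , p , cov , s) = nextNeg m (h ∘ suc) (trans (cong (_+ sumTo m (isNeg ∘ h ∘ suc)) (sym (isNeg-no q))) e)
    in suc d , m' , cong suc e' , p , cover cov , s
    where cover : ∀ {d m'} → (∀ {j} → j < m → h (suc j) ≡ -1ℤ → j ≡ d ⊎ (∃ λ j' → j ≡ suc d + j' × j' < m')) →
                  ∀ {j} → j < suc m → h j ≡ -1ℤ → j ≡ suc d ⊎ (∃ λ j' → j ≡ suc (suc d) + j' × j' < m')
          cover cov {zero}  _       z = ⊥-elim (q z)
          cover cov {suc j} (s≤s l) z with cov l z
          ... | inj₁ e            = inj₁ (cong suc e)
          ... | inj₂ (j' , e , t) = inj₂ (j' , cong suc e , t)

noNeg : ∀ m h → sumTo m (isNeg ∘ h) ≡ 0 → ∀ {j} → j < m → h j ≢ -1ℤ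
noNeg (suc m) h e {zero}  _       p with () ← trans (sym (isNeg-yes p)) (m+n≡0⇒m≡0 (isNeg (h 0)) e)
noNeg (suc m) h e {suc j} (s≤s l) p = noNeg m (h ∘ suc) (m+n≡0⇒n≡0 (isNeg (h 0)) e) l p

threeNegs : ∀ n h → sumTo n (isNeg ∘ h) ≡ 3 → ∃ λ a → ∃ λ b → ∃ λ c → a < b × b < c × c < n ×
            h a ≡ -1ℤ × h b ≡ -1ℤ × h c ≡ -1ℤ × (∀ {j} → j < n → h j ≡ -1ℤ → j ≡ a ⊎ j ≡ b ⊎ j ≡ c)
threeNegs n h e with nextNeg n h e
... | a , n1 , refl , pa , cov1 , e1 with nextNeg n1 (λ j → h (suc a + j)) e1
...   | b , n2 , refl , pb , cov2 , e2 with nextNeg n2 (λ j → h (suc a + (suc b + j))) e2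
...     | c , n3 , refl , pc , cov3 , e3 =
  a , suc a + b , suc a + (suc b + c) , s≤s (m≤m+n a b) ,
  +-monoʳ-< (suc a) (s≤s (m≤m+n b c)) , +-monoʳ-< (suc a) (+-monoʳ-< (suc b) (s≤s (m≤m+n c n3))) , pa , pb , pc , cover
  where
  cover : ∀ {j} → j < _ → h j ≡ -1ℤ → j ≡ a ⊎ j ≡ suc a + b ⊎ j ≡ suc a + (suc b + c)
  cover l p with cov1 l p
  ... | inj₁ x = inj₁ x
  ... | inj₂ (_ , refl , l1) with cov2 l1 p
  ...   | inj₁ refl = inj₂ (inj₁ refl)
  ...   | inj₂ (_ , refl , l2) with cov3 l2 p
  ...     | inj₁ refl = inj₂ (inj₂ refl)
  ...     | inj₂ (_ , refl , l3) = ⊥-elim (noNeg n3 _ e3 l3 p)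

Collinear : (ℕ → ℕ → ℤ) → Set
Collinear f = ∃ λ r → ∀ {i j} → f i j ≡ -1ℤ → i ≡ r

neg≢0 : ∀ {z} → z ≡ -1ℤ → z ≢ 0ℤ
neg≢0 refl ()

module _ {n f} (F : Facts n f) where
  open Facts F
  open Conf conf

  private
    sz : ∀ {i j} → f i j ≡ -1ℤ → i < n × j < n
    sz m = size (neg≢0 m)

    around : ∀ {i i' j j'} → f i j ≡ -1ℤ → f i' j' ≡ -1ℤ → i < i' → j ≡ j'
    around {i} {i'} {j} {j'} m m' i<i' with <-cmp j j'
    ... | tri≈ _ e _ = e
    ... | tri< s _ _ =
      let (b , b< , p2) = before (rowLine (proj₁ (sz m))) m ; (a , a< , p1) = before (colLine (proj₂ (sz m))) m
          (c , c< , p3) = after (rowLine (proj₁ (sz m'))) m' ; (d , d< , p4) = after (colLine (proj₂ (sz m'))) m'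
      in ⊥-elim (no2143 p1 p2 p3 p4 a< i<i' d< b< s c<)
    -- With the columns in the other order, the horizontal neighbours are taken to the right of the
    -- upper entry and to the left of the lower one, which turns 2143 into 3412.
    ... | tri> _ _ s =
      let (b , b< , p2) = after (rowLine (proj₁ (sz m))) m ; (a , a< , p1) = before (colLine (proj₂ (sz m))) m
          (c , c< , p3) = before (rowLine (proj₁ (sz m'))) m' ; (d , d< , p4) = after (colLine (proj₂ (sz m'))) m'
      in ⊥-elim (no3412 p1 p2 p3 p4 a< i<i' d< c< s b<)

  -- Two negative entries in general position are each surrounded by ones, which form 2143 or 3412.
  negPair : ∀ {i i' j j'} → f i j ≡ -1ℤ → f i' j' ≡ -1ℤ → i ≡ i' ⊎ j ≡ j'
  negPair {i} {i'} m m' with <-cmp i i'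
  ... | tri≈ _ e _ = inj₁ e
  ... | tri< s _ _ = inj₂ (around m m' s)
  ... | tri> _ _ s = inj₂ (sym (around m' m s))

  someNeg : ∃ λ i → ∃ λ j → f i j ≡ -1ℤ
  someNeg with anyUpTo? (λ i → anyUpTo? (λ j → f i j ℤ.≟ -1ℤ) n) n
  ... | yes (i , _ , j , _ , m) = i , j , m
  ... | no h with () ← trans (sym three) (trans (sumTo-cong n (λ i<n → trans (sumTo-cong n (λ j<n → isNeg-no (λ m → h (_ , i<n , _ , j<n , m)))) (sumTo-0 n))) (sumTo-0 n))

  -- If the row of one negative entry contains a second one, any other sharing a column with both is
  -- impossible, so all lie in this row. If not, every negative entry has to share the column of the
  -- first.
  collinear : Collinear f ⊎ Collinear (λ i j → f j i)
  collinear with someNeg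
  ... | i₀ , j₀ , m₀ with anyUpTo? (λ j → ¬? (j ≟ j₀) ×-dec (f i₀ j ℤ.≟ -1ℤ)) n
  ...   | yes (j1 , _ , j1≢ , m1) = inj₁ (i₀ , rowOf)
    where rowOf : ∀ {i j} → f i j ≡ -1ℤ → i ≡ i₀
          rowOf m with negPair m m₀ | negPair m m1
          ... | inj₁ e | _ = e
          ... | _ | inj₁ e = e
          ... | inj₂ refl | inj₂ refl = ⊥-elim (j1≢ refl)
  ...   | no h = inj₂ (j₀ , columnOf)
    where columnOf : ∀ {j i} → f i j ≡ -1ℤ → j ≡ j₀
          columnOf {j} m with negPair m m₀
          ... | inj₂ e = e
          ... | inj₁ refl = decidable-stable (j ≟ j₀) (λ j≢ → h (j , proj₂ (sz m) , j≢ , m))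

module RowType {n f} (F : Facts n f) (inColumn : Collinear f) where
  open Facts F
  open Conf conf
  private
    One Neg : ℕ → ℕ → Set
    One i j = f i j ≡ 1ℤ
    Neg i j = f i j ≡ -1ℤ

    r : ℕ
    r = proj₁ inColumn

    rowOf : ∀ {i j} → Neg i j → i ≡ r
    rowOf = proj₂ inColumn

    r<n : r < n
    r<n = let (i , j , m) = someNeg F in subst (_< n) (rowOf m) (proj₁ (size (neg≢0 m)))

    inRowThree : sumTo n (isNeg ∘ f r) ≡ 3
    inRowThree = trans (sym (sumTo-single n r<n (λ i≢r → trans (sumTo-cong n (λ _ → isNeg-no (i≢r ∘ rowOf))) (sumTo-0 n)))) three

    negsOf : ∃ λ a → ∃ λ b → ∃ λ c → a < b × b < c × c < n × Neg r a × Neg r b × Neg r c ×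
             (∀ {j} → j < n → Neg r j → j ≡ a ⊎ j ≡ b ⊎ j ≡ c)
    negsOf = threeNegs n (f r) inRowThree

    not-both : ∀ {j} → One r j → Neg r j → ⊥
    not-both p m with () ← trans (sym p) m

  module _ {d1 d2 d3} (d1d2 : d1 < d2) (d2d3 : d2 < d3) (m1 : Neg r d1) (m2 : Neg r d2) (m3 : Neg r d3)
           (only : ∀ {j} → j < n → Neg r j → j ≡ d1 ⊎ j ≡ d2 ⊎ j ≡ d3) where
    private
      rowL = rowLine r<n
      negs : ∀ {i j} → Neg i j → i ≡ r × (j ≡ d1 ⊎ j ≡ d2 ⊎ j ≡ d3)
      negs m with refl ← rowOf m = refl , only (proj₂ (size (neg≢0 m))) m

      c1' = before rowL m1
      c2' = sepNeg rowL m1 m2 d1d2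
      c3' = sepNeg rowL m2 m3 d2d3
      c4' = after rowL m3
      c1 = proj₁ c1'
      c2 = proj₁ c2'
      c3 = proj₁ c3'
      c4 = proj₁ c4'
      above : ∀ {j} → Neg r j → ∃ λ i → i < r × One i j
      above m = before (colLine (proj₂ (size (neg≢0 m)))) m
      below : ∀ {j} → Neg r j → ∃ λ i → r < i × One i j
      below m = after (colLine (proj₂ (size (neg≢0 m)))) m

      -- The negative entries cut row r into four intervals, and two ones in the same interval would
      -- have a negative entry between them.
      same : ∀ {x y} → One r x → One r y → (∀ {z} → z ≡ d1 ⊎ z ≡ d2 ⊎ z ≡ d3 → (z < x × z < y) ⊎ (x < z × y < z)) → x ≡ y
      same {x} {y} p q h with <-cmp x y
      ... | tri≈ _ e _ = e
      ... | tri< l _ _ with sepOne rowL p q l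
      ...   | z , a , b , m with h (proj₂ (negs m))
      ...     | inj₁ (a' , _) = ⊥-elim (<-asym a a')
      ...     | inj₂ (_ , b') = ⊥-elim (<-asym b b')
      same {x} {y} p q h | tri> _ _ l with sepOne rowL q p l
      ...   | z , a , b , m with h (proj₂ (negs m))
      ...     | inj₁ (_ , a') = ⊥-elim (<-asym a a')
      ...     | inj₂ (b' , _) = ⊥-elim (<-asym b b')

      rowOnes : ∀ {j} → One r j → (j ≡ c1 ⊎ j ≡ c2) ⊎ (j ≡ c3 ⊎ j ≡ c4)
      rowOnes {j} p with <-cmp j d1 | <-cmp j d2 | <-cmp j d3
      ... | tri≈ _ refl _ | _ | _ = ⊥-elim (not-both p m1)
      ... | _ | tri≈ _ refl _ | _ = ⊥-elim (not-both p m2)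
      ... | _ | _ | tri≈ _ refl _ = ⊥-elim (not-both p m3)
      ... | tri< l _ _ | _ | _ = inj₁ (inj₁ (same p (proj₂ (proj₂ c1')) λ
            { (inj₁ refl) → inj₂ (l , proj₁ (proj₂ c1'))
            ; (inj₂ (inj₁ refl)) → inj₂ (<-trans l d1d2 , <-trans (proj₁ (proj₂ c1')) d1d2)
            ; (inj₂ (inj₂ refl)) → inj₂ (<-trans l (<-trans d1d2 d2d3) , <-trans (proj₁ (proj₂ c1')) (<-trans d1d2 d2d3)) }))
      ... | tri> _ _ k | tri< l _ _ | _ = let (_ , k' , l' , q) = c2' in inj₁ (inj₂ (same p q λ
            { (inj₁ refl) → inj₁ (k , k')
            ; (inj₂ (inj₁ refl)) → inj₂ (l , l')
            ; (inj₂ (inj₂ refl)) → inj₂ (<-trans l d2d3 , <-trans l' d2d3) }))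
      ... | tri> _ _ _ | tri> _ _ k | tri< l _ _ = let (_ , k' , l' , q) = c3' in inj₂ (inj₁ (same p q λ
            { (inj₁ refl) → inj₁ (<-trans d1d2 k , <-trans d1d2 k')
            ; (inj₂ (inj₁ refl)) → inj₁ (k , k')
            ; (inj₂ (inj₂ refl)) → inj₂ (l , l') }))
      ... | _ | _ | tri> _ _ k = let (_ , k' , q) = c4' in inj₂ (inj₂ (same p q λ
            { (inj₁ refl) → inj₁ (<-trans (<-trans d1d2 d2d3) k , <-trans (<-trans d1d2 d2d3) k')
            ; (inj₂ (inj₁ refl)) → inj₁ (<-trans d2d3 k , <-trans d2d3 k')
            ; (inj₂ (inj₂ refl)) → inj₁ (k , k') }))

      geo : Geo n One Neg _<_ _<_ r c1 d1 c2 d2 c3 d3 c4 (proj₁ (above m1)) (proj₁ (above m2)) (proj₁ (above m3))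
                (proj₁ (below m1)) (proj₁ (below m2)) (proj₁ (below m3))
      geo = record
        { ordR = <-ord ; ordC = <-ord ; rowLine = rowLine ; colLine = colLine ; dom = λ p → size (one≢0 p)
        ; no2143 = no2143 ; no3412 = no3412 ; negs = negs ; ones = rowOnes
        ; c1d1 = proj₁ (proj₂ c1') ; d1c2 = proj₁ (proj₂ c2') ; c2d2 = proj₁ (proj₂ (proj₂ c2'))
        ; d2c3 = proj₁ (proj₂ c3') ; c3d3 = proj₁ (proj₂ (proj₂ c3')) ; d3c4 = proj₁ (proj₂ c4')
        ; oc1 = proj₂ (proj₂ c1') ; oc2 = proj₂ (proj₂ (proj₂ c2')) ; oc3 = proj₂ (proj₂ (proj₂ c3')) ; oc4 = proj₂ (proj₂ c4')
        ; ou1 = proj₂ (proj₂ (above m1)) ; ou2 = proj₂ (proj₂ (above m2)) ; ou3 = proj₂ (proj₂ (above m3))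
        ; u1r = proj₁ (proj₂ (above m1)) ; u2r = proj₁ (proj₂ (above m2)) ; u3r = proj₁ (proj₂ (above m3))
        ; ol1 = proj₂ (proj₂ (below m1)) ; ol2 = proj₂ (proj₂ (below m2)) ; ol3 = proj₂ (proj₂ (below m3))
        ; rl1 = proj₁ (proj₂ (below m1)) ; rl2 = proj₁ (proj₂ (below m2)) ; rl3 = proj₁ (proj₂ (below m3)) }

    readConfig : ∃ λ (w : Config n) → ∀ i j → Build.val w i j ≡ f i j
    readConfig = agreeing (ReadGeo.reading geo (λ i j → f i j ℤ.≟ 1ℤ))
      where
      agreeing : (∃ λ (w : Config n) → (∀ {i j} → One i j → Build.One w i j) × (∀ {i j} → Build.One w i j → One i j) ×
                   (∀ {i j} → Neg i j → Build.Neg w i j) ×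
                   (Neg r d1 → Neg r d2 → Neg r d3 → ∀ {i j} → Build.Neg w i j → Neg i j)) →
                 ∃ λ (w : Config n) → ∀ i j → Build.val w i j ≡ f i j
      agreeing (w , one⇒ , one⇐ , neg⇒ , neg⇐) = w , λ i j → agree (ternary i j) (W.val-ternary i j)
        where
        module W = Build w
        agree : ∀ {i j} → Ternary (f i j) → Ternary (W.val i j) → W.val i j ≡ f i j
        agree (inj₂ (inj₁ p)) _ = trans (W.One⇒1 (one⇒ p)) (sym p)
        agree (inj₂ (inj₂ m)) _ = trans (W.Neg⇒-1 (neg⇒ m)) (sym m)
        agree (inj₁ z) (inj₁ z') = trans z' (sym z)
        agree (inj₁ z) (inj₂ (inj₁ p)) = ⊥-elim (one≢0 (one⇐ (W.1⇒One p)) z)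
        agree (inj₁ z) (inj₂ (inj₂ m)) = ⊥-elim (neg≢0 (neg⇐ m1 m2 m3 (W.-1⇒Neg m)) z)

  configOf : ∃ λ (w : Config n) → ∀ i j → Build.val w i j ≡ f i j
  configOf = let (a , b , c , ab , bc , _ , ma , mb , mc , only) = negsOf in readConfig ab bc ma mb mc only

-- The bijection

-- The factor 2 is the orientation: the negative entries share a row or a column. The words describe
-- matrices of size 7 + N, hence the zeros.
card : ℕ → ℕ
card 0 = 0
card 1 = 0
card 2 = 0
card 3 = 0
card 4 = 0
card 5 = 0
card 6 = 0
card (suc (suc (suc (suc (suc (suc (suc N))))))) = 2 * total N

length-trues : ∀ w → length w ≡ trues w + falses w
length-trues []          = refl
length-trues (true ∷ w)  = cong suc (length-trues w)
length-trues (false ∷ w) = trans (cong suc (length-trues w)) (sym (+-suc (trues w) (falses w)))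

rows-count : ∀ U D L R {N} → trues U ≡ suc (trues L) → falses U ≡ suc (falses R) → trues D ≡ suc (trues R) → falses D ≡ suc (falses L) →
             length L + length R ≡ N → 2 + length U + suc (length D) ≡ 7 + N
rows-count U D L R {N} tU fU tD fD LR
  rewrite length-trues U | length-trues D | sym LR | length-trues L | length-trues R | tU | fU | tD | fD
  = lem (trues L) (falses L) (trues R) (falses R)
  where lem : ∀ a b c d → 2 + (suc a + suc d) + suc (suc c + suc b) ≡ 7 + ((a + b) + (c + d))
        lem = solve-∀

columns-count : ∀ l k {N} → l + k ≡ N → 6 + l + suc k ≡ 7 + N
columns-count l k refl = cong (6 +_) (+-suc l k)

shapeConfig : ∀ {N} → Shape N → Config (7 + N)
shapeConfig (s , U , D) = record
  { U = toList U ; D = toList D ; L = leftWord s ; R = rightWord s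
  ; tU = trues-toList U ; fU = falses-toList U ; tD = trues-toList D ; fD = falses-toList D
  ; UDn = rows-count (toList U) (toList D) (leftWord s) (rightWord s)
            (trues-toList U) (falses-toList U) (trues-toList D) (falses-toList D) (Split-length s)
  ; LRn = columns-count (length (leftWord s)) (length (rightWord s)) (Split-length s) }

mkWord : ∀ w {a b} → trues w ≡ a → falses w ≡ b → Σ (Word a b) λ v → toList v ≡ w
mkWord w refl refl = fromList w , toList-fromList w

mkShape : ∀ U D L R {N} → trues U ≡ suc (trues L) → falses U ≡ suc (falses R) → trues D ≡ suc (trues R) → falses D ≡ suc (falses L) →
          length L + length R ≡ N → Σ (Shape N) λ s → toList (proj₁ (proj₂ s)) ≡ U × toList (proj₂ (proj₂ s)) ≡ D ×
          leftWord (proj₁ s) ≡ L × rightWord (proj₁ s) ≡ R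
mkShape U D L R tU fU tD fD refl =
  let l = leftWord-mkSplit L R ; r = rightWord-mkSplit L R
      (u , eu) = mkWord U (trans tU (cong (suc ∘ trues) (sym l))) (trans fU (cong (suc ∘ falses) (sym r)))
      (d , ed) = mkWord D (trans tD (cong (suc ∘ trues) (sym r))) (trans fD (cong (suc ∘ falses) (sym l)))
  in (mkSplit L R , u , d) , eu , ed , l , r

Shape-injective : ∀ {N} (s t : Shape N) → toList (proj₁ (proj₂ s)) ≡ toList (proj₁ (proj₂ t)) →
                  toList (proj₂ (proj₂ s)) ≡ toList (proj₂ (proj₂ t)) →
                  leftWord (proj₁ s) ≡ leftWord (proj₁ t) → rightWord (proj₁ s) ≡ rightWord (proj₁ t) → s ≡ t
Shape-injective (s , U , D) (t , U' , D') eu ed l r with Split-injective s t l r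
... | refl = cong₂ (λ u d → s , u , d) (toList-injective U U' eu) (toList-injective D D' ed)

Config-size : ∀ {n} → Config n → ∃ λ N → n ≡ 7 + N
Config-size w = let open Config w in length L + length R , trans (sym LRn) (columns-count (length L) (length R) refl)

configMatrix-cong : ∀ {n} (w w' : Config n) → Config.U w ≡ Config.U w' → Config.D w ≡ Config.D w' →
                    Config.L w ≡ Config.L w' → Config.R w ≡ Config.R w' → w ≡ w'
configMatrix-cong record { tU = a ; fU = b ; tD = c ; fD = d ; UDn = p ; LRn = q }
                  record { tU = a' ; fU = b' ; tD = c' ; fD = d' ; UDn = p' ; LRn = q' } refl refl refl refl
  with refl ← ≡-irrelevant a a' | refl ← ≡-irrelevant b b' | refl ← ≡-irrelevant c c' | refl ← ≡-irrelevant d d'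
     | refl ← ≡-irrelevant p p' | refl ← ≡-irrelevant q q' = refl

configShape : ∀ {N} (w : Config (7 + N)) → ∃ λ s → shapeConfig {N} s ≡ w
configShape {N} w =
  let open Config w
      (s , eu , ed , l , r) = mkShape U D L R {N} tU fU tD fD
        (+-cancelˡ-≡ 7 _ _ (trans (sym (columns-count (length L) (length R) refl)) LRn))
  in s , configMatrix-cong (shapeConfig s) w eu ed l r

shapeConfig-injective : ∀ {N} (s t : Shape N) → shapeConfig s ≡ shapeConfig t → s ≡ t
shapeConfig-injective s t e = Shape-injective s t (cong Config.U e) (cong Config.D e) (cong Config.L e) (cong Config.R e)

orient : ∀ {n} → Bool → Matrix n → Matrix n
orient true  A = A
orient false A = transpose A

build : ∀ {n} → Bool × Config n → Matrix n
build (b , w) = orient b (Build.matrix w)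

build-InASM3 : ∀ {n} (x : Bool × Config n) → InASM3 (build x)
build-InASM3 {n} (b , w) = go b
  where
  base : InASM3 (Build.matrix w)
  base = Facts⇒InASM3 {A = Build.matrix w} (Facts-cong (λ i j → sym (Build.cell-matrix w i j)) (Build.facts w))
  go : ∀ b → InASM3 (orient b (Build.matrix w))
  go true  = base
  go false = transpose-InASM3 {A = Build.matrix w} base

matrix-same : ∀ {n} (w w' : Config n) → Build.matrix w ≡ Build.matrix w' → w ≡ w'
matrix-same w w' e =
  let (u , d , l , r) = val-injective w w' (λ i j → trans (sym (Build.cell-matrix w i j))
                          (trans (cong (λ A → cell A i j) e) (Build.cell-matrix w' i j)))
  in configMatrix-cong w w' u d l r

-- The negative entries of the transpose lie in a single column, whereas the matrix has some in the
-- distinct columns d1 and d2.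
matrix≢transpose : ∀ {n} (w w' : Config n) → Build.matrix w ≢ transpose (Build.matrix w')
matrix≢transpose w w' e = <-irrefl (trans (negAt W.d1 (inj₁ refl)) (sym (negAt W.d2 (inj₂ (inj₁ refl))))) (n≤1+n _)
  where
  module W = Build w
  module W' = Build w'
  same : ∀ i j → W.val i j ≡ W'.val j i
  same i j = trans (sym (W.cell-matrix i j)) (trans (cong (λ A → cell A i j) e)
               (trans (cell-transpose (Build.matrix w') i j) (W'.cell-matrix j i)))
  negAt : ∀ j → j ≡ W.d1 ⊎ j ≡ W.d2 ⊎ j ≡ W.d3 → j ≡ W'.r
  negAt j h = proj₁ (W'.-1⇒Neg (trans (sym (same W.r j)) (W.Neg⇒-1 (refl , h))))

build-injective : ∀ {n} (x y : Bool × Config n) → build x ≡ build y → x ≡ y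
build-injective (true , w)  (true , w')  e = cong (true ,_) (matrix-same w w' e)
build-injective (false , w) (false , w') e = cong (false ,_) (matrix-same w w'
  (trans (sym (transpose-involutive (Build.matrix w))) (trans (cong transpose e) (transpose-involutive (Build.matrix w')))))
build-injective (true , w)  (false , w') e = ⊥-elim (matrix≢transpose w w' e)
build-injective (false , w) (true , w')  e = ⊥-elim (matrix≢transpose w' w (sym e))

build-surjective : ∀ {n} {A : Matrix n} → InASM3 A → ∃ λ x → build x ≡ A
build-surjective {n} {A} h = go (collinear facts)
  where
  facts = InASM3⇒Facts {A = A} h
  go : Collinear (cell A) ⊎ Collinear (λ i j → cell A j i) → ∃ λ x → build x ≡ A
  go (inj₁ c) = let (w , e) = RowType.configOf facts c in
    (true , w) , matrix-ext _ _ (λ {i} {j} _ _ → trans (Build.cell-matrix w i j) (e i j))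
  go (inj₂ c) = let (w , e) = RowType.configOf (Facts-flip facts) c in
    (false , w) , matrix-ext _ _ (λ {i} {j} _ _ → trans (cell-transpose (Build.matrix w) i j) (trans (Build.cell-matrix w j i) (e j i)))

-- Membership is irrelevant in ASM3, so the index of a matrix is recovered by a finite search.
enumerate : ∀ {n k} (b : Fin k → Matrix n) → (∀ x → InASM3 (b x)) → (∀ x y → b x ≡ b y → x ≡ y) →
            (∀ A → InASM3 A → ∃ λ x → b x ≡ A) → Fin k ↔ ASM3 n
enumerate {n} {k} b sound inj complete = mk↔ₛ′ (λ x → b x , [ sound x ]) from to-from (λ x → inj _ x (proj₂ (found (b x) (sound x))))
  where
  found : ∀ A → .(InASM3 A) → ∃ λ x → b x ≡ A
  found A h = recompute (Finₚ.any? (λ x → ≡-dec (≡-dec ℤ._≟_) (b x) A)) (complete A h)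
  from : ASM3 n → Fin k
  from (A , [ h ]) = proj₁ (found A h)
  ASM3-≡ : ∀ {A B : Matrix n} .{p : InASM3 A} .{q : InASM3 B} → A ≡ B → _≡_ {A = ASM3 n} (A , [ p ]) (B , [ q ])
  ASM3-≡ refl = refl
  to-from : ∀ y → (b (from y) , [ sound (from y) ]) ≡ y
  to-from (A , [ h ]) = ASM3-≡ (proj₂ (found A h))

reindex : ∀ {n k} {X : Set} → Fin k ↔ X → (f : X → Matrix n) → (∀ x → InASM3 (f x)) → (∀ x y → f x ≡ f y → x ≡ y) →
          (∀ A → InASM3 A → ∃ λ x → f x ≡ A) → Fin k ↔ ASM3 n
reindex {n} {k} index f sound inj complete = enumerate (f ∘ I.to) (sound ∘ I.to)
  (λ x y e → trans (sym (I.strictlyInverseʳ x)) (trans (cong I.from (inj (I.to x) (I.to y) e)) (I.strictlyInverseʳ y)))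
  (λ A h → let (x , e) = complete A h in I.from x , trans (cong f (I.strictlyInverseˡ x)) e)
  where module I = Inverse index

buildShape : ∀ {N} → Bool × Shape N → Matrix (7 + N)
buildShape (c , s) = build (c , shapeConfig s)

buildShape-injective : ∀ {N} (x y : Bool × Shape N) → buildShape x ≡ buildShape y → x ≡ y
buildShape-injective (c , s) (d , t) e with build-injective (c , shapeConfig s) (d , shapeConfig t) e
... | e' = cong₂ _,_ (cong proj₁ e') (shapeConfig-injective s t (cong proj₂ e'))

buildShape-surjective : ∀ {N} (A : Matrix (7 + N)) → InASM3 A → ∃ λ x → buildShape {N} x ≡ A
buildShape-surjective A h =
  let ((c , w) , e) = build-surjective {A = A} h ; (s , es) = configShape w
  in (c , s) , trans (cong (λ v → build (c , v)) es) e

large : ∀ N → Fin (2 * total N) ↔ ASM3 (7 + N)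
large N = reindex (↔-trans Finₚ.*↔× (Finₚ.2↔Bool ×-↔ ↔-sym (Shape↔Fin N)))
                  buildShape (λ (c , s) → build-InASM3 (c , shapeConfig s)) buildShape-injective buildShape-surjective

small : ∀ n → n ≤ 6 → Fin 0 ↔ ASM3 n
small n n≤6 = enumerate (λ ()) (λ ()) (λ ()) (λ A h → ⊥-elim (absurd A h))
  where absurd : ∀ A → ¬ (InASM3 {n} A)
        absurd A h with build-surjective {A = A} h
        ... | (_ , w) , _ with Config-size w
        ...   | N , refl = <⇒≱ {6} {7 + N} (s≤s (m≤m+n 6 N)) n≤6

card-small : ∀ n → n ≤ 6 → card n ≡ 0
card-small 0 _ = refl
card-small 1 _ = refl
card-small 2 _ = refl
card-small 3 _ = refl
card-small 4 _ = refl
card-small 5 _ = refl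
card-small 6 _ = refl
card-small (suc (suc (suc (suc (suc (suc (suc N))))))) (s≤s (s≤s (s≤s (s≤s (s≤s (s≤s ()))))))

Fin↔ASM3 : ∀ n → Fin (card n) ↔ ASM3 n
Fin↔ASM3 n with n ≤? 6
... | yes p = subst (λ m → Fin m ↔ ASM3 n) (sym (card-small n p)) (small n p)
... | no p  = subst (λ m → Fin (card m) ↔ ASM3 m) (m+[n∸m]≡n (≰⇒> p)) (large (n ∸ 7))

-- Formal power series

infixl 7 _⊛_
infixl 6 _⊞_

shift : Series → Series
shift f m = f (suc m)

-- The Cauchy product by structural recursion on the degree, which makes the ring laws provable by
-- induction.
_⊛_ : Series → Series → Series
(f ⊛ g) zero    = f 0 ⋆ g 0
(f ⊛ g) (suc m) = f 0 ⋆ g (suc m) ⊹ (shift f ⊛ g) m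

_⊞_ : Series → Series → Series
(f ⊞ g) m = f m ⊹ g m

_·_ : ℤ → Series → Series
(c · f) m = c ⋆ f m

private
  conv : ℕ → Series → Series → ℤ
  conv m f g = foldr _⊹_ 0ℤ (applyUpTo (λ k → f k ⋆ g (m ∸ k)) (suc m))

  conv≡⊛ : ∀ m f g → conv m f g ≡ (f ⊛ g) m
  conv≡⊛ zero    f g = ℤₚ.+-identityʳ _
  conv≡⊛ (suc m) f g = cong (f 0 ⋆ g (suc m) ⊹_) (conv≡⊛ m (shift f) g)

*ₛ≡⊛ : ∀ f g → (f *ₛ g) ≈ₛ (f ⊛ g)
*ₛ≡⊛ f g m = trans (cong (foldr _⊹_ 0ℤ) (map-upTo (λ k → f k ⋆ g (m ∸ k)) (suc m))) (conv≡⊛ m f g)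

⊛-cong : ∀ {f f' g g'} → f ≈ₛ f' → g ≈ₛ g' → (f ⊛ g) ≈ₛ (f' ⊛ g')
⊛-cong p q zero    = cong₂ _⋆_ (p 0) (q 0)
⊛-cong p q (suc m) = cong₂ _⊹_ (cong₂ _⋆_ (p 0) (q (suc m))) (⊛-cong (p ∘ suc) q m)

⊛-congˡ : ∀ {f g g'} → g ≈ₛ g' → (f ⊛ g) ≈ₛ (f ⊛ g')
⊛-congˡ {f} = ⊛-cong {f} {f} (λ _ → refl)

⊛-congʳ : ∀ {f f' g} → f ≈ₛ f' → (f ⊛ g) ≈ₛ (f' ⊛ g)
⊛-congʳ {g = g} p = ⊛-cong {g = g} {g} p (λ _ → refl)

⊛-distribʳ : ∀ f g h → ((f ⊞ g) ⊛ h) ≈ₛ ((f ⊛ h) ⊞ (g ⊛ h))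
⊛-distribʳ f g h zero    = ℤₚ.*-distribʳ-+ (h 0) (f 0) (g 0)
⊛-distribʳ f g h (suc m) = trans (cong ((f 0 ⊹ g 0) ⋆ h (suc m) ⊹_) (⊛-distribʳ (shift f) (shift g) h m))
                                 (lem (f 0) (g 0) (h (suc m)) _ _)
  where lem : ∀ a b c x y → (a ⊹ b) ⋆ c ⊹ (x ⊹ y) ≡ (a ⋆ c ⊹ x) ⊹ (b ⋆ c ⊹ y)
        lem = ℤRS.solve-∀

⊛-distribˡ : ∀ f g h → (f ⊛ (g ⊞ h)) ≈ₛ ((f ⊛ g) ⊞ (f ⊛ h))
⊛-distribˡ f g h zero    = ℤₚ.*-distribˡ-+ (f 0) (g 0) (h 0)
⊛-distribˡ f g h (suc m) = trans (cong (f 0 ⋆ (g (suc m) ⊹ h (suc m)) ⊹_) (⊛-distribˡ (shift f) g h m))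
                                 (lem (f 0) (g (suc m)) (h (suc m)) _ _)
  where lem : ∀ a b c x y → a ⋆ (b ⊹ c) ⊹ (x ⊹ y) ≡ (a ⋆ b ⊹ x) ⊹ (a ⋆ c ⊹ y)
        lem = ℤRS.solve-∀

·-⊛ : ∀ c f g → ((c · f) ⊛ g) ≈ₛ (c · (f ⊛ g))
·-⊛ c f g zero    = ℤₚ.*-assoc c (f 0) (g 0)
·-⊛ c f g (suc m) = trans (cong ((c ⋆ f 0) ⋆ g (suc m) ⊹_) (·-⊛ c (shift f) g m)) (lem c (f 0) (g (suc m)) _)
  where lem : ∀ c a b x → (c ⋆ a) ⋆ b ⊹ c ⋆ x ≡ c ⋆ (a ⋆ b ⊹ x)
        lem = ℤRS.solve-∀

-- Peels the other end of the convolution; commutativity follows by comparing this with the defining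
-- recursion.
⊛-sucʳ : ∀ f g m → (f ⊛ g) (suc m) ≡ f (suc m) ⋆ g 0 ⊹ (f ⊛ shift g) m
⊛-sucʳ f g zero    = ℤₚ.+-comm (f 0 ⋆ g 1) (f 1 ⋆ g 0)
⊛-sucʳ f g (suc m) = trans (cong (f 0 ⋆ g (suc (suc m)) ⊹_) (⊛-sucʳ (shift f) g m)) (lem (f 0 ⋆ g (suc (suc m))) (f (suc (suc m)) ⋆ g 0) _)
  where lem : ∀ a b c → a ⊹ (b ⊹ c) ≡ b ⊹ (a ⊹ c)
        lem = ℤRS.solve-∀

⊛-comm : ∀ f g → (f ⊛ g) ≈ₛ (g ⊛ f)
⊛-comm f g zero    = ℤₚ.*-comm (f 0) (g 0)
⊛-comm f g (suc m) = trans (⊛-sucʳ f g m) (cong₂ _⊹_ (ℤₚ.*-comm (f (suc m)) (g 0)) (⊛-comm f (shift g) m))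

⊛-assoc : ∀ f g h → ((f ⊛ g) ⊛ h) ≈ₛ (f ⊛ (g ⊛ h))
⊛-assoc f g h zero    = ℤₚ.*-assoc (f 0) (g 0) (h 0)
⊛-assoc f g h (suc m) =
  trans (cong ((f 0 ⋆ g 0) ⋆ h (suc m) ⊹_)
          (trans (⊛-distribʳ (f 0 · shift g) (shift f ⊛ g) h m)
                 (cong₂ _⊹_ (·-⊛ (f 0) (shift g) h m) (⊛-assoc (shift f) g h m))))
        (lem (f 0) (g 0) (h (suc m)) ((shift g ⊛ h) m) ((shift f ⊛ (g ⊛ h)) m))
  where lem : ∀ a b c x y → (a ⋆ b) ⋆ c ⊹ (a ⋆ x ⊹ y) ≡ a ⋆ (b ⋆ c ⊹ x) ⊹ y
        lem = ℤRS.solve-∀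

deriv : Series → Series
deriv f m = (ℤ.+ suc m) ⋆ f (suc m)

-- The factor m + 2 is split as 1 + (m + 1). The second part meets the induction hypothesis for
-- `shift f`, and the first supplies what `deriv (shift f)` lacks compared with `shift (deriv f)`.
deriv-⊛ : ∀ f g → deriv (f ⊛ g) ≈ₛ ((deriv f ⊛ g) ⊞ (f ⊛ deriv g))
deriv-⊛ f g zero    = lem (f 0) (g 1) (f 1) (g 0)
  where lem : ∀ a b c d → 1ℤ ⋆ (a ⋆ b ⊹ c ⋆ d) ≡ (1ℤ ⋆ c) ⋆ d ⊹ a ⋆ (1ℤ ⋆ b)
        lem = ℤRS.solve-∀
deriv-⊛ f g (suc m) =
  trans (lem1 (ℤ.+ suc m) (f 0 ⋆ g (suc (suc m))) ((shift f ⊛ g) (suc m)))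
 (trans (cong (λ y → (1ℤ ⊹ ℤ.+ suc m) ⋆ (f 0 ⋆ g (suc (suc m))) ⊹ ((shift f ⊛ g) (suc m) ⊹ y)) (deriv-⊛ (shift f) g m))
 (trans (lem2 (1ℤ ⊹ ℤ.+ suc m) (f 0) (g (suc (suc m))) (f 1) (g (suc m)) ((shift (shift f) ⊛ g) m) ((deriv (shift f) ⊛ g) m) ((shift f ⊛ deriv g) m))
        (cong (λ x → (1ℤ ⋆ f 1 ⋆ g (suc m) ⊹ x) ⊹ (f 0 ⋆ ((1ℤ ⊹ ℤ.+ suc m) ⋆ g (suc (suc m))) ⊹ (shift f ⊛ deriv g) m))
          (sym (trans (⊛-congʳ {g = g} split m) (⊛-distribʳ (shift (shift f)) (deriv (shift f)) g m))))))
  where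
  lem1 : ∀ k a b → (1ℤ ⊹ k) ⋆ (a ⊹ b) ≡ (1ℤ ⊹ k) ⋆ a ⊹ (b ⊹ k ⋆ b)
  lem1 = ℤRS.solve-∀
  lem2 : ∀ k a b c d x y z → k ⋆ (a ⋆ b) ⊹ ((c ⋆ d ⊹ x) ⊹ (y ⊹ z)) ≡ (1ℤ ⋆ c ⋆ d ⊹ (x ⊹ y)) ⊹ (a ⋆ (k ⋆ b) ⊹ z)
  lem2 = ℤRS.solve-∀
  split : shift (deriv f) ≈ₛ (shift (shift f) ⊞ deriv (shift f))
  split k = lem3 (ℤ.+ suc k) (f (suc (suc k)))
    where lem3 : ∀ k a → (1ℤ ⊹ k) ⋆ a ≡ a ⊹ k ⋆ a
          lem3 = ℤRS.solve-∀

const-⊛ : ∀ c f → (poly (c ∷ []) ⊛ f) ≈ₛ (c · f)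
const-⊛ c f zero    = refl
const-⊛ c f (suc m) = trans (cong (c ⋆ f (suc m) ⊹_) (zeros m)) (ℤₚ.+-identityʳ _)
  where
  zeros : ∀ m → (poly [] ⊛ f) m ≡ 0ℤ
  zeros zero    = ℤₚ.*-zeroˡ (f 0)
  zeros (suc m) = cong₂ _⊹_ (ℤₚ.*-zeroˡ (f (suc m))) (zeros m)

linear-⊛ : ∀ c f m → (poly (1ℤ ∷ c ∷ []) ⊛ f) (suc m) ≡ f (suc m) ⊹ c ⋆ f m
linear-⊛ c f m = cong₂ _⊹_ (ℤₚ.*-identityˡ (f (suc m))) (const-⊛ c f m)

linear-zero : ∀ c f → (poly (1ℤ ∷ c ∷ []) ⊛ f) 0 ≡ f 0
linear-zero c f = ℤₚ.*-identityˡ (f 0)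

-- The constant term 1 makes the factor cancellable: the coefficients vanish one after the other.
linear-cancel : ∀ c f → (∀ m → (poly (1ℤ ∷ c ∷ []) ⊛ f) m ≡ 0ℤ) → ∀ m → f m ≡ 0ℤ
linear-cancel c f h zero    = trans (sym (linear-zero c f)) (h 0)
linear-cancel c f h (suc m) = trans (lem (f (suc m)) (c ⋆ f m))
  (cong₂ _⊖_ (trans (sym (linear-⊛ c f m)) (h (suc m))) (trans (cong (c ⋆_) (linear-cancel c f h m)) (ℤₚ.*-zeroʳ c)))
  where lem : ∀ a b → a ≡ (a ⊹ b) ⊖ b
        lem = ℤRS.solve-∀

-- The central binomial series as the inverse of the square root

central : Series
central m = ℤ.+ paths m m

paths-sym : ∀ a b → paths a b ≡ paths b a
paths-sym zero    b       = sym (paths-zeroʳ b)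
paths-sym (suc a) zero    = refl
paths-sym (suc a) (suc b) = trans (cong₂ _+_ (paths-sym a (suc b)) (paths-sym (suc a) b)) (+-comm (paths (suc b) a) _)

-- The absorption identity for binomial coefficients, obtained from Pascal's rule and the symmetric
-- identity for the other index.
paths-rec : ∀ a b → suc a * paths (suc a) b ≡ suc (a + b) * paths a b
paths-rec a zero rewrite paths-zeroʳ a | +-identityʳ a = refl
paths-rec a (suc b) =
  trans (*-distribˡ-+ (suc a) (paths a (suc b)) (paths (suc a) b))
 (trans (cong (suc a * paths a (suc b) +_) (trans (paths-rec a b) (sym other)))
        (lem a b (paths a (suc b))))
  where
  other : suc b * paths a (suc b) ≡ suc (a + b) * paths a b
  other = trans (cong (suc b *_) (paths-sym a (suc b)))
         (trans (paths-rec b a) (cong₂ _*_ (cong suc (+-comm b a)) (paths-sym b a)))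
  lem : ∀ a b x → suc a * x + suc b * x ≡ suc (a + suc b) * x
  lem = solve-∀

central-rec : ∀ m → suc m * paths (suc m) (suc m) ≡ (4 * m + 2) * paths m m
central-rec m =
  trans (cong (λ x → suc m * (x + paths (suc m) m)) (paths-sym m (suc m)))
 (trans (lem1 (suc m) (paths (suc m) m)) (trans (cong (2 *_) (paths-rec m m)) (lem2 m (paths m m))))
  where
  lem1 : ∀ k x → k * (x + x) ≡ 2 * (k * x)
  lem1 = solve-∀
  lem2 : ∀ m x → 2 * (suc (m + m) * x) ≡ (4 * m + 2) * x
  lem2 = solve-∀

deriv-central : ∀ m → deriv central m ≡ ((ℤ.+ 4) ⋆ ℤ.+ m ⊹ ℤ.+ 2) ⋆ central m
deriv-central m = trans (sym (ℤₚ.pos-* (suc m) (paths (suc m) (suc m))))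
                 (trans (cong ℤ.+_ (central-rec m))
                 (trans (ℤₚ.pos-* (4 * m + 2) (paths m m)) (cong (λ x → (x ⊹ ℤ.+ 2) ⋆ central m) (ℤₚ.pos-* 4 m))))

deriv-central-ode : (1-4z ⊛ deriv central) ≈ₛ ((ℤ.+ 2) · central)
deriv-central-ode zero    = refl
deriv-central-ode (suc m) =
  trans (linear-⊛ (ℤ.- (ℤ.+ 4)) (deriv central) m)
 (trans (cong (_⊹ (ℤ.- (ℤ.+ 4)) ⋆ deriv central m) (deriv-central (suc m)))
        (lem (ℤ.+ suc m) (central (suc m))))
  where lem : ∀ k x → ((ℤ.+ 4) ⋆ k ⊹ ℤ.+ 2) ⋆ x ⊹ (ℤ.- (ℤ.+ 4)) ⋆ (k ⋆ x) ≡ (ℤ.+ 2) ⋆ x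
        lem = ℤRS.solve-∀

⊛-· : ∀ c f g → (f ⊛ (c · g)) ≈ₛ (c · (f ⊛ g))
⊛-· c f g m = trans (⊛-comm f (c · g) m) (trans (·-⊛ c g f m) (cong (c ⋆_) (⊛-comm g f m)))

⊛-swap : ∀ f g h → (f ⊛ (g ⊛ h)) ≈ₛ (g ⊛ (f ⊛ h))
⊛-swap f g h m = trans (sym (⊛-assoc f g h m)) (trans (⊛-congʳ {g = h} (⊛-comm f g) m) (⊛-assoc g f h m))

-- Both factors of S B satisfy a linear differential equation, (1 − 4z) S' = − 2 S and (1 − 4z) B' = 2 B, so (S B)' = 0.
module _ (S : Series) (sq : IsSqrt1-4z S) where
  private
    S0 : S 0 ≡ 1ℤ
    S0 = proj₁ sq

    S² : (S ⊛ S) ≈ₛ 1-4z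
    S² m = trans (sym (*ₛ≡⊛ S S m)) (proj₂ sq m)

    -- Half the derivative of S² = 1 - 4z.
    SS' : (S ⊛ deriv S) ≈ₛ poly (ℤ.- (ℤ.+ 2) ∷ [])
    SS' m = ℤₚ.*-cancelˡ-≡ (ℤ.+ 2) _ _ (trans (lem ((S ⊛ deriv S) m))
              (trans (cong (_⊹ (S ⊛ deriv S) m) (⊛-comm S (deriv S) m))
              (trans (sym (deriv-⊛ S S m)) (trans (cong ((ℤ.+ suc m) ⋆_) (S² (suc m))) (value m)))))
      where
      lem : ∀ x → (ℤ.+ 2) ⋆ x ≡ x ⊹ x
      lem = ℤRS.solve-∀
      value : ∀ m → deriv 1-4z m ≡ (ℤ.+ 2) ⋆ poly (ℤ.- (ℤ.+ 2) ∷ []) m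
      value zero    = refl
      value (suc m) = ℤₚ.*-zeroʳ (ℤ.+ suc (suc m))

    -- Both sides are S · S · S'.
    ode : (1-4z ⊛ deriv S) ≈ₛ ((ℤ.- (ℤ.+ 2)) · S)
    ode m = trans (⊛-congʳ {g = deriv S} (λ k → sym (S² k)) m)
           (trans (⊛-assoc S S (deriv S) m)
           (trans (⊛-congˡ {S} SS' m)
           (trans (⊛-comm S _ m) (const-⊛ (ℤ.- (ℤ.+ 2)) S m))))

    vanish : ∀ m → (1-4z ⊛ deriv (S ⊛ central)) m ≡ 0ℤ
    vanish m =
      trans (⊛-congˡ {1-4z} (deriv-⊛ S central) m)
     (trans (⊛-distribˡ 1-4z (deriv S ⊛ central) (S ⊛ deriv central) m)
     (trans (cong₂ _⊹_
        (trans (sym (⊛-assoc 1-4z (deriv S) central m)) (trans (⊛-congʳ {g = central} ode m) (·-⊛ (ℤ.- (ℤ.+ 2)) S central m)))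
        (trans (⊛-swap 1-4z S (deriv central) m) (trans (⊛-congˡ {S} deriv-central-ode m) (⊛-· (ℤ.+ 2) S central m))))
      (lem ((S ⊛ central) m))))
      where lem : ∀ x → (ℤ.- (ℤ.+ 2)) ⋆ x ⊹ (ℤ.+ 2) ⋆ x ≡ 0ℤ
            lem = ℤRS.solve-∀

  S⊛central : (S ⊛ central) ≈ₛ poly (1ℤ ∷ [])
  S⊛central zero    = trans (ℤₚ.*-identityʳ (S 0)) S0
  S⊛central (suc m) = ℤₚ.*-cancelˡ-≡ (ℤ.+ suc m) _ 0ℤ
    (trans (linear-cancel (ℤ.- (ℤ.+ 4)) (deriv (S ⊛ central)) vanish m) (sym (ℤₚ.*-zeroʳ (ℤ.+ suc m))))

-- The generating function of the cardinalities

cards : Series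
cards n = ℤ.+ card n

total-sucℤ : ∀ N → ℤ.+ total (suc N) ≡ ((ℤ.+ 2) ⋆ ℤ.+ total N ⊹ central (3 + N)) ⊖ (ℤ.+ 4) ⋆ ℤ.+ (2 ^ N)
total-sucℤ N = trans (lem1 (ℤ.+ total (suc N)) ((ℤ.+ 4) ⋆ ℤ.+ (2 ^ N))) (cong (_⊖ (ℤ.+ 4) ⋆ ℤ.+ (2 ^ N)) eq)
  where
  lem1 : ∀ x y → x ≡ (x ⊹ y) ⊖ y
  lem1 = ℤRS.solve-∀
  eq : ℤ.+ total (suc N) ⊹ (ℤ.+ 4) ⋆ ℤ.+ (2 ^ N) ≡ (ℤ.+ 2) ⋆ ℤ.+ total N ⊹ central (3 + N)
  eq = trans (cong (ℤ.+ total (suc N) ⊹_) (sym (ℤₚ.pos-* 4 (2 ^ N))))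
      (trans (cong ℤ.+_ (trans (cong (total (suc N) +_) (*-assoc 2 2 (2 ^ N))) (total-suc N)))
             (cong (_⊹ central (3 + N)) (ℤₚ.pos-* 2 (total N))))

-- The series (1-2z)/√(1-4z) - (1-2z²), with `central` in place of 1/√(1-4z).
numerator : Series
numerator = (1-2z ⊛ central) ⊞ ((ℤ.- 1ℤ) · 1-2z²)

2z⁵-shift : ∀ f m → (2z⁵ ⊛ f) (5 + m) ≡ (ℤ.+ 2) ⋆ f m
2z⁵-shift f m =
  trans (drop (f (5 + m)) _) (trans (drop (f (4 + m)) _) (trans (drop (f (3 + m)) _) (trans (drop (f (2 + m)) _)
 (trans (drop (f (1 + m)) _) (const-⊛ (ℤ.+ 2) f m)))))
  where drop : ∀ x y → 0ℤ ⋆ x ⊹ y ≡ y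
        drop x y = trans (cong (_⊹ y) (ℤₚ.*-zeroˡ x)) (ℤₚ.+-identityˡ y)

-- One factor 1 - 2z turns the recurrence of `total` into central binomial coefficients minus
-- multiples of 2^N, and the second removes these powers. The polynomial 1 - 2z² corrects only the
-- degrees 5 and 7, which are among the nine evaluated directly.
cards-numerator : (1-2z ⊛ (1-2z ⊛ cards)) ≈ₛ (2z⁵ ⊛ numerator)
cards-numerator 0 = refl
cards-numerator 1 = refl
cards-numerator 2 = refl
cards-numerator 3 = refl
cards-numerator 4 = refl
cards-numerator 5 = refl
cards-numerator 6 = refl
cards-numerator 7 = refl
cards-numerator 8 = refl
cards-numerator (suc (suc (suc (suc (suc (suc (suc (suc (suc N))))))))) =
  trans (linear-⊛ -2ℤ (1-2z ⊛ cards) (8 + N))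
 (trans (cong₂ (λ x y → x ⊹ -2ℤ ⋆ y) (linear-⊛ -2ℤ cards (8 + N)) (linear-⊛ -2ℤ cards (7 + N)))
 (trans (cong3 (ℤₚ.pos-* 2 (total (suc (suc N)))) (ℤₚ.pos-* 2 (total (suc N))) (ℤₚ.pos-* 2 (total N)))
 (trans (cong (λ t → expr t (ℤ.+ total (suc N)) (ℤ.+ total N)) (trans (total-sucℤ (suc N)) (cong (λ p → ((ℤ.+ 2) ⋆ ℤ.+ total (suc N) ⊹ central (4 + N)) ⊖ (ℤ.+ 4) ⋆ p) (ℤₚ.pos-* 2 (2 ^ N)))))
 (trans (cong (λ t → expr (((ℤ.+ 2) ⋆ t ⊹ central (4 + N)) ⊖ (ℤ.+ 4) ⋆ ((ℤ.+ 2) ⋆ ℤ.+ (2 ^ N))) t (ℤ.+ total N)) (total-sucℤ N))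
 (trans (lem (ℤ.+ total N) (central (4 + N)) (central (3 + N)) (ℤ.+ (2 ^ N)))
 (trans (cong (λ x → (ℤ.+ 2) ⋆ (x ⊹ 0ℤ)) (sym (linear-⊛ -2ℤ central (3 + N))))
        (sym (2z⁵-shift numerator (4 + N)))))))))
  where
  -2ℤ = ℤ.- (ℤ.+ 2)
  expr : ℤ → ℤ → ℤ → ℤ
  expr x y z = ((ℤ.+ 2) ⋆ x ⊹ -2ℤ ⋆ ((ℤ.+ 2) ⋆ y)) ⊹ -2ℤ ⋆ ((ℤ.+ 2) ⋆ y ⊹ -2ℤ ⋆ ((ℤ.+ 2) ⋆ z))
  cong3 : ∀ {x x' y y' z z'} → x ≡ x' → y ≡ y' → z ≡ z' → (x ⊹ -2ℤ ⋆ y) ⊹ -2ℤ ⋆ (y ⊹ -2ℤ ⋆ z) ≡ (x' ⊹ -2ℤ ⋆ y') ⊹ -2ℤ ⋆ (y' ⊹ -2ℤ ⋆ z')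
  cong3 refl refl refl = refl
  lem : ∀ t b c p → ((ℤ.+ 2) ⋆ (((ℤ.+ 2) ⋆ (((ℤ.+ 2) ⋆ t ⊹ c) ⊖ (ℤ.+ 4) ⋆ p) ⊹ b) ⊖ (ℤ.+ 4) ⋆ ((ℤ.+ 2) ⋆ p)) ⊹ (ℤ.- (ℤ.+ 2)) ⋆ ((ℤ.+ 2) ⋆ (((ℤ.+ 2) ⋆ t ⊹ c) ⊖ (ℤ.+ 4) ⋆ p))) ⊹ (ℤ.- (ℤ.+ 2)) ⋆ ((ℤ.+ 2) ⋆ (((ℤ.+ 2) ⋆ t ⊹ c) ⊖ (ℤ.+ 4) ⋆ p) ⊹ (ℤ.- (ℤ.+ 2)) ⋆ ((ℤ.+ 2) ⋆ t))
                    ≡ (ℤ.+ 2) ⋆ ((b ⊹ (ℤ.- (ℤ.+ 2)) ⋆ c) ⊹ 0ℤ)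
  lem = ℤRS.solve-∀

generating : GFIdentity cards
generating S sq m =
  trans (lhs m)
 (trans (⊛-congˡ {S} cards-numerator m)
 (trans (⊛-swap S 2z⁵ numerator m)
 (trans (⊛-congˡ {2z⁵} S-numerator m)
 (trans (⊛-distribˡ 2z⁵ 1-2z ((ℤ.- 1ℤ) · (1-2z² ⊛ S)) m)
 (trans (cong ((2z⁵ ⊛ 1-2z) m ⊹_) (⊛-· (ℤ.- 1ℤ) 2z⁵ (1-2z² ⊛ S) m))
 (trans (lem ((2z⁵ ⊛ 1-2z) m) _)
        (cong₂ _⊖_ (sym (*ₛ≡⊛ 2z⁵ 1-2z m)) (sym rhs))))))))
  where
  lem : ∀ x y → x ⊹ (ℤ.- 1ℤ) ⋆ y ≡ x ⊖ y
  lem = ℤRS.solve-∀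
  rhs : ((2z⁵ *ₛ 1-2z²) *ₛ S) m ≡ (2z⁵ ⊛ (1-2z² ⊛ S)) m
  rhs = trans (*ₛ≡⊛ (2z⁵ *ₛ 1-2z²) S m) (trans (⊛-congʳ {g = S} (*ₛ≡⊛ 2z⁵ 1-2z²) m) (⊛-assoc 2z⁵ 1-2z² S m))
  lhs : ((((1-2z *ₛ 1-2z) *ₛ S) *ₛ cards)) ≈ₛ (S ⊛ (1-2z ⊛ (1-2z ⊛ cards)))
  lhs m = trans (*ₛ≡⊛ ((1-2z *ₛ 1-2z) *ₛ S) cards m)
         (trans (⊛-congʳ {g = cards} (λ k → trans (*ₛ≡⊛ (1-2z *ₛ 1-2z) S k)
                  (trans (⊛-congʳ {g = S} (*ₛ≡⊛ 1-2z 1-2z) k) (⊛-comm (1-2z ⊛ 1-2z) S k))) m)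
         (trans (⊛-assoc S (1-2z ⊛ 1-2z) cards m) (⊛-congˡ {S} (⊛-assoc 1-2z 1-2z cards) m)))
  S-numerator : (S ⊛ numerator) ≈ₛ (1-2z ⊞ ((ℤ.- 1ℤ) · (1-2z² ⊛ S)))
  S-numerator k =
    trans (⊛-distribˡ S (1-2z ⊛ central) ((ℤ.- 1ℤ) · 1-2z²) k)
          (cong₂ _⊹_
            (trans (⊛-swap S 1-2z central k) (trans (⊛-congˡ {1-2z} (S⊛central S sq) k)
              (trans (⊛-comm 1-2z _ k) (trans (const-⊛ 1ℤ 1-2z k) (ℤₚ.*-identityˡ (1-2z k))))))
            (trans (⊛-· (ℤ.- 1ℤ) S 1-2z² k) (cong ((ℤ.- 1ℤ) ⋆_) (⊛-comm S 1-2z² k))))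

-- The closed formula

sumTo-sucʳ : ∀ n g → sumTo (suc n) g ≡ sumTo n g + g n
sumTo-sucʳ zero    g = +-identityʳ (g 0)
sumTo-sucʳ (suc n) g = trans (cong (g 0 +_) (sumTo-sucʳ n (g ∘ suc))) (sym (+-assoc (g 0) _ _))

sumTo-* : ∀ n c g → sumTo n (λ i → c * g i) ≡ c * sumTo n g
sumTo-* zero    c g = sym (*-zeroʳ c)
sumTo-* (suc n) c g = trans (cong (c * g 0 +_) (sumTo-* n c (g ∘ suc))) (sym (*-distribˡ-+ c (g 0) _))

foldr-applyUpTo : ∀ n g → foldr _+_ 0 (applyUpTo g n) ≡ sumTo n g
foldr-applyUpTo zero    g = refl
foldr-applyUpTo (suc n) g = cong (g 0 +_) (foldr-applyUpTo n (g ∘ suc))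

weighted : ℕ → ℕ → ℕ
weighted j k = 2 ^ (j ∸ k) * ((2 * k) C k)

-- Raising j doubles all previous weights and adds the term k = j with weight 2.
weighted-suc : ∀ j → sumTo (suc j) (weighted (suc j)) ≡ 2 * sumTo j (weighted j) + 2 * paths j j
weighted-suc j = trans (sumTo-sucʳ j (weighted (suc j))) (cong₂ _+_
  (trans (sumTo-cong j (λ {k} k<j → trans (cong (λ x → 2 ^ x * ((2 * k) C k)) (+-∸-assoc 1 (<⇒≤ k<j)))
           (*-assoc 2 (2 ^ (j ∸ k)) _))) (sumTo-* j 2 (weighted j)))
  (cong₂ _*_ (cong (2 ^_) (m+n∸n≡m 1 j)) (trans (cong (λ x → (j + x) C j) (+-identityʳ j)) (sym (paths≡C j j)))))

-- Passing from N to N + 1 doubles either side and adds 2 · C(2j,j) with j = N + 3. On the left, the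
-- growth of the factor 5 + N absorbs the power of two that accompanies `total (suc N)` in
-- `total-suc`.
total-formula : ∀ N → 2 * total N + (5 + N) * 2 ^ (2 + N) ≡ sumTo (3 + N) (weighted (3 + N))
total-formula zero    = refl
total-formula (suc N) =
  trans (lem1 (total (suc N)) (2 ^ N) N)
 (trans (cong (λ x → 2 * x + 2 * ((5 + N) * (2 * (2 * 2 ^ N)))) (total-suc N))
 (trans (lem2 (total N) (paths (3 + N) (3 + N)) ((5 + N) * (2 * (2 * 2 ^ N))))
 (trans (cong (λ x → 2 * x + 2 * paths (3 + N) (3 + N)) (total-formula N))
        (sym (weighted-suc (3 + N))))))
  where
  lem1 : ∀ t p N → 2 * t + (6 + N) * (2 * (2 * (2 * p))) ≡ 2 * (t + 2 * (2 * p)) + 2 * ((5 + N) * (2 * (2 * p)))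
  lem1 = solve-∀
  lem2 : ∀ t x y → 2 * (2 * t + x) + 2 * y ≡ 2 * (2 * t + y) + 2 * x
  lem2 = solve-∀

cards-formula : ∀ n → 7 ≤ n → ℤ.+ card n ≡ formula n
cards-formula (suc (suc (suc (suc (suc (suc (suc N))))))) _ =
  trans (lem (ℤ.+ (2 * total N)) (ℤ.+ ((5 + N) * 2 ^ (2 + N))))
        (cong (λ x → ℤ.+ x ⊖ ℤ.+ ((5 + N) * 2 ^ (2 + N)))
          (trans (total-formula N) (sym (trans (cong (foldr _+_ 0) (map-upTo (weighted (3 + N)) (3 + N))) (foldr-applyUpTo (3 + N) (weighted (3 + N)))))))
  where lem : ∀ x y → x ≡ (x ⊹ y) ⊖ y
        lem = ℤRS.solve-∀
cards-formula 0 ()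
cards-formula 1 (s≤s ())
cards-formula 2 (s≤s (s≤s ()))
cards-formula 3 (s≤s (s≤s (s≤s ())))
cards-formula 4 (s≤s (s≤s (s≤s (s≤s ()))))
cards-formula 5 (s≤s (s≤s (s≤s (s≤s (s≤s ())))))
cards-formula 6 (s≤s (s≤s (s≤s (s≤s (s≤s (s≤s ()))))))

open import Data.Integer using (+_)

theorem1p4 : Σ (ℕ → ℕ) λ a →
    (∀ n → Fin (a n) ↔ ASM3 n)
    × (∀ n → 7 ≤ n → + (a n) ≡ formula n)
    × (∀ n → n ≤ 6 → a n ≡ 0)
    × GFIdentity (λ n → + (a n))
theorem1p4 = card , Fin↔ASM3 , cards-formula , card-small , generating
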